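{- Let $T$ be a quadratic starlike tree containing $K_{1,3}$ as a proper induced subgraph, with characteristic polynomial $f_T(x)=\det(xI-A(T))$. Then $f_T(x)$ is of the form $$f_T(x)=x^{t_1}(x^2-1)^{t_2}(x^2-2)^{t_3}\big((x^2-x-1)(x^2+x-1)\big)^{t_4}(x^2-3)^{t_5}(x^2-c),$$ with integers $t_1,\dots,t_5\ge 0$, an integer $c\ge 4$, and $\lambda_1(T)$ a root of $x^2-c$ (form (I)), if and only if $T$ is one of the following four graphs; in each case the characteristic polynomial is as stated: (1) $T_{1,1,0,0,n_5}$ with $n_5\ge 1$, and $f_T(x)=x^{n_5}(x^2-1)^{n_5}(x^2-x-1)(x^2+x-1)(x^2-3)^{n_5-1}(x^2-(n_5+3))$; (2) $T_{1,0,n_3}$ with $n_3\ge 2$, and $f_T(x)=x^{n_3}(x^2-1)(x^2-2)^{n_3-1}(x^2-(n_3+2))$; (3) $T_{0,n_2}$ with $n_2\ge 3$, and $f_T(x)=x(x^2-1)^{n_2-1}(x^2-(n_2+1))$; (4) $T_{n_1}$ (the star $K_{1,n_1}$) with $n_1\ge 4$, and $f_T(x)=x^{n_1-1}(x^2-n_1)$.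
   Context: All graphs are simple and connected; eigenvalues are those of the adjacency matrix $A(G)$, ordered $\lambda_1(G)\ge\lambda_2(G)\ge\cdots$. A graph is quadratic if every eigenvalue is an algebraic integer of degree at most $2$, equivalently every irreducible factor over $\mathbb{Q}$ of its characteristic polynomial has degree at most $2$. $P_i$ denotes the path on $i$ vertices. The starlike tree $T_{n_1,n_2,\ldots,n_k}$ is the tree on $n_1+2n_2+\cdots+kn_k+1$ vertices consisting of a center vertex $u$ together with $n_i$ pendant paths $P_i$ (each joined by an edge from one endpoint to $u$), i.e. $T-u=\bigcup_{i=1}^k n_iP_i$; trailing zero indices may be omitted. -}

module Defs where

open import Data.Nat as ℕ using (ℕ; zero; suc; _≡ᵇ_)
open import Data.Integer as ℤ using (ℤ)
open import Data.Rational as ℚ using (ℚ)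
open import Data.Fin as Fin using (Fin; toℕ; punchIn)
open import Data.Fin.Properties using () renaming (_≟_ to _≟F_)
open import Data.List as List using (List; []; _∷_; _++_; replicate)
open import Data.Nat.ListAction using (sum)
open import Data.Bool.ListAction using (any)
open import Data.Bool using (Bool; true; false; if_then_else_; _∨_; _∧_)
open import Data.Product using (_×_; _,_; ∃; Σ)
open import Data.Sum using (_⊎_)
open import Relation.Binary.PropositionalEquality using (_≡_)
open import Relation.Nullary using (¬_; does)

-- Univariate polynomials over a (raw) ring, as coefficient lists
-- (constant coefficient first).  Equality is coefficientwise, so
-- trailing zeros are irrelevant.

module PolyOps {A : Set} (0# 1# : A) (_+_ _*_ : A → A → A) (-_ : A → A) where

  Poly : Set
  Poly = List A

  coeff : Poly → ℕ → A
  coeff []      _       = 0#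
  coeff (a ∷ p) zero    = a
  coeff (a ∷ p) (suc i) = coeff p i

  infix 4 _≈P_
  _≈P_ : Poly → Poly → Set
  p ≈P q = ∀ i → coeff p i ≡ coeff q i

  DegLe : Poly → ℕ → Set
  DegLe p d = ∀ i → d ℕ.< i → coeff p i ≡ 0#

  zeroP oneP X : Poly
  zeroP = []
  oneP  = 1# ∷ []
  X     = 0# ∷ 1# ∷ []

  infixl 6 _+P_
  infixl 7 _*P_
  _+P_ : Poly → Poly → Poly
  []      +P q       = q
  (a ∷ p) +P []      = a ∷ p
  (a ∷ p) +P (b ∷ q) = (a + b) ∷ (p +P q)

  negP : Poly → Poly
  negP = List.map -_

  scale : A → Poly → Poly
  scale a = List.map (a *_)

  _*P_ : Poly → Poly → Poly
  []      *P q = []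
  (a ∷ p) *P q = scale a q +P (0# ∷ (p *P q))

  _^P_ : Poly → ℕ → Poly
  p ^P zero  = oneP
  p ^P suc n = p *P (p ^P n)

  signed : ℕ → Poly → Poly
  signed zero    p = p
  signed (suc k) p = negP (signed k p)

  sumFin : (n : ℕ) → (Fin n → Poly) → Poly
  sumFin zero    f = zeroP
  sumFin (suc n) f = f Fin.zero +P sumFin n (λ j → f (Fin.suc j))

  det : (n : ℕ) → (Fin n → Fin n → Poly) → Poly
  det zero    M = oneP
  det (suc n) M =
    sumFin (suc n) λ j →
      signed (toℕ j) (M Fin.zero j *P det n (λ r c → M (Fin.suc r) (punchIn j c)))

module PZ = PolyOps (ℤ.+ 0) (ℤ.+ 1) ℤ._+_ ℤ._*_ ℤ.-_
module PQ = PolyOps ℚ.0ℚ ℚ.1ℚ ℚ._+_ ℚ._*_ ℚ.-_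

PolyZ PolyQ : Set
PolyZ = PZ.Poly
PolyQ = PQ.Poly

toQ : PolyZ → PolyQ
toQ = List.map (λ z → z ℚ./ 1)

IrreducibleQ : PolyQ → Set
IrreducibleQ g =
  ¬ PQ.DegLe g 0 ×
  (∀ a b → a PQ.*P b PQ.≈P g → PQ.DegLe a 0 ⊎ PQ.DegLe b 0)

QuadraticPoly : PolyZ → Set
QuadraticPoly f =
  ∀ g h → g PQ.*P h PQ.≈P toQ f → IrreducibleQ g → PQ.DegLe g 2

record Graph : Set where
  field
    n   : ℕ
    adj : Fin n → Fin n → Bool
open Graph public

charPoly : Graph → PolyZ
charPoly G = PZ.det (n G) λ i j →
  if does (i ≟F j) then PZ.X
  else (if adj G i j then (ℤ.- (ℤ.+ 1)) ∷ [] else [])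

record _≅_ (G H : Graph) : Set where
  field
    to      : Fin (n G) → Fin (n H)
    from    : Fin (n H) → Fin (n G)
    from∘to : ∀ i → from (to i) ≡ i
    to∘from : ∀ j → to (from j) ≡ j
    adj-pres : ∀ i j → adj H (to i) (to j) ≡ adj G i j

record InducedSub (H G : Graph) : Set where
  field
    emb      : Fin (n H) → Fin (n G)
    emb-inj  : ∀ i j → emb i ≡ emb j → i ≡ j
    adj-pres : ∀ i j → adj G (emb i) (emb j) ≡ adj H i j

ProperInducedSub : Graph → Graph → Set
ProperInducedSub H G = InducedSub H G × n H ℕ.< n G

-- Starlike trees T_{n_1,...,n_k}: centre 0, then the pendant paths laid
-- out consecutively; a list ns = n_1 ∷ n_2 ∷ ... ∷ n_k ∷ [].

pathLengths : ℕ → List ℕ → List ℕ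
pathLengths i []       = []
pathLengths i (m ∷ ns) = replicate m i ++ pathLengths (suc i) ns

chain : ℕ → ℕ → List (ℕ × ℕ)
chain o zero    = []
chain o (suc m) = (o , suc o) ∷ chain (suc o) m

pathEdges : ℕ → ℕ → List (ℕ × ℕ)
pathEdges o zero    = []
pathEdges o (suc L) = (0 , o) ∷ chain o L

edgesFrom : ℕ → List ℕ → List (ℕ × ℕ)
edgesFrom o []       = []
edgesFrom o (L ∷ Ls) = pathEdges o L ++ edgesFrom (o ℕ.+ L) Ls

starlike : List ℕ → Graph
starlike ns = record
  { n   = suc (sum Ls)
  ; adj = λ i j → any (λ { (a , b) →
              ((a ≡ᵇ toℕ i) ∧ (b ≡ᵇ toℕ j)) ∨ ((a ≡ᵇ toℕ j) ∧ (b ≡ᵇ toℕ i)) })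
            (edgesFrom 1 Ls)
  }
  where Ls = pathLengths 1 ns

K13 : Graph
K13 = starlike (3 ∷ [])

x²-[_] : ℤ → PolyZ
x²-[ k ] = ℤ.- k ∷ ℤ.+ 0 ∷ ℤ.+ 1 ∷ []

x²-x-1 x²+x-1 : PolyZ
x²-x-1 = ℤ.- (ℤ.+ 1) ∷ ℤ.- (ℤ.+ 1) ∷ ℤ.+ 1 ∷ []
x²+x-1 = ℤ.- (ℤ.+ 1) ∷ ℤ.+ 1 ∷ ℤ.+ 1 ∷ []

open PZ using (_*P_; _^P_; _≈P_; X) public

formI : ℕ → ℕ → ℕ → ℕ → ℕ → ℤ → PolyZ
formI t₁ t₂ t₃ t₄ t₅ c =
  (X ^P t₁) *P (x²-[ ℤ.+ 1 ] ^P t₂) *P (x²-[ ℤ.+ 2 ] ^P t₃)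
    *P ((x²-x-1 *P x²+x-1) ^P t₄) *P (x²-[ ℤ.+ 3 ] ^P t₅) *P x²-[ c ]

FormI : PolyZ → Set
FormI f = Σ ℕ λ t₁ → Σ ℕ λ t₂ → Σ ℕ λ t₃ → Σ ℕ λ t₄ → Σ ℕ λ t₅ → Σ ℤ λ c →
  ℤ.+ 4 ℤ.≤ c × f ≈P formI t₁ t₂ t₃ t₄ t₅ c

{-# OPTIONS --safe #-}
module Submission where

-- Let φ_L be the characteristic polynomial of the path with L vertices.  Attaching pendant paths to
-- the centre one at a time shows that a starlike tree with branch lengths L_1, ..., L_m has
-- characteristic polynomial Π φ_{L_i} (x - Σ φ_{L_i - 1} / φ_{L_i}).
--
-- Of the shape (I) only one consequence is needed: λ with λ² = c is a root for an integer c ≥ 4.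
-- There all φ_L are positive, so with r_L = λ φ_{L-1}(λ) / φ_L(λ) the equation becomes
-- Σ r_{L_i} = c.  As 1 = r_1 < r_2 < ... < (c - 2) / (c - 3), either m = c or m = c - 1.  In the first
-- case all branches have length 1.  In the second, comparing the excesses r_L - 1 with 1 / (m - 1) leaves
-- m branches of length 2, or one of length 1 and m - 1 of length 3, or one of length 1, one of
-- length 2 and m - 2 of length 5.

-- Two obstacles shape the proof. The determinant is a bare expansion along the first row, whereas a
-- graph isomorphism permutes rows and columns simultaneously, and the given layout puts the centre
-- first instead of a leaf. So invariance under simultaneous permutations is drawn from the
-- uniqueness of alternating multilinear forms, and a branch is reversed before it is peeled off
-- from its free end. The other obstacle is that λ need not be an integer while the multiplicities
-- are unknown. Values at λ are taken in ℤ[s] with s² = c and multiplied by a power of s that makes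
-- them integers. The equation Σ r = c is then treated as in linear programming: each case supplies
-- weights α L / δ bounding r L from one side; summed over the branches they leave too little room,
-- and where the sum is exact every length with a strict bound is excluded. The delicate case is one
-- branch of length 1 together with some of length 2. Lengths 3 and 4 then have ratios below r 5 and
-- lengths from 6 on above it, so two rounds are needed: an upper bound removes 3, 4 and further 2s,
-- and after that a lower bound removes the long branches.

module Determinants where

  open import Algebra.Bundles using (CommutativeRing)
  open import Data.Nat using (ℕ; zero; suc)
  open import Data.Fin as Fin using (Fin; zero; suc; toℕ; punchIn; punchOut)
  open import Data.Fin.Properties using (_≟_; suc-injective; any?; injective⇒≤; punchOut-injective; cantor-schröder-bernstein)
  open import Data.Nat.Properties using (1+n≰n)
  open import Data.Fin.Permutation using (Permutation′; permutation; _⟨$⟩ʳ_)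
  open import Data.Fin.Permutation.Components using (transpose)
  open import Data.Fin.Permutation.Transposition.List using (TranspositionList; eval; decompose; eval-decompose)
  open import Data.List using (List; []; _∷_)
  open import Data.Product using (_,_; ∃; proj₁; proj₂)
  open import Function using (_∘_)
  open import Relation.Nullary using (yes; no; does; contradiction)
  open import Relation.Nullary.Decidable using (dec-true; dec-false; ¬?; _×-dec_; decidable-stable)
  open import Data.Bool using (if_then_else_)
  open import Relation.Binary.PropositionalEquality as ≡ using (_≡_; _≢_)
  import Level

  -- Alternating multilinear forms over a commutative ring.

  module Det {c ℓ} (R : CommutativeRing c ℓ) where
    open CommutativeRing R hiding (zero)
    import Algebra.Properties.Semiring.Sum semiring as S
    open import Algebra.Properties.Ring ring using (-‿distribˡ-*; -‿distribʳ-*; -‿+-comm; -‿involutive; -0#≈0#)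
    open import Relation.Binary.Reasoning.Setoid setoid
    open import Algebra.Properties.CommutativeSemigroup +-commutativeSemigroup using (interchange)
    open import Algebra.Properties.CommutativeSemigroup *-commutativeSemigroup using (x∙yz≈y∙xz)

    Row : ℕ → Set c
    Row m = Fin m → Carrier

    Mat : ℕ → ℕ → Set c
    Mat n m = Fin n → Row m

    -- Opaque, because unification would otherwise unfold sums over Fin (suc n).
    opaque
      sum : ∀ {n} → (Fin n → Carrier) → Carrier
      sum = S.sum

      sum-empty : ∀ (f : Fin 0 → Carrier) → sum f ≈ 0#
      sum-empty f = refl

      sum-suc : ∀ {n} (f : Fin (suc n) → Carrier) → sum f ≈ f zero + sum (λ i → f (suc i))
      sum-suc f = refl

      sum-cong-≋ : ∀ {n} {f g : Fin n → Carrier} → (∀ i → f i ≈ g i) → sum f ≈ sum g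
      sum-cong-≋ = S.sum-cong-≋

      ∑-distrib-+ : ∀ {n} (f g : Fin n → Carrier) → sum (λ i → f i + g i) ≈ sum f + sum g
      ∑-distrib-+ = S.∑-distrib-+

      *-distribˡ-sum : ∀ {n} x (f : Fin n → Carrier) → x * sum f ≈ sum (λ i → x * f i)
      *-distribˡ-sum = S.*-distribˡ-sum

      sum-zero : ∀ {n} (f : Fin n → Carrier) → (∀ i → f i ≈ 0#) → sum f ≈ 0#
      sum-zero {n} f h = trans (S.sum-cong-≋ h) (S.sum-replicate-zero n)

    signed : ℕ → Carrier → Carrier
    signed zero    p = p
    signed (suc k) p = - signed k p

    det : ∀ n → Mat n n → Carrier
    det zero    M = 1#
    det (suc n) M = sum λ j → signed (toℕ j) (M zero j * det n (λ r k → M (suc r) (punchIn j k)))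

    signed-cong : ∀ k {a b} → a ≈ b → signed k a ≈ signed k b
    signed-cong zero    e = e
    signed-cong (suc k) e = -‿cong (signed-cong k e)

    signed-0 : ∀ k → signed k 0# ≈ 0#
    signed-0 zero    = refl
    signed-0 (suc k) = trans (-‿cong (signed-0 k)) -0#≈0#

    signed-+ : ∀ k a b → signed k (a + b) ≈ signed k a + signed k b
    signed-+ zero    a b = refl
    signed-+ (suc k) a b = trans (-‿cong (signed-+ k a b)) (sym (-‿+-comm _ _))

    signed-* : ∀ k a b → signed k (a * b) ≈ a * signed k b
    signed-* zero    a b = refl
    signed-* (suc k) a b = trans (-‿cong (signed-* k a b)) (-‿distribʳ-* _ _)

    signed-neg : ∀ k a → signed k (- a) ≈ - signed k a
    signed-neg zero    a = refl
    signed-neg (suc k) a = -‿cong (signed-neg k a)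

    sum-neg : ∀ {n} (f : Fin n → Carrier) → sum (λ i → - f i) ≈ - sum f
    sum-neg {zero}  f = trans (sum-empty _) (sym (trans (-‿cong (sum-empty f)) -0#≈0#))
    sum-neg {suc n} f = trans (sum-suc _) (trans (+-congˡ (sum-neg _)) (trans (-‿+-comm _ _) (-‿cong (sym (sum-suc f)))))

    -- The law `linear` speaks of three matrices that agree off row `i`, so additivity and
    -- homogeneity come as one law and no row update is needed to state it.
    record Multilinear {n m} (D : Mat n m → Carrier) : Set (c Level.⊔ ℓ) where
      field
        cong : ∀ {A B} → (∀ i j → A i j ≈ B i j) → D A ≈ D B
        linear : ∀ i r {A B C} →
          (∀ k → k ≢ i → ∀ j → A k j ≈ B k j) →
          (∀ k → k ≢ i → ∀ j → A k j ≈ C k j) →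
          (∀ j → A i j ≈ B i j + r * C i j) →
          D A ≈ D B + r * D C

      zero-row : ∀ i {A} → (∀ j → A i j ≈ 0#) → D A ≈ 0#
      zero-row i {A} h = begin
        -- A zero row satisfies v = v + (-1) v, so linearity applied to three copies of `A` gives D
        -- A = D A - D A.
        D A                ≈⟨ linear i (- 1#) (λ _ _ _ → refl) (λ _ _ _ → refl) row ⟩
        D A + - 1# * D A   ≈⟨ cancel (D A) ⟩
        0#                 ∎
        where
        cancel : ∀ x → x + - 1# * x ≈ 0#
        cancel x = trans (+-congˡ (trans (sym (-‿distribˡ-* 1# x)) (-‿cong (*-identityˡ x)))) (-‿inverseʳ x)
        row : ∀ j → A i j ≈ A i j + - 1# * A i j
        row j = trans (h j) (sym (cancel (A i j)))

    Alternating : ∀ {n m} → (Mat n m → Carrier) → Set (c Level.⊔ ℓ)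
    Alternating D = ∀ {i k} → i ≢ k → ∀ {A} → (∀ j → A i j ≈ A k j) → D A ≈ 0#

    δ : ∀ {m} → Fin m → Row m
    δ i j = if does (i ≟ j) then 1# else 0#


    _∷ᵣ_ : ∀ {n m} → Row m → Mat n m → Mat (suc n) m
    (v ∷ᵣ A) zero    = v
    (v ∷ᵣ A) (suc i) = A i

    sum-δ : ∀ {m} (v : Row m) j → v j ≈ sum (λ k → v k * δ k j)
    sum-δ {suc m} v zero = sym (trans (sum-suc _) (trans
      (+-cong (*-identityʳ _) (sum-zero {m} _ (λ k → zeroʳ _))) (+-identityʳ _)))
    sum-δ {suc m} v (suc j) = sym (trans (sum-suc _) (trans
      (+-cong (zeroʳ _) (sym (sum-δ (v ∘ suc) j))) (+-identityˡ _)))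

    head-sum : ∀ {n m} {D : Mat (suc n) m → Carrier} → Multilinear D → ∀ {k} (a : Fin k → Carrier) (w : Fin k → Row m) A →
      D ((λ j → sum (λ i → a i * w i j)) ∷ᵣ A) ≈ sum (λ i → a i * D (w i ∷ᵣ A))
    head-sum mD {zero}  a w A = trans (Multilinear.zero-row mD zero (λ _ → sum-empty _)) (sym (sum-empty _))
    head-sum {D = D} mD {suc k} a w A = begin
      D ((λ j → sum (λ i → a i * w i j)) ∷ᵣ A)       ≈⟨ linear zero (a zero) (tails s) (tails (w zero)) (λ j → trans (sum-suc _) (+-comm _ _)) ⟩
      D (s ∷ᵣ A) + a zero * D (w zero ∷ᵣ A)          ≈⟨ +-comm _ _ ⟩
      a zero * D (w zero ∷ᵣ A) + D (s ∷ᵣ A)          ≈⟨ +-congˡ (head-sum mD (a ∘ suc) (w ∘ suc) A) ⟩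
      a zero * D (w zero ∷ᵣ A) + sum (λ i → a (suc i) * D (w (suc i) ∷ᵣ A)) ≈⟨ sym (sum-suc _) ⟩
      sum (λ i → a i * D (w i ∷ᵣ A))                 ∎
      where
      open Multilinear mD
      s : Row _
      s j = sum (λ i → a (suc i) * w (suc i) j)
      tails : ∀ {v} w′ k → k ≢ zero → ∀ j → (v ∷ᵣ A) k j ≈ (w′ ∷ᵣ A) k j
      tails w′ zero    k≢0 j = contradiction ≡.refl k≢0
      tails w′ (suc k) _   j = refl

    ∷ᵣ-multilinear : ∀ {n m} {D : Mat (suc n) m → Carrier} → Multilinear D → ∀ v → Multilinear (λ A → D (v ∷ᵣ A))
    ∷ᵣ-multilinear mD v = record
      { cong   = λ h → cong λ { zero j → refl ; (suc i) j → h i j }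
      ; linear = λ i r hB hC hi → linear (suc i) r
          (λ { zero _ j → refl ; (suc k) k≢i j → hB k (k≢i ∘ ≡.cong suc) j })
          (λ { zero _ j → refl ; (suc k) k≢i j → hC k (k≢i ∘ ≡.cong suc) j })
          hi
      }
      where open Multilinear mD

    -- The first row is a combination of the rows of δ; once it is replaced by one of them, the form
    -- in the remaining rows is again multilinear, and induction applies.
    vanishing-on-basis : ∀ {n m} {D : Mat n m → Carrier} → Multilinear D →
      (∀ (f : Fin n → Fin m) → D (δ ∘ f) ≈ 0#) → ∀ A → D A ≈ 0#
    vanishing-on-basis {zero}  mD h A = trans (Multilinear.cong mD (λ ())) (h (λ ()))
    vanishing-on-basis {suc n} {D = D} mD h A = begin
      D A                                                      ≈⟨ cong (λ { zero j → sum-δ (A zero) j ; (suc i) j → refl }) ⟩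
      D ((λ j → sum (λ k → A zero k * δ k j)) ∷ᵣ (A ∘ suc))    ≈⟨ head-sum mD (A zero) δ (A ∘ suc) ⟩
      sum (λ k → A zero k * D (δ k ∷ᵣ (A ∘ suc)))              ≈⟨ sum-zero _ (λ k → trans (*-congˡ (vanish k)) (zeroʳ _)) ⟩
      0#                                                       ∎
      where
      open Multilinear mD
      vanish : ∀ k → D (δ k ∷ᵣ (A ∘ suc)) ≈ 0#
      vanish k = vanishing-on-basis (∷ᵣ-multilinear mD (δ k))
        (λ f → trans (cong λ { zero j → refl ; (suc i) j → refl }) (h λ { zero → k ; (suc i) → f i })) (A ∘ suc)

    module Swap {n m} {D : Mat n m → Carrier} (mD : Multilinear D) (aD : Alternating D) {i k : Fin n} (i≢k : i ≢ k) where
      open Multilinear mD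

      place : Mat n m → Row m → Row m → Mat n m
      place A u v r = if does (r ≟ i) then u else (if does (r ≟ k) then v else A r)

      at-i : ∀ A u v → place A u v i ≡ u
      at-i A u v rewrite dec-true (i ≟ i) ≡.refl = ≡.refl

      at-k : ∀ A u v → place A u v k ≡ v
      at-k A u v rewrite dec-false (k ≟ i) (i≢k ∘ ≡.sym) | dec-true (k ≟ k) ≡.refl = ≡.refl

      off-i : ∀ A u u′ v r → r ≢ i → place A u v r ≡ place A u′ v r
      off-i A u u′ v r r≢i rewrite dec-false (r ≟ i) r≢i = ≡.refl

      off-k : ∀ A u v v′ r → r ≢ k → place A u v r ≡ place A u v′ r
      off-k A u v v′ r r≢k rewrite dec-false (r ≟ k) r≢k = ≡.refl

      place-same : ∀ A r j → place A (A i) (A k) r j ≈ A r j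
      place-same A r j with r ≟ i
      ... | yes ≡.refl = refl
      ... | no _ with r ≟ k
      ...   | yes ≡.refl = refl
      ...   | no _ = refl

      place-swap : ∀ A r j → place A (A k) (A i) r j ≈ A (transpose i k r) j
      place-swap A r j with r ≟ i
      ... | yes _ = refl
      ... | no _ with r ≟ k
      ...   | yes _ = refl
      ...   | no _ = refl

      _⊞_ : Row m → Row m → Row m
      (u ⊞ v) j = u j + 1# * v j

      row≈ : ∀ {u v : Row m} → u ≡ v → ∀ j → u j ≈ v j
      row≈ ≡.refl j = refl

      expandᵢ : ∀ A u u′ v → D (place A (u ⊞ u′) v) ≈ D (place A u v) + 1# * D (place A u′ v)
      expandᵢ A u u′ v = linear i 1#
        (λ r r≢i → row≈ (off-i A (u ⊞ u′) u v r r≢i))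
        (λ r r≢i → row≈ (off-i A (u ⊞ u′) u′ v r r≢i))
        (λ j → reflexive (≡.trans (≡.cong (λ w → w j) (at-i A (u ⊞ u′) v))
          (≡.sym (≡.cong₂ (λ w w′ → w j + 1# * w′ j) (at-i A u v) (at-i A u′ v)))))

      expandₖ : ∀ A u v v′ → D (place A u (v ⊞ v′)) ≈ D (place A u v) + 1# * D (place A u v′)
      expandₖ A u v v′ = linear k 1#
        (λ r r≢k → row≈ (off-k A u (v ⊞ v′) v r r≢k))
        (λ r r≢k → row≈ (off-k A u (v ⊞ v′) v′ r r≢k))
        (λ j → reflexive (≡.trans (≡.cong (λ w → w j) (at-k A u (v ⊞ v′)))
          (≡.sym (≡.cong₂ (λ w w′ → w j + 1# * w′ j) (at-k A u v) (at-k A u v′)))))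

      diagonal : ∀ A u → D (place A u u) ≈ 0#
      diagonal A u = aD i≢k (row≈ (≡.trans (at-i A u u) (≡.sym (at-k A u u))))

      -- Polarisation: with u and v the two rows, D is expanded at u + v in both places. The value
      -- there and the two diagonal terms vanish, which leaves the two mixed terms.
      swap : ∀ A → D (A ∘ transpose i k) + D A ≈ 0#
      swap A = begin
        D (A ∘ transpose i k) + D A
          ≈⟨ +-cong (sym (cong (place-swap A))) (sym (cong (place-same A))) ⟩
        D (place A v u) + D (place A u v)
          ≈⟨ +-cong (sym (one (diagonal A v))) (sym (one′ (diagonal A u))) ⟩
        (D (place A v u) + 1# * D (place A v v)) + (D (place A u u) + 1# * D (place A u v))
          ≈⟨ +-cong (sym (expandₖ A v u v)) (sym (expandₖ A u u v)) ⟩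
        D (place A v (u ⊞ v)) + D (place A u (u ⊞ v))
          ≈⟨ trans (+-comm _ _) (+-congˡ (sym (*-identityˡ _))) ⟩
        D (place A u (u ⊞ v)) + 1# * D (place A v (u ⊞ v))
          ≈⟨ sym (expandᵢ A u v (u ⊞ v)) ⟩
        D (place A (u ⊞ v) (u ⊞ v))
          ≈⟨ diagonal A (u ⊞ v) ⟩
        0# ∎
        where
        u = A i
        v = A k
        one : ∀ {x z} → z ≈ 0# → x + 1# * z ≈ x
        one z≈0 = trans (+-congˡ (trans (*-identityˡ _) z≈0)) (+-identityʳ _)
        one′ : ∀ {x z} → z ≈ 0# → z + 1# * x ≈ x
        one′ z≈0 = trans (+-cong z≈0 (*-identityˡ _)) (+-identityˡ _)

      swap-vanishing : ∀ A → D A ≈ 0# → D (A ∘ transpose i k) ≈ 0#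
      swap-vanishing A h = trans (sym (trans (+-congˡ h) (+-identityʳ _))) (swap A)

    transpose-vanishing : ∀ {n m} {D : Mat n m → Carrier} → Multilinear D → Alternating D →
      ∀ i k A → D A ≈ 0# → D (A ∘ transpose i k) ≈ 0#
    transpose-vanishing {D = D} mD aD i k A h with i ≟ k
    ... | no i≢k = Swap.swap-vanishing mD aD i≢k A h
    ... | yes ≡.refl = trans (Multilinear.cong mD same) h
      where
      same : ∀ r j → A (transpose i i r) j ≈ A r j
      same r j with r ≟ i
      ... | yes ≡.refl = refl
      ... | no r≢i rewrite dec-false (r ≟ i) r≢i = refl

    -- Only vanishing is carried along the transpositions, so the sign of the permutation never has
    -- to be defined.
    permute-vanishing : ∀ {n m} {D : Mat n m → Carrier} → Multilinear D → Alternating D →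
      ∀ (ts : TranspositionList n) A → D A ≈ 0# → D (A ∘ (eval ts ⟨$⟩ʳ_)) ≈ 0#
    permute-vanishing mD aD []             A h = h
    permute-vanishing mD aD ((i , k) ∷ ts) A h =
      transpose-vanishing mD aD i k (A ∘ (eval ts ⟨$⟩ʳ_)) (permute-vanishing mD aD ts A h)

    injective⇒surjective : ∀ {n} (f : Fin n → Fin n) → (∀ {i k} → f i ≡ f k → i ≡ k) → ∀ j → ∃ λ i → f i ≡ j
    injective⇒surjective {suc n} f inj j with any? (λ i → f i ≟ j)
    ... | yes hit = hit
    ... | no miss = contradiction (injective⇒≤ {f = λ i → punchOut (avoid i)} (λ {i} {k} e → inj (punchOut-injective (avoid i) (avoid k) e))) 1+n≰n
      where
      avoid : ∀ i → j ≢ f i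
      avoid i e = miss (i , ≡.sym e)

    -- Uniqueness of the determinant up to a factor. On rows of δ selected by `f`, a repeated value
    -- of `f` gives two equal rows; otherwise `f` is a permutation, and a product of transpositions
    -- leads back to δ.
    alternating-vanishing : ∀ {n} {D : Mat n n → Carrier} → Multilinear D → Alternating D → D δ ≈ 0# → ∀ A → D A ≈ 0#
    alternating-vanishing {n} {D} mD aD h = vanishing-on-basis mD basis
      where
      open Multilinear mD
      basis : ∀ f → D (δ ∘ f) ≈ 0#
      basis f with any? (λ i → any? (λ k → ¬? (i ≟ k) ×-dec (f i ≟ f k)))
      ... | yes (i , k , i≢k , e) = aD i≢k (λ j → reflexive (≡.cong (λ x → δ x j) e))
      ... | no none = trans (cong (λ i j → reflexive (≡.cong (λ x → δ x j) (≡.sym (eval-decompose π i)))))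
                        (permute-vanishing mD aD (decompose π) δ h)
        where
        inj : ∀ {i k} → f i ≡ f k → i ≡ k
        inj {i} {k} e = decidable-stable (i ≟ k) (λ i≢k → none (i , k , i≢k , e))
        onto = injective⇒surjective f inj
        π : Permutation′ n
        π = permutation f (proj₁ ∘ onto) (proj₂ ∘ onto) (λ i → inj (proj₂ (onto (f i))))

    -- The expansion along the first row as an alternating form, and its invariance.

    minor : ∀ {n} → Mat (suc n) (suc n) → Fin (suc n) → Mat n n
    minor M j r k = M (suc r) (punchIn j k)

    det-cong : ∀ n {A B} → (∀ i j → A i j ≈ B i j) → det n A ≈ det n B
    det-cong zero    h = refl
    det-cong (suc n) h = sum-cong-≋ λ j →
      signed-cong (toℕ j) (*-cong (h zero j) (det-cong n λ r k → h (suc r) (punchIn j k)))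

    sum-linear : ∀ {n} r {a b c : Fin n → Carrier} → (∀ i → a i ≈ b i + r * c i) → sum a ≈ sum b + r * sum c
    sum-linear {n} r {a} {b} {c} h = begin
      sum a                              ≈⟨ sum-cong-≋ h ⟩
      sum (λ i → b i + r * c i)          ≈⟨ ∑-distrib-+ b _ ⟩
      sum b + sum (λ i → r * c i)        ≈⟨ +-congˡ (sym (*-distribˡ-sum r c)) ⟩
      sum b + r * sum c                  ∎

    signed-linear : ∀ k r {a b c} → a ≈ b + r * c → signed k a ≈ signed k b + r * signed k c
    signed-linear k r {a} {b} {c} h = trans (signed-cong k h) (trans (signed-+ k b (r * c)) (+-congˡ (signed-* k r c)))

    det-linear : ∀ n i r {A B C} →
      (∀ k → k ≢ i → ∀ j → A k j ≈ B k j) →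
      (∀ k → k ≢ i → ∀ j → A k j ≈ C k j) →
      (∀ j → A i j ≈ B i j + r * C i j) →
      det n A ≈ det n B + r * det n C
    det-linear (suc n) zero r {A} {B} {C} hB hC hi = sum-linear r λ j → signed-linear (toℕ j) r (begin
      A zero j * det n (minor A j)
        ≈⟨ trans (*-congʳ (hi j)) (distribʳ _ _ _) ⟩
      B zero j * det n (minor A j) + r * C zero j * det n (minor A j)
        ≈⟨ +-cong (*-congˡ (det-cong n {minor A j} {minor B j} λ i k → hB (suc i) (λ ()) _))
                  (trans (*-congˡ (det-cong n {minor A j} {minor C j} λ i k → hC (suc i) (λ ()) _)) (*-assoc _ _ _)) ⟩
      B zero j * det n (minor B j) + r * (C zero j * det n (minor C j)) ∎)
    det-linear (suc n) (suc i) r {A} {B} {C} hB hC hi = sum-linear r λ j → signed-linear (toℕ j) r (begin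
      A zero j * det n (minor A j)
        ≈⟨ *-congˡ (det-linear n i r {minor A j} {minor B j} {minor C j} (λ k k≢i l → hB (suc k) (k≢i ∘ suc-injective) _)
                                     (λ k k≢i l → hC (suc k) (k≢i ∘ suc-injective) _) (λ l → hi _)) ⟩
      A zero j * (det n (minor B j) + r * det n (minor C j))
        ≈⟨ distribˡ _ _ _ ⟩
      A zero j * det n (minor B j) + A zero j * (r * det n (minor C j))
        ≈⟨ +-cong (*-congʳ (hB zero (λ ()) j)) (trans (*-congʳ (hC zero (λ ()) j)) (x∙yz≈y∙xz _ _ _)) ⟩
      B zero j * det n (minor B j) + r * (C zero j * det n (minor C j)) ∎)

    det-multilinear : ∀ n → Multilinear (det n)
    det-multilinear n = record { cong = det-cong n ; linear = det-linear n }

    -- The terms of the expansion along two rows are indexed by ordered pairs of distinct columns;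
    -- for equal rows the terms of a pair and of the reversed pair cancel.
    pairs-cancel : ∀ n (v : Row (suc (suc n))) (H : (Fin n → Fin (suc (suc n))) → Carrier) →
      (∀ {e e′} → (∀ i → e i ≡ e′ i) → H e ≈ H e′) →
      sum (λ j → signed (toℕ j) (v j * sum (λ k → signed (toℕ k) (v (punchIn j k) * H (λ i → punchIn j (punchIn k i)))))) ≈ 0#
    pairs-cancel n v H H-cong = begin
      sum (λ j → signed (toℕ j) (v j * sum (λ k → signed (toℕ k) (v (punchIn j k) * H (λ i → punchIn j (punchIn k i))))))
        ≈⟨ trans (sum-suc _) (+-congˡ (sum-cong-≋ λ j → -‿cong (signed-cong (toℕ j) (*-congˡ (sum-suc _))))) ⟩
      v zero * sum (λ k → signed (toℕ k) (v (suc k) * H₀ k)) + sum (λ j → - signed (toℕ j) (v (suc j) * (v zero * H₀ j + rest j)))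
        ≈⟨ +-cong (trans (*-distribˡ-sum (v zero) _) (sum-cong-≋ λ k → sym (signed-* (toℕ k) (v zero) (v (suc k) * H₀ k))))
                  (sum-cong-≋ λ j → -‿cong (trans (signed-cong (toℕ j) (trans (distribˡ _ _ _) (+-congʳ (x∙yz≈y∙xz (v (suc j)) (v zero) (H₀ j))))) (signed-+ (toℕ j) _ _))) ⟩
      sum first + sum (λ j → - (first j + signed (toℕ j) (v (suc j) * rest j)))
        ≈⟨ +-congˡ (trans (sum-neg _) (-‿cong (∑-distrib-+ first _))) ⟩
      sum first + - (sum first + sum (λ j → signed (toℕ j) (v (suc j) * rest j)))
        ≈⟨ +-congˡ (-‿cong (trans (+-congˡ (rest-zero n v H H-cong)) (+-identityʳ _))) ⟩
      sum first + - sum first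
        ≈⟨ -‿inverseʳ _ ⟩
      0# ∎
      where
      H₀ : Fin (suc n) → Carrier
      H₀ k = H (λ i → suc (punchIn k i))
      first rest : Fin (suc n) → Carrier
      first k = signed (toℕ k) (v zero * (v (suc k) * H₀ k))
      rest j = sum (λ k → - signed (toℕ k) (v (suc (punchIn j k)) * H (λ i → punchIn (suc j) (punchIn (suc k) i))))
      -- These are the pairs that avoid column 0. Column 0 is then always the first of the columns
      -- left over, so it can be absorbed into `H`, and the same sum with one column fewer remains.
      rest-zero : ∀ n (v : Row (suc (suc n))) (H : (Fin n → Fin (suc (suc n))) → Carrier) →
        (∀ {e e′} → (∀ i → e i ≡ e′ i) → H e ≈ H e′) →
        sum (λ j → signed (toℕ j) (v (suc j) * sum (λ k → - signed (toℕ k) (v (suc (punchIn j k)) * H (λ i → punchIn (suc j) (punchIn (suc k) i)))))) ≈ 0#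
      rest-zero zero v H H-cong = sum-zero {1} _ (λ j → trans (signed-cong (toℕ j) (trans (*-congˡ {v (suc j)} (sum-empty _)) (zeroʳ _))) (signed-0 (toℕ j)))
      rest-zero (suc n) v H H-cong = begin
        sum (λ j → signed (toℕ j) (v (suc j) * sum (λ k → - signed (toℕ k) (v (suc (punchIn j k)) * H (λ i → punchIn (suc j) (punchIn (suc k) i))))))
          ≈⟨ sum-cong-≋ (λ j → trans (signed-cong (toℕ j) (trans (*-congˡ (trans (sum-neg _) (-‿cong (sum-cong-≋ λ k → signed-cong (toℕ k) (*-congˡ {v (suc (punchIn j k))} (H-cong (lift j k))))))) (sym (-‿distribʳ-* _ _)))) (signed-neg (toℕ j) _)) ⟩
        sum (λ j → - signed (toℕ j) (v (suc j) * sum (λ k → signed (toℕ k) (v (suc (punchIn j k)) * H′ (λ i → punchIn j (punchIn k i))))))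
          ≈⟨ sum-neg _ ⟩
        - sum (λ j → signed (toℕ j) (v (suc j) * sum (λ k → signed (toℕ k) (v (suc (punchIn j k)) * H′ (λ i → punchIn j (punchIn k i))))))
          ≈⟨ -‿cong (pairs-cancel n (v ∘ suc) H′ (λ h → H-cong λ { zero → ≡.refl ; (suc i) → ≡.cong suc (h i) })) ⟩
        - 0#
          ≈⟨ -0#≈0# ⟩
        0# ∎
        where
        ↑_ : (Fin n → Fin (suc (suc n))) → Fin (suc n) → Fin (suc (suc (suc n)))
        (↑ e) zero    = zero
        (↑ e) (suc i) = suc (e i)
        H′ : (Fin n → Fin (suc (suc n))) → Carrier
        H′ e = H (↑ e)
        lift : ∀ j k i → punchIn (suc j) (punchIn (suc k) i) ≡ (↑ (λ i → punchIn j (punchIn k i))) i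
        lift j k zero    = ≡.refl
        lift j k (suc i) = ≡.refl

    equal-top-rows : ∀ n {A} → (∀ j → A zero j ≈ A (suc zero) j) → det (suc (suc n)) A ≈ 0#
    equal-top-rows n {A} h = begin
      det (suc (suc n)) A
        ≈⟨ sum-cong-≋ (λ j → signed-cong (toℕ j) (*-congˡ {A zero j} (sum-cong-≋ λ k → signed-cong (toℕ k) (*-congʳ {det n (minor (minor A j) k)} (sym (h (punchIn j k))))))) ⟩
      _ ≈⟨ pairs-cancel n (A zero) (λ e → det n (λ r i → A (suc (suc r)) (e i)))
             (λ {e} {e′} h → det-cong n {λ r i → A (suc (suc r)) (e i)} {λ r i → A (suc (suc r)) (e′ i)} λ r i → reflexive (≡.cong (A (suc (suc r))) (h i))) ⟩
      0# ∎

    -- The exchange τ fixes the top row and moves the row equal to it directly below, where the case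
    -- of adjacent top rows applies. In each minor τ acts as a transposition and changes the sign by
    -- induction, so the two determinants add up to zero.
    equal-to-top-row : ∀ n → Alternating (det (suc n)) → ∀ k A → (∀ j → A zero j ≈ A (suc k) j) → det (suc (suc n)) A ≈ 0#
    equal-to-top-row n alt zero    A h = equal-top-rows n {A} h
    equal-to-top-row n alt (suc k) A h = begin
      det (suc (suc n)) A
        ≈⟨ trans (sym (+-identityˡ _)) (+-congʳ (sym (equal-top-rows n {A ∘ τ} h))) ⟩
      det (suc (suc n)) (A ∘ τ) + det (suc (suc n)) A
        ≈⟨ sym (∑-distrib-+ _ _) ⟩
      sum (λ j → signed (toℕ j) (A zero j * det (suc n) (minor (A ∘ τ) j)) + signed (toℕ j) (A zero j * det (suc n) (minor A j)))
        ≈⟨ sum-zero _ (λ j → trans (sym (signed-+ (toℕ j) _ _)) (trans (signed-cong (toℕ j) (vanish j)) (signed-0 (toℕ j)))) ⟩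
      0# ∎
      where
      τ : Fin (suc (suc n)) → Fin (suc (suc n))
      τ zero    = zero
      τ (suc i) = suc (transpose zero (suc k) i)
      vanish : ∀ j → A zero j * det (suc n) (minor (A ∘ τ) j) + A zero j * det (suc n) (minor A j) ≈ 0#
      vanish j = trans (sym (distribˡ _ _ _))
        (trans (*-congˡ (Swap.swap (det-multilinear (suc n)) alt {zero} {suc k} (λ ()) (minor A j))) (zeroʳ _))

    det-alternating : ∀ n → Alternating (det n)
    det-alternating (suc n) {zero} {zero} i≢k {A} h = contradiction ≡.refl i≢k
    det-alternating (suc (suc n)) {zero} {suc k} _ {A} h = equal-to-top-row n (det-alternating (suc n)) k A h
    det-alternating (suc (suc n)) {suc i} {zero} _ {A} h = equal-to-top-row n (det-alternating (suc n)) i A (λ j → sym (h j))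
    det-alternating (suc n) {suc i} {suc k} i≢k {A} h = sum-zero _ λ j →
      trans (signed-cong (toℕ j) (trans (*-congˡ {A zero j} (det-alternating n (i≢k ∘ ≡.cong suc) {minor A j} (λ l → h (punchIn j l)))) (zeroʳ _))) (signed-0 (toℕ j))

    -- The difference of both sides, as a function of `A`, is multilinear and alternating, and it
    -- vanishes at δ because an injective ρ preserves δ. By uniqueness it is zero.
    det-permute : ∀ n (ρ : Fin n → Fin n) → (∀ {i k} → ρ i ≡ ρ k → i ≡ k) →
      ∀ A → det n (λ i j → A (ρ i) (ρ j)) ≈ det n A
    det-permute n ρ inj A = begin
      D₁ A                        ≈⟨ sym (+-identityʳ _) ⟩
      D₁ A + 0#                   ≈⟨ +-congˡ (sym (-‿inverseˡ _)) ⟩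
      D₁ A + (- det n A + det n A) ≈⟨ sym (+-assoc _ _ _) ⟩
      D A + det n A               ≈⟨ +-congʳ (alternating-vanishing D-multilinear D-alternating D-δ A) ⟩
      0# + det n A                ≈⟨ +-identityˡ _ ⟩
      det n A                     ∎
      where
      D₁ D : Mat n n → Carrier
      D₁ A = det n (λ i j → A (ρ i) (ρ j))
      D A = D₁ A - det n A
      ρ⁻¹ = injective⇒surjective ρ inj
      D₁-linear : ∀ i r {A B C} → (∀ k → k ≢ i → ∀ j → A k j ≈ B k j) → (∀ k → k ≢ i → ∀ j → A k j ≈ C k j) →
        (∀ j → A i j ≈ B i j + r * C i j) → D₁ A ≈ D₁ B + r * D₁ C
      D₁-linear i r hB hC hi with ρ⁻¹ i
      ... | i′ , ≡.refl = det-linear n i′ r (λ k k≢ j → hB (ρ k) (k≢ ∘ inj) (ρ j)) (λ k k≢ j → hC (ρ k) (k≢ ∘ inj) (ρ j)) (λ j → hi (ρ j))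
      D-multilinear : Multilinear D
      D-multilinear = record
        { cong   = λ h → +-cong (det-cong n λ i j → h (ρ i) (ρ j)) (-‿cong (det-cong n h))
        ; linear = λ i r {A} {B} {C} hB hC hi → begin
            D₁ A - det n A
              ≈⟨ +-cong (D₁-linear i r hB hC hi) (-‿cong (det-linear n i r hB hC hi)) ⟩
            (D₁ B + r * D₁ C) - (det n B + r * det n C)
              ≈⟨ +-congˡ (trans (sym (-‿+-comm _ _)) (+-congˡ (-‿distribʳ-* _ _))) ⟩
            (D₁ B + r * D₁ C) + (- det n B + r * - det n C)
              ≈⟨ interchange _ _ _ _ ⟩
            D B + (r * D₁ C + r * - det n C)
              ≈⟨ +-congˡ (sym (distribˡ r _ _)) ⟩
            D B + r * D C ∎
        }
      D-alternating : Alternating D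
      D-alternating {i} {k} i≢k {A} h = trans (+-cong alt₁ (trans (-‿cong (det-alternating n i≢k h)) -0#≈0#)) (+-identityʳ _)
        where
        alt₁ : D₁ A ≈ 0#
        alt₁ with ρ⁻¹ i | ρ⁻¹ k
        ... | i′ , ≡.refl | k′ , ≡.refl = det-alternating n (i≢k ∘ ≡.cong ρ) (λ j → h (ρ j))
      δ-ρ : ∀ i j → δ (ρ i) (ρ j) ≈ δ i j
      δ-ρ i j with i ≟ j
      ... | yes ≡.refl rewrite dec-true (ρ i ≟ ρ i) ≡.refl = refl
      ... | no i≢j rewrite dec-false (ρ i ≟ ρ j) (i≢j ∘ inj) = refl
      D-δ : D δ ≈ 0#
      D-δ = trans (+-congʳ (det-cong n δ-ρ)) (-‿inverseʳ _)

    -- An isomorphism of graphs relates two a priori different vertex counts. The mutually inverse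
    -- maps force them to be equal, and then this is a permutation.
    det-reindex : ∀ m n (f : Fin m → Fin n) (g : Fin n → Fin m) → (∀ i → g (f i) ≡ i) → (∀ j → f (g j) ≡ j) →
      ∀ A → det m (λ i j → A (f i) (f j)) ≈ det n A
    det-reindex m n f g gf fg A with cantor-schröder-bernstein {f = f} {g} (retract⇒injective {f = f} {g} gf) (retract⇒injective {f = g} {f} fg)
      where
      retract⇒injective : ∀ {m n} {f : Fin m → Fin n} {g : Fin n → Fin m} → (∀ i → g (f i) ≡ i) → ∀ {i k} → f i ≡ f k → i ≡ k
      retract⇒injective {g = g} gf e = ≡.trans (≡.sym (gf _)) (≡.trans (≡.cong g e) (gf _))
    ... | ≡.refl = det-permute n f (λ e → ≡.trans (≡.sym (gf _)) (≡.trans (≡.cong g e) (gf _))) A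

    zero-column : ∀ n {A} → (∀ i → A i zero ≈ 0#) → det (suc n) A ≈ 0#
    zero-column n {A} h = sum-zero _ λ j → trans (signed-cong (toℕ j) (term n j A h)) (signed-0 (toℕ j))
      where
      term : ∀ n j A → (∀ i → A i zero ≈ 0#) → A zero j * det n (minor A j) ≈ 0#
      term n       zero    A h = trans (*-congʳ (h zero)) (zeroˡ _)
      term (suc n) (suc j) A h = trans (*-congˡ (zero-column n {minor A (suc j)} (h ∘ suc))) (zeroʳ _)

    expand-head : ∀ n A → (∀ j → A zero (suc j) * det n (minor A (suc j)) ≈ 0#) → det (suc n) A ≈ A zero zero * det n (minor A zero)
    expand-head n A h = trans (sum-suc _) (trans (+-congˡ (sum-zero _ λ j →
      trans (-‿cong (trans (signed-cong (toℕ j) (h j)) (signed-0 (toℕ j)))) -0#≈0#)) (+-identityʳ _))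

    single-entry-column : ∀ n A → (∀ i → A (suc i) zero ≈ 0#) → det (suc n) A ≈ A zero zero * det n (minor A zero)
    single-entry-column n A h = expand-head n A (term n A h)
      where
      term : ∀ n A → (∀ i → A (suc i) zero ≈ 0#) → ∀ j → A zero (suc j) * det n (minor A (suc j)) ≈ 0#
      term (suc n) A h j = trans (*-congˡ (zero-column n {minor A (suc j)} h)) (zeroʳ _)

    isolated-vertex : ∀ n A → (∀ j → A zero (suc j) ≈ 0#) → det (suc n) A ≈ A zero zero * det n (minor A zero)
    isolated-vertex n A h = expand-head n A (λ j → trans (*-congʳ (h j)) (zeroˡ _))

    -- The classical recursion for a leaf v at u: f(G) = x f(G - v) - f(G - v - u). In the minor of
    -- column 1 the first column has its only nonzero entry on top; the two entries -1 cancel and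
    -- the cofactor sign stays.
    pendant-vertex : ∀ n A → (∀ j → A zero (suc (suc j)) ≈ 0#) → (∀ j → A (suc (suc j)) zero ≈ 0#) →
      A zero (suc zero) ≈ - 1# → A (suc zero) zero ≈ - 1# →
      det (suc (suc n)) A ≈ A zero zero * det (suc n) (minor A zero) - det n (λ i j → A (suc (suc i)) (suc (suc j)))
    pendant-vertex n A row col r c = begin
      det (suc (suc n)) A
        ≈⟨ trans (sum-suc _) (+-congˡ (trans (sum-suc _) (+-congˡ (sum-zero _ λ j →
             trans (-‿cong (-‿cong (trans (signed-cong (toℕ j) (trans (*-congʳ {det (suc n) (minor A (suc (suc j)))} (row j)) (zeroˡ _))) (signed-0 (toℕ j)))))
               (trans (-‿cong -0#≈0#) -0#≈0#))))) ⟩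
      A zero zero * det (suc n) (minor A zero) + (- (A zero (suc zero) * det (suc n) (minor A (suc zero))) + 0#)
        ≈⟨ +-congˡ (trans (+-identityʳ _) (-‿cong (*-cong r (trans (single-entry-column n (minor A (suc zero)) col) (*-congʳ c))))) ⟩
      A zero zero * det (suc n) (minor A zero) - (- 1# * (- 1# * d))
        ≈⟨ +-congˡ (-‿cong (trans (neg-1 _) (trans (-‿cong (neg-1 _)) (-‿involutive _)))) ⟩
      A zero zero * det (suc n) (minor A zero) - d ∎
      where
      d = det n (λ i j → A (suc (suc i)) (suc (suc j)))
      neg-1 : ∀ x → - 1# * x ≈ - x
      neg-1 x = trans (sym (-‿distribˡ-* 1# x)) (-‿cong (*-identityˡ x))

-- Adjacency in starlike trees laid out on the natural numbers.

module StarlikeDeterminants where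

  open Determinants
  open import Defs using (chain; pathEdges; edgesFrom)
  open import Algebra.Bundles using (CommutativeRing)
  open import Data.Nat as ℕ using (ℕ; zero; suc; _≤_; _<_; z≤n; s≤s; _∸_; _≡ᵇ_; _≤ᵇ_)
  import Data.Nat.Properties as ℕₚ
  open import Data.Nat.ListAction using (sum)
  open import Data.Fin as Fin using (Fin; toℕ; fromℕ<)
  open import Data.Fin.Properties using (toℕ<n; toℕ-fromℕ<; toℕ-injective)
  open import Data.List as List using (List; []; _∷_; _++_)
  open import Data.List.Properties using (map-++)
  open import Data.List.Relation.Unary.All as All using (All; []; _∷_)
  open import Data.List.Relation.Unary.All.Properties using (++⁺)
  open import Data.Bool using (Bool; true; false; if_then_else_; _∨_; _∧_; T)
  open import Data.Bool.Properties using (∨-comm; ∧-zeroʳ)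
  open import Data.Bool.ListAction using (any)
  open import Data.Product using (_×_; _,_)
  open import Data.Sum using (_⊎_; inj₁; inj₂)
  open import Function using (_∘_)
  open import Relation.Nullary using (¬_; contradiction; yes; no)
  open import Relation.Binary.PropositionalEquality as ≡ using (_≡_; _≢_)

  incident : ℕ → ℕ → ℕ × ℕ → Bool
  incident i j (a , b) = ((a ≡ᵇ i) ∧ (b ≡ᵇ j)) ∨ ((a ≡ᵇ j) ∧ (b ≡ᵇ i))

  adjacent : List (ℕ × ℕ) → ℕ → ℕ → Bool
  adjacent es i j = any (incident i j) es

  adjacent-sym : ∀ es i j → adjacent es i j ≡ adjacent es j i
  adjacent-sym []             i j = ≡.refl
  adjacent-sym ((a , b) ∷ es) i j = ≡.cong₂ _∨_ (∨-comm ((a ≡ᵇ i) ∧ (b ≡ᵇ j)) _) (adjacent-sym es i j)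

  adjacent-++ : ∀ es {fs} i j → adjacent (es ++ fs) i j ≡ adjacent es i j ∨ adjacent fs i j
  adjacent-++ []       i j = ≡.refl
  adjacent-++ (e ∷ es) {fs} i j with incident i j e
  ... | true  = ≡.refl
  ... | false = adjacent-++ es i j

  ≡ᵇ-refl : ∀ i → (i ≡ᵇ i) ≡ true
  ≡ᵇ-refl zero    = ≡.refl
  ≡ᵇ-refl (suc i) = ≡ᵇ-refl i

  ≢⇒≡ᵇ-false : ∀ {i j} → i ≢ j → (i ≡ᵇ j) ≡ false
  ≢⇒≡ᵇ-false {i} {j} i≢j with i ≡ᵇ j in eq
  ... | false = ≡.refl
  ... | true  = contradiction (ℕₚ.≡ᵇ⇒≡ i j (≡.subst T (≡.sym eq) _)) i≢j

  ≡ᵇ-injective : ∀ {f : ℕ → ℕ} → (∀ {i j} → f i ≡ f j → i ≡ j) → ∀ i j → (f i ≡ᵇ f j) ≡ (i ≡ᵇ j)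
  ≡ᵇ-injective {f} inj i j with i ℕₚ.≟ j
  ... | yes ≡.refl = ≡.trans (≡ᵇ-refl (f i)) (≡.sym (≡ᵇ-refl i))
  ... | no i≢j     = ≡.trans (≢⇒≡ᵇ-false (i≢j ∘ inj)) (≡.sym (≢⇒≡ᵇ-false i≢j))

  Avoids : ℕ → ℕ → ℕ × ℕ → Set
  Avoids i j (a , b) = ¬ (a ≡ i × b ≡ j) × ¬ (a ≡ j × b ≡ i)

  ∧-false : ∀ {a b i j} → ¬ (a ≡ i × b ≡ j) → ((a ≡ᵇ i) ∧ (b ≡ᵇ j)) ≡ false
  ∧-false {a} {b} {i} {j} ¬e with a ℕₚ.≟ i
  ... | yes ≡.refl = ≡.trans (≡.cong ((a ≡ᵇ a) ∧_) (≢⇒≡ᵇ-false (λ e → ¬e (≡.refl , e)))) (∧-zeroʳ _)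
  ... | no a≢i rewrite ≢⇒≡ᵇ-false a≢i = ≡.refl

  avoids⇒nonadjacent : ∀ {es i j} → All (Avoids i j) es → adjacent es i j ≡ false
  avoids⇒nonadjacent [] = ≡.refl
  avoids⇒nonadjacent {(a , b) ∷ es} {i} {j} ((p , q) ∷ av)
    rewrite ∧-false p | ∧-false q = avoids⇒nonadjacent av

  chain-adjacent : ∀ o m w → o ≤ w → w < o ℕ.+ m → adjacent (chain o m) w (suc w) ≡ true
  chain-adjacent o zero    w o≤w w<o+m = contradiction (≡.subst (w <_) (ℕₚ.+-identityʳ o) w<o+m) (ℕₚ.≤⇒≯ o≤w)
  chain-adjacent o (suc m) w o≤w w<o+m with o ℕₚ.≟ w
  ... | yes ≡.refl rewrite ≡ᵇ-refl o = ≡.refl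
  ... | no o≢w rewrite ≢⇒≡ᵇ-false o≢w with (o ≡ᵇ suc w) ∧ (suc o ≡ᵇ w)
  ...   | true  = ≡.refl
  ...   | false = chain-adjacent (suc o) m w (ℕₚ.≤∧≢⇒< o≤w o≢w) (≡.subst (w <_) (ℕₚ.+-suc o m) w<o+m)

  chain-edges : ∀ o m → All (λ (a , b) → b ≡ suc a × o ≤ a × a < o ℕ.+ m) (chain o m)
  chain-edges o zero    = []
  chain-edges o (suc m) =
    (≡.refl , ℕₚ.≤-refl , ℕₚ.m<m+n o (s≤s z≤n)) ∷
    All.map (λ {(a , _)} (e , l , u) → e , ℕₚ.<⇒≤ l , ≡.subst (a <_) (≡.sym (ℕₚ.+-suc o m)) u) (chain-edges (suc o) m)

  edgesFrom-edges : ∀ o Ls → All (λ (a , b) → o ≤ b × (a ≡ 0 ⊎ o ≤ a)) (edgesFrom o Ls)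
  edgesFrom-edges o []       = []
  edgesFrom-edges o (L ∷ Ls) = ++⁺ (path o L)
    (All.map (λ { (l , inj₁ e) → ℕₚ.≤-trans (ℕₚ.m≤m+n o L) l , inj₁ e
                ; (l , inj₂ m) → ℕₚ.≤-trans (ℕₚ.m≤m+n o L) l , inj₂ (ℕₚ.≤-trans (ℕₚ.m≤m+n o L) m) })
             (edgesFrom-edges (o ℕ.+ L) Ls))
    where
    path : ∀ o L → All (λ (a , b) → o ≤ b × (a ≡ 0 ⊎ o ≤ a)) (pathEdges o L)
    path o zero    = []
    path o (suc L) = (ℕₚ.≤-refl , inj₁ ≡.refl) ∷
      All.map (λ { (≡.refl , l , _) → ℕₚ.m≤n⇒m≤1+n l , inj₂ l }) (chain-edges o L)

  pathEdges-1 : ∀ L → pathEdges 1 L ≡ chain 0 L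
  pathEdges-1 zero    = ≡.refl
  pathEdges-1 (suc L) = ≡.refl

  -- Embeds the tree without its first branch into the whole tree: the centre 0 stays, all other
  -- vertices move past the `L` vertices of that branch.
  skip : ℕ → ℕ → ℕ
  skip L zero    = zero
  skip L (suc i) = L ℕ.+ suc i

  skip² : ℕ → ℕ × ℕ → ℕ × ℕ
  skip² L (a , b) = skip L a , skip L b

  skip-injective : ∀ L {i j} → skip L i ≡ skip L j → i ≡ j
  skip-injective L {zero}  {zero}  e = ≡.refl
  skip-injective L {zero}  {suc j} e with () ← ≡.trans e (ℕₚ.+-suc L j)
  skip-injective L {suc i} {zero}  e with () ← ≡.trans (≡.sym (ℕₚ.+-suc L i)) e
  skip-injective L {suc i} {suc j} e = ℕₚ.+-cancelˡ-≡ L _ _ e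

  chain-skip : ∀ L o m → chain (L ℕ.+ suc o) m ≡ List.map (skip² L) (chain (suc o) m)
  chain-skip L o zero    = ≡.refl
  chain-skip L o (suc m) = ≡.cong₂ _∷_ (≡.cong ((L ℕ.+ suc o) ,_) (≡.sym (ℕₚ.+-suc L (suc o))))
    (≡.trans (≡.cong (λ k → chain k m) (≡.sym (ℕₚ.+-suc L (suc o)))) (chain-skip L (suc o) m))

  edgesFrom-skip : ∀ L o Ls → edgesFrom (L ℕ.+ suc o) Ls ≡ List.map (skip² L) (edgesFrom (suc o) Ls)
  edgesFrom-skip L o []       = ≡.refl
  edgesFrom-skip L o (M ∷ Ls) = ≡.trans
    (≡.cong₂ _++_ (path M) (≡.trans (≡.cong (λ k → edgesFrom k Ls) (ℕₚ.+-assoc L (suc o) M)) (edgesFrom-skip L (o ℕ.+ M) Ls)))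
    (≡.sym (map-++ (skip² L) (pathEdges (suc o) M) _))
    where
    path : ∀ M → pathEdges (L ℕ.+ suc o) M ≡ List.map (skip² L) (pathEdges (suc o) M)
    path zero    = ≡.refl
    path (suc M) = ≡.cong (_ ∷_) (chain-skip L o M)

  adjacent-skip : ∀ L es i j → adjacent (List.map (skip² L) es) (skip L i) (skip L j) ≡ adjacent es i j
  adjacent-skip L []             i j = ≡.refl
  adjacent-skip L ((a , b) ∷ es) i j
    rewrite ≡ᵇ-injective (skip-injective L) a i | ≡ᵇ-injective (skip-injective L) b j
          | ≡ᵇ-injective (skip-injective L) a j | ≡ᵇ-injective (skip-injective L) b i
          | adjacent-skip L es i j = ≡.refl

  chain-avoids-skip : ∀ L i j → All (Avoids (skip L i) (skip L j)) (chain 0 L)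
  chain-avoids-skip L i j = All.map
    (λ { (≡.refl , _ , a<L) → (λ (_ , e) → avoid j a<L (≡.sym e)) , (λ (_ , e) → avoid i a<L (≡.sym e)) }) (chain-edges 0 L)
    where
    avoid : ∀ {a} k → a < L → skip L k ≢ suc a
    avoid (suc k) a<L e = ℕₚ.<⇒≱ a<L (ℕₚ.≤-trans (ℕₚ.m≤m+n L k) (ℕₚ.≤-reflexive (ℕₚ.suc-injective (≡.trans (≡.sym (ℕₚ.+-suc L k)) e))))

  module _ (L : ℕ) (Ls : List ℕ) where

    private es = edgesFrom 1 (L ∷ Ls)

    adjacent-rest : ∀ i j → adjacent es (skip L i) (skip L j) ≡ adjacent (edgesFrom 1 Ls) i j
    adjacent-rest i j = begin
      adjacent es (skip L i) (skip L j)
        ≡⟨ adjacent-++ (pathEdges 1 L) _ _ ⟩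
      adjacent (pathEdges 1 L) (skip L i) (skip L j) ∨ adjacent (edgesFrom (suc L) Ls) (skip L i) (skip L j)
        ≡⟨ ≡.cong₂ (λ fs gs → adjacent fs (skip L i) (skip L j) ∨ adjacent gs (skip L i) (skip L j)) (pathEdges-1 L)
             (≡.trans (≡.cong (λ k → edgesFrom k Ls) (ℕₚ.+-comm 1 L)) (edgesFrom-skip L 0 Ls)) ⟩
      adjacent (chain 0 L) (skip L i) (skip L j) ∨ adjacent (List.map (skip² L) (edgesFrom 1 Ls)) (skip L i) (skip L j)
        ≡⟨ ≡.cong₂ _∨_ (avoids⇒nonadjacent (chain-avoids-skip L i j)) (adjacent-skip L (edgesFrom 1 Ls) i j) ⟩
      adjacent (edgesFrom 1 Ls) i j ∎
      where open ≡.≡-Reasoning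

    adjacent-path : ∀ w → w < L → adjacent es w (suc w) ≡ true
    adjacent-path w w<L = ≡.trans (adjacent-++ (pathEdges 1 L) w (suc w))
      (≡.cong (_∨ adjacent (edgesFrom (suc L) Ls) w (suc w)) (≡.trans (≡.cong (λ fs → adjacent fs w (suc w)) (pathEdges-1 L)) (chain-adjacent 0 L w z≤n w<L)))

    -- A vertex v of the first branch has at most the neighbours v - 1 and v + 1, the latter only
    -- below `L`: the number L + 1 already belongs to the next branch.
    nonadjacent-path : ∀ v w → 0 < v → v ≤ L → (w ≡ suc v → ¬ v < L) → v ≢ suc w → adjacent es v w ≡ false
    nonadjacent-path v w 0<v v≤L h₁ h₂ = avoids⇒nonadjacent (++⁺
      (≡.subst (All (Avoids v w)) (≡.sym (pathEdges-1 L)) (All.map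
        (λ { (≡.refl , _ , a<L) → (λ { (≡.refl , e) → h₁ (≡.sym e) a<L }) , (λ { (≡.refl , e) → h₂ (≡.sym e) }) }) (chain-edges 0 L)))
      (All.map
        (λ { (l , inj₁ ≡.refl) → (λ { (e , _) → ℕₚ.<-irrefl e 0<v }) , (λ { (_ , ≡.refl) → ℕₚ.<⇒≱ l v≤L })
           ; (l , inj₂ m) → (λ { (≡.refl , _) → ℕₚ.<⇒≱ m v≤L }) , (λ { (_ , ≡.refl) → ℕₚ.<⇒≱ l v≤L }) })
        (edgesFrom-edges (suc L) Ls)))

  -- Puts the free end of the first branch at position 0 and the centre at position `L`, so that
  -- expansion along the first row starts at a leaf.
  reverseUpTo : ℕ → ℕ → ℕ
  reverseUpTo L k = if k ≤ᵇ L then L ∸ k else k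

  reverse-≤ : ∀ {L k} → k ≤ L → reverseUpTo L k ≡ L ∸ k
  reverse-≤ {L} {k} k≤L with k ≤ᵇ L in eq
  ... | true  = ≡.refl
  ... | false = contradiction (≡.subst T eq (ℕₚ.≤⇒≤ᵇ k≤L)) (λ ())

  reverse-> : ∀ {L k} → L < k → reverseUpTo L k ≡ k
  reverse-> {L} {k} L<k with k ≤ᵇ L in eq
  ... | false = ≡.refl
  ... | true  = contradiction (ℕₚ.≤ᵇ⇒≤ k L (≡.subst T (≡.sym eq) _)) (ℕₚ.<⇒≱ L<k)

  reverse-skip : ∀ L i → reverseUpTo L (L ℕ.+ i) ≡ skip L i
  reverse-skip L zero    = ≡.trans (≡.cong (reverseUpTo L) (ℕₚ.+-identityʳ L)) (≡.trans (reverse-≤ {L} ℕₚ.≤-refl) (ℕₚ.n∸n≡0 L))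
  reverse-skip L (suc i) = reverse-> (ℕₚ.m<m+n L (s≤s z≤n))

  reverse-involutive : ∀ L k → reverseUpTo L (reverseUpTo L k) ≡ k
  reverse-involutive L k with k ℕₚ.≤? L
  ... | yes k≤L rewrite reverse-≤ k≤L | reverse-≤ {L} {L ∸ k} (ℕₚ.m∸n≤m L k) = ℕₚ.m∸[m∸n]≡n k≤L
  ... | no k≰L rewrite reverse-> (ℕₚ.≰⇒> k≰L) = reverse-> (ℕₚ.≰⇒> k≰L)

  reverse-< : ∀ {L N k} → L < N → k < N → reverseUpTo L k < N
  reverse-< {L} {N} {k} L<N k<N with k ≤ᵇ L
  ... | true  = ℕₚ.≤-<-trans (ℕₚ.m∸n≤m L k) L<N
  ... | false = k<N

  -- Peeling a branch off a starlike tree.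

  module Characteristic {c ℓ} (R : CommutativeRing c ℓ) (x : CommutativeRing.Carrier R) where
    open CommutativeRing R hiding (zero)
    open Det R hiding (sum)
    open import Algebra.Properties.Ring ring
    open import Algebra.Properties.CommutativeSemigroup +-commutativeSemigroup using (interchange)
    open import Relation.Binary.Reasoning.Setoid setoid

    -- Entries indexed by natural numbers make every trailing submatrix a mere shift of one
    -- function, independent of the size.
    detℕ : ℕ → (ℕ → ℕ → Carrier) → Carrier
    detℕ n e = det n (λ i j → e (toℕ i) (toℕ j))

    detℕ-cong : ∀ n {e f} → (∀ i j → e i j ≈ f i j) → detℕ n e ≈ detℕ n f
    detℕ-cong n h = det-cong n (λ i j → h (toℕ i) (toℕ j))

    detℕ-size : ∀ {m n} → m ≡ n → ∀ e → detℕ m e ≈ detℕ n e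
    detℕ-size ≡.refl e = refl

    detℕ-reindex : ∀ n (ρ : ℕ → ℕ) → (∀ {k} → k < n → ρ k < n) → (∀ k → ρ (ρ k) ≡ k) →
      ∀ e → detℕ n (λ i j → e (ρ i) (ρ j)) ≈ detℕ n e
    detℕ-reindex n ρ bounded inv e = trans
      (det-cong n {λ i j → e (ρ (toℕ i)) (ρ (toℕ j))} {λ i j → e (toℕ (f i)) (toℕ (f j))}
        (λ i j → reflexive (≡.cong₂ e (≡.sym (toℕ-fromℕ< _)) (≡.sym (toℕ-fromℕ< _)))))
      (det-reindex n n f f ff ff (λ i j → e (toℕ i) (toℕ j)))
      where
      f : Fin n → Fin n
      f i = fromℕ< (bounded (toℕ<n i))
      ff : ∀ i → f (f i) ≡ i
      ff i = toℕ-injective (≡.trans (toℕ-fromℕ< _) (≡.trans (≡.cong ρ (toℕ-fromℕ< _)) (inv (toℕ i))))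

    shift : ℕ → (ℕ → ℕ → Carrier) → ℕ → ℕ → Carrier
    shift k e i j = e (k ℕ.+ i) (k ℕ.+ j)

    -- φ L is the characteristic polynomial of the path with L vertices; φ⁻ L is φ (L - 1).
    φ φ⁻ : ℕ → Carrier
    φ zero     = 1#
    φ (suc L)  = x * φ L - φ⁻ L
    φ⁻ zero    = 0#
    φ⁻ (suc L) = φ L

    -- The vertices below `L` form a path whose last vertex is joined to vertex `L`, with no other
    -- edge leading out of the path. The entries among the vertices from `L` on are arbitrary.
    record PendantPath (L : ℕ) (e : ℕ → ℕ → Carrier) : Set ℓ where
      field
        diagonal   : ∀ k → k < L → e k k ≈ x
        upper      : ∀ k → k < L → e k (suc k) ≈ - 1#
        lower      : ∀ k → k < L → e (suc k) k ≈ - 1#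
        farUpper   : ∀ k → k < L → ∀ j → e k (2 ℕ.+ k ℕ.+ j) ≈ 0#
        farLower   : ∀ k → k < L → ∀ j → e (2 ℕ.+ k ℕ.+ j) k ≈ 0#

    pendant-tail : ∀ {L e} → PendantPath (suc L) e → PendantPath L (shift 1 e)
    pendant-tail p = record
      { diagonal = λ k k<L → diagonal (suc k) (s≤s k<L)
      ; upper    = λ k k<L → upper (suc k) (s≤s k<L)
      ; lower    = λ k k<L → lower (suc k) (s≤s k<L)
      ; farUpper = λ k k<L → farUpper (suc k) (s≤s k<L)
      ; farLower = λ k k<L → farLower (suc k) (s≤s k<L)
      }
      where open PendantPath p

    pendant-step : ∀ {L} n {e} → PendantPath (suc L) e →
      detℕ (suc (suc n)) e ≈ x * detℕ (suc n) (shift 1 e) - detℕ n (shift 2 e)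
    pendant-step n {e} p = trans
      (pendant-vertex n (λ i j → e (toℕ i) (toℕ j))
        (λ j → farUpper 0 (s≤s z≤n) (toℕ j)) (λ j → farLower 0 (s≤s z≤n) (toℕ j))
        (upper 0 (s≤s z≤n)) (lower 0 (s≤s z≤n)))
      (+-congʳ (*-congʳ (diagonal 0 (s≤s z≤n))))
      where open PendantPath p

    φ-1 : φ 1 ≈ x
    φ-1 = trans (+-cong (*-identityʳ x) -0#≈0#) (+-identityʳ x)

    -- Both sides satisfy the leaf recursion in `L`, which is also the recursion of φ; hence the
    -- induction in steps of two. The value 0 of `φ⁻ 0` covers the empty path.
    det-pendantPath : ∀ L n e → PendantPath L e →
      detℕ (L ℕ.+ suc n) e ≈ φ L * detℕ (suc n) (shift L e) - φ⁻ L * detℕ n (shift (suc L) e)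
    det-pendantPath zero n e p = sym (trans (+-cong (*-identityˡ _) (trans (-‿cong (zeroˡ _)) -0#≈0#)) (+-identityʳ _))
    det-pendantPath (suc zero) n e p = trans (pendant-step n p) (+-cong (*-congʳ (sym φ-1)) (-‿cong (sym (*-identityˡ _))))
    det-pendantPath (suc (suc L)) n e p = begin
      detℕ (suc (suc L) ℕ.+ suc n) e
        ≈⟨ pendant-step (L ℕ.+ suc n) p ⟩
      x * detℕ (suc L ℕ.+ suc n) (shift 1 e) - detℕ (L ℕ.+ suc n) (shift 2 e)
        ≈⟨ +-cong (*-congˡ (det-pendantPath (suc L) n (shift 1 e) (pendant-tail p)))
                  (-‿cong (det-pendantPath L n (shift 2 e) (pendant-tail (pendant-tail p)))) ⟩
      x * (φ (suc L) * A - φ L * B) - (φ L * A - φ⁻ L * B)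
        ≈⟨ +-cong (trans (distribˡ _ _ _) (+-cong (sym (*-assoc _ _ _)) (trans (sym (-‿distribʳ-* _ _)) (-‿cong (sym (*-assoc _ _ _))))))
                  (sym (-‿+-comm _ _)) ⟩
      (x * φ (suc L) * A - x * φ L * B) + (- (φ L * A) - - (φ⁻ L * B))
        ≈⟨ interchange _ _ _ _ ⟩
      (x * φ (suc L) * A - φ L * A) + (- (x * φ L * B) - - (φ⁻ L * B))
        ≈⟨ +-cong (sym ([y-z]x≈yx-zx _ _ _)) (trans (-‿+-comm _ _) (-‿cong (sym ([y-z]x≈yx-zx _ _ _)))) ⟩
      φ (suc (suc L)) * A - φ (suc L) * B ∎
      where
      A = detℕ (suc n) (shift (suc (suc L)) e)
      B = detℕ n (shift (suc (suc (suc L))) e)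

    -- Here the path has L + 1 vertices, of which the last is joined to nothing later. Peeling off
    -- the first `L` vertices leaves this isolated one, which turns φ L and φ⁻ L into φ (L + 1).
    det-component : ∀ L n e → PendantPath L e → e L L ≈ x → (∀ j → e L (suc L ℕ.+ j) ≈ 0#) →
      detℕ (L ℕ.+ suc n) e ≈ φ (suc L) * detℕ n (shift (suc L) e)
    det-component L n e p diag row = begin
      detℕ (L ℕ.+ suc n) e
        ≈⟨ det-pendantPath L n e p ⟩
      φ L * detℕ (suc n) (shift L e) - φ⁻ L * D
        ≈⟨ +-congʳ (*-congˡ (isolated-vertex n (λ i j → shift L e (toℕ i) (toℕ j))
             (λ j → trans (reflexive (≡.cong₂ e (ℕₚ.+-identityʳ L) (ℕₚ.+-suc L (toℕ j)))) (row (toℕ j))))) ⟩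
      φ L * (e (L ℕ.+ 0) (L ℕ.+ 0) * detℕ n (shift 1 (shift L e))) - φ⁻ L * D
        ≈⟨ +-congʳ (*-congˡ (*-cong (trans (reflexive (≡.cong₂ e (ℕₚ.+-identityʳ L) (ℕₚ.+-identityʳ L))) diag)
             (detℕ-cong n λ i j → reflexive (≡.cong₂ e (ℕₚ.+-suc L i) (ℕₚ.+-suc L j))))) ⟩
      φ L * (x * D) - φ⁻ L * D
        ≈⟨ +-congʳ (trans (sym (*-assoc _ _ _)) (*-congʳ (*-comm _ _))) ⟩
      x * φ L * D - φ⁻ L * D
        ≈⟨ sym ([y-z]x≈yx-zx _ _ _) ⟩
      φ (suc L) * D ∎
      where D = detℕ n (shift (suc L) e)

    entry : List (ℕ × ℕ) → ℕ → ℕ → Carrier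
    entry es i j = if i ≡ᵇ j then x else (if adjacent es i j then - 1# else 0#)

    entry-diagonal : ∀ es i → entry es i i ≈ x
    entry-diagonal es i rewrite ≡ᵇ-refl i = refl

    entry-edge : ∀ es i j → i ≢ j → adjacent es i j ≡ true → entry es i j ≈ - 1#
    entry-edge es i j i≢j h rewrite ≢⇒≡ᵇ-false i≢j | h = refl

    entry-nonedge : ∀ es i j → i ≢ j → adjacent es i j ≡ false → entry es i j ≈ 0#
    entry-nonedge es i j i≢j h rewrite ≢⇒≡ᵇ-false i≢j | h = refl

    entry-sym : ∀ es i j → entry es i j ≡ entry es j i
    entry-sym es i j with i ℕₚ.≟ j
    ... | yes ≡.refl = ≡.refl
    ... | no i≢j rewrite ≢⇒≡ᵇ-false i≢j | ≢⇒≡ᵇ-false (i≢j ∘ ≡.sym) | adjacent-sym es i j = ≡.refl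

    -- The determinants belonging to a starlike tree and to the tree without its centre.
    full deleted : List ℕ → Carrier
    full    Ls = detℕ (suc (sum Ls)) (entry (edgesFrom 1 Ls))
    deleted Ls = detℕ (sum Ls) (shift 1 (entry (edgesFrom 1 Ls)))

    module _ (L : ℕ) (Ls : List ℕ) where

      private
        es = edgesFrom 1 (L ∷ Ls)
        e  = entry es

      entry-rest : ∀ i j → e (skip L i) (skip L j) ≈ entry (edgesFrom 1 Ls) i j
      entry-rest i j rewrite ≡ᵇ-injective (skip-injective L) i j | adjacent-rest L Ls i j = refl

      reversed : ℕ → ℕ → Carrier
      reversed i j = e (reverseUpTo L i) (reverseUpTo L j)

      reversed-pendant : PendantPath L reversed
      reversed-pendant = record
        { diagonal = λ k k<L → entry-diagonal es (reverseUpTo L k)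
        ; upper    = λ k k<L → edge k k<L
        ; lower    = λ k k<L → trans (reflexive (entry-sym es (reverseUpTo L (suc k)) (reverseUpTo L k))) (edge k k<L)
        ; farUpper = far
        ; farLower = λ k k<L j → trans (reflexive (entry-sym es (reverseUpTo L (2 ℕ.+ k ℕ.+ j)) (reverseUpTo L k))) (far k k<L j)
        }
        where
        L∸k : ∀ {k} → k < L → L ∸ k ≡ suc (L ∸ suc k)
        L∸k {k} k<L = ℕₚ.+-∸-assoc 1 k<L
        edge : ∀ k → k < L → reversed k (suc k) ≈ - 1#
        -- Positions k and k + 1 hold the vertices L - k and L - k - 1, so the edge is met in
        -- decreasing order.
        edge k k<L rewrite reverse-≤ (ℕₚ.<⇒≤ k<L) | reverse-≤ k<L | L∸k k<L = entry-edge es _ _ ℕₚ.1+n≢n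
          (≡.trans (adjacent-sym es _ _) (adjacent-path L Ls (L ∸ suc k) (ℕₚ.∸-monoʳ-< (s≤s z≤n) k<L)))
        far : ∀ k → k < L → ∀ j → reversed k (2 ℕ.+ k ℕ.+ j) ≈ 0#
        -- The other vertex either lies at least two steps nearer to the centre on this branch,
        -- possibly being the centre, or belongs to another branch. As k < L, the vertex L - k is
        -- not the centre.
        far k k<L j rewrite reverse-≤ (ℕₚ.<⇒≤ k<L) with 2 ℕ.+ k ℕ.+ j ℕₚ.≤? L
        ... | yes j≤L rewrite reverse-≤ j≤L = entry-nonedge es _ _ (ℕₚ.>⇒≢ (ℕₚ.<-trans (ℕₚ.n<1+n _) below))
                (nonadjacent-path L Ls (L ∸ k) _ (ℕₚ.m<n⇒0<n∸m k<L) (ℕₚ.m∸n≤m L k)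
                  (λ e → contradiction (≡.subst (_< L ∸ k) e (ℕₚ.<-trans (ℕₚ.n<1+n _) below)) (ℕₚ.<⇒≯ (ℕₚ.n<1+n _)))
                  (λ e → ℕₚ.<-irrefl (≡.sym e) below))
          where
          below : suc (L ∸ (2 ℕ.+ k ℕ.+ j)) < L ∸ k
          below = ≡.subst (suc (L ∸ (2 ℕ.+ k ℕ.+ j)) <_) (≡.sym (L∸k k<L))
            (s≤s (ℕₚ.∸-monoʳ-< (s≤s (s≤s (ℕₚ.m≤m+n k j))) j≤L))
        ... | no j≰L rewrite reverse-> (ℕₚ.≰⇒> j≰L) = entry-nonedge es _ _ (ℕₚ.<⇒≢ below)
                (nonadjacent-path L Ls (L ∸ k) _ (ℕₚ.m<n⇒0<n∸m k<L) (ℕₚ.m∸n≤m L k)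
                  (λ e v<L → ℕₚ.<⇒≱ (ℕₚ.≰⇒> j≰L) (≡.subst (_≤ L) (≡.sym e) v<L))
                  (λ e → ℕₚ.<-irrefl e (ℕₚ.<-trans below (ℕₚ.n<1+n _))))
          where
          below : L ∸ k < 2 ℕ.+ k ℕ.+ j
          below = ℕₚ.≤-<-trans (ℕₚ.m∸n≤m L k) (ℕₚ.≰⇒> j≰L)

      -- After the reversal the leading block is a pendant path, and the block from position `L` on
      -- is the tree without this branch, its centre first. Deleting that centre gives the second
      -- term.
      full-∷ : full (L ∷ Ls) ≈ φ L * full Ls - φ⁻ L * deleted Ls
      full-∷ = begin
        detℕ (suc (L ℕ.+ sum Ls)) e
          ≈⟨ sym (detℕ-reindex _ (reverseUpTo L) (reverse-< (s≤s (ℕₚ.m≤m+n L _))) (reverse-involutive L) e) ⟩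
        detℕ (suc (L ℕ.+ sum Ls)) reversed
          ≈⟨ detℕ-size (≡.sym (ℕₚ.+-suc L (sum Ls))) reversed ⟩
        detℕ (L ℕ.+ suc (sum Ls)) reversed
          ≈⟨ det-pendantPath L (sum Ls) reversed reversed-pendant ⟩
        φ L * detℕ (suc (sum Ls)) (shift L reversed) - φ⁻ L * detℕ (sum Ls) (shift (suc L) reversed)
          ≈⟨ +-cong (*-congˡ (detℕ-cong (suc (sum Ls)) rest)) (-‿cong (*-congˡ (detℕ-cong (sum Ls) {shift (suc L) reversed} {shift 1 (entry (edgesFrom 1 Ls))} λ i j →
               trans (reflexive (≡.cong₂ reversed (≡.sym (ℕₚ.+-suc L i)) (≡.sym (ℕₚ.+-suc L j)))) (rest (suc i) (suc j))))) ⟩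
        φ L * full Ls - φ⁻ L * deleted Ls ∎
        where
        rest : ∀ i j → reversed (L ℕ.+ i) (L ℕ.+ j) ≈ entry (edgesFrom 1 Ls) i j
        rest i j = trans (reflexive (≡.cong₂ e (reverse-skip L i) (reverse-skip L j))) (entry-rest i j)

    -- Without the centre the first branch is a component of its own and already starts with an end
    -- vertex, so it splits off without a reversal.
    deleted-∷ : ∀ L Ls → deleted (L ∷ Ls) ≈ φ L * deleted Ls
    deleted-∷ zero    Ls = sym (*-identityˡ _)
    deleted-∷ (suc L) Ls = begin
      detℕ (suc L ℕ.+ sum Ls) (shift 1 e)
        ≈⟨ detℕ-size (≡.sym (ℕₚ.+-suc L (sum Ls))) (shift 1 e) ⟩
      detℕ (L ℕ.+ suc (sum Ls)) (shift 1 e)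
        ≈⟨ det-component L (sum Ls) (shift 1 e) pendant (entry-diagonal es (suc L)) (λ j → far L _ ℕₚ.≤-refl (s≤s (s≤s (ℕₚ.m≤m+n L j))) (λ _ → ℕₚ.<-irrefl ≡.refl)) ⟩
      φ (suc L) * detℕ (sum Ls) (shift (suc (suc L)) e)
        ≈⟨ *-congˡ (detℕ-cong (sum Ls) λ i j → trans
             (reflexive (≡.cong₂ e (≡.sym (ℕₚ.+-suc (suc L) i)) (≡.sym (ℕₚ.+-suc (suc L) j)))) (entry-rest (suc L) Ls (suc i) (suc j))) ⟩
      φ (suc L) * deleted Ls ∎
      where
      es = edgesFrom 1 (suc L ∷ Ls)
      e  = entry es
      far : ∀ k w → k ≤ L → suc k < w → (w ≡ suc (suc k) → ¬ suc k < suc L) → e (suc k) w ≈ 0#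
      far k w k≤L k<w h = entry-nonedge es (suc k) w (ℕₚ.<⇒≢ k<w) (nonadjacent-path (suc L) Ls (suc k) w (s≤s z≤n) (s≤s k≤L) h
        (λ e → ℕₚ.<-irrefl e (ℕₚ.<-trans k<w (ℕₚ.n<1+n w))))
      far′ : ∀ k → k < L → ∀ j → e (suc k) (3 ℕ.+ k ℕ.+ j) ≈ 0#
      far′ k k<L j = far k _ (ℕₚ.<⇒≤ k<L) (ℕₚ.<-trans (ℕₚ.n<1+n _) (s≤s (s≤s (s≤s (ℕₚ.m≤m+n k j)))))
        (λ e → contradiction (ℕₚ.≤-reflexive (ℕₚ.suc-injective (ℕₚ.suc-injective e))) (ℕₚ.<⇒≱ (s≤s (ℕₚ.m≤m+n k j))))
      edge : ∀ k → k < L → e (suc k) (suc (suc k)) ≈ - 1#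
      edge k k<L = entry-edge es (suc k) (suc (suc k)) (ℕₚ.1+n≢n ∘ ≡.sym) (adjacent-path (suc L) Ls (suc k) (s≤s k<L))
      pendant : PendantPath L (shift 1 e)
      pendant = record
        { diagonal = λ k _ → entry-diagonal es (suc k)
        ; upper    = edge
        ; lower    = λ k k<L → trans (reflexive (entry-sym es (suc (suc k)) (suc k))) (edge k k<L)
        ; farUpper = far′
        ; farLower = λ k k<L j → trans (reflexive (entry-sym es (3 ℕ.+ k ℕ.+ j) (suc k))) (far′ k k<L j)
        }

-- Integer coefficient lists as a commutative ring, and characteristic polynomials of graphs.

module IntegerPolynomials where

  open Determinants
  open StarlikeDeterminants
  open import Defs
  open import Algebra.Bundles using (CommutativeRing)
  open import Data.Nat using (ℕ; zero; suc)
  open import Data.Integer as ℤ using (+_)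
  import Data.Integer.Properties as ℤₚ
  open import Data.List using (List; []; _∷_)
  open import Data.Nat.ListAction using (sum)
  open import Data.Bool using (if_then_else_)
  open import Data.Fin as Fin using (Fin; toℕ)
  open import Data.Fin.Properties using (toℕ-injective) renaming (_≟_ to _≟F_)
  open import Data.Product using (_,_)
  open import Function using (_∘_)
  open import Level using (0ℓ)
  open import Relation.Binary.Bundles using (Setoid)
  open import Relation.Nullary using (does; yes; no)
  open import Relation.Nullary.Decidable using (dec-true; dec-false)
  open import Relation.Binary.PropositionalEquality as ≡ using (_≡_)
  open PZ using (coeff; scale; negP; oneP; zeroP; _+P_)

  infix 4 _≋_
  -- The relation `_≈P_` unfolds to a function type; the record keeps both polynomials visible to
  -- inference.
  record _≋_ (p q : PolyZ) : Set where
    constructor coeffwise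
    field coeff≡ : p ≈P q
  open _≋_

  ≋-refl : ∀ {p} → p ≋ p
  ≋-refl = coeffwise λ _ → ≡.refl

  ≋-sym : ∀ {p q} → p ≋ q → q ≋ p
  ≋-sym h = coeffwise λ i → ≡.sym (coeff≡ h i)

  ≋-trans : ∀ {p q r} → p ≋ q → q ≋ r → p ≋ r
  ≋-trans h h′ = coeffwise λ i → ≡.trans (coeff≡ h i) (coeff≡ h′ i)

  ≋-setoid : Setoid 0ℓ 0ℓ
  ≋-setoid = record { Carrier = PolyZ ; _≈_ = _≋_ ; isEquivalence = record { refl = ≋-refl ; sym = ≋-sym ; trans = ≋-trans } }

  ∷-cong : ∀ {a b p q} → a ≡ b → p ≋ q → a ∷ p ≋ b ∷ q
  ∷-cong a≡b h = coeffwise λ { zero → a≡b ; (suc i) → coeff≡ h i }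

  0∷[] : + 0 ∷ [] ≋ []
  0∷[] = coeffwise λ { zero → ≡.refl ; (suc i) → ≡.refl }

  coeff-+ : ∀ p q i → coeff (p +P q) i ≡ coeff p i ℤ.+ coeff q i
  coeff-+ []      q       i       = ≡.sym (ℤₚ.+-identityˡ _)
  coeff-+ (a ∷ p) []      i       = ≡.sym (ℤₚ.+-identityʳ _)
  coeff-+ (a ∷ p) (b ∷ q) zero    = ≡.refl
  coeff-+ (a ∷ p) (b ∷ q) (suc i) = coeff-+ p q i

  coeff-scale : ∀ a p i → coeff (scale a p) i ≡ a ℤ.* coeff p i
  coeff-scale a []      i       = ≡.sym (ℤₚ.*-zeroʳ a)
  coeff-scale a (b ∷ p) zero    = ≡.refl
  coeff-scale a (b ∷ p) (suc i) = coeff-scale a p i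

  coeff-neg : ∀ p i → coeff (negP p) i ≡ ℤ.- coeff p i
  coeff-neg []      i       = ≡.refl
  coeff-neg (a ∷ p) zero    = ≡.refl
  coeff-neg (a ∷ p) (suc i) = coeff-neg p i

  +-cong : ∀ {p p′ q q′} → p ≋ p′ → q ≋ q′ → p +P q ≋ p′ +P q′
  +-cong {p} {p′} {q} {q′} h k = coeffwise λ i → begin
    coeff (p +P q) i            ≡⟨ coeff-+ p q i ⟩
    coeff p i ℤ.+ coeff q i     ≡⟨ ≡.cong₂ ℤ._+_ (coeff≡ h i) (coeff≡ k i) ⟩
    coeff p′ i ℤ.+ coeff q′ i   ≡⟨ ≡.sym (coeff-+ p′ q′ i) ⟩
    coeff (p′ +P q′) i          ∎
    where open ≡.≡-Reasoning

  neg-cong : ∀ {p q} → p ≋ q → negP p ≋ negP q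
  neg-cong {p} {q} h = coeffwise λ i →
    ≡.trans (coeff-neg p i) (≡.trans (≡.cong ℤ.-_ (coeff≡ h i)) (≡.sym (coeff-neg q i)))

  scale-cong : ∀ a {p q} → p ≋ q → scale a p ≋ scale a q
  scale-cong a {p} {q} h = coeffwise λ i →
    ≡.trans (coeff-scale a p i) (≡.trans (≡.cong (a ℤ.*_) (coeff≡ h i)) (≡.sym (coeff-scale a q i)))

  +-assoc : ∀ p q r → (p +P q) +P r ≋ p +P (q +P r)
  +-assoc []      q       r       = ≋-refl
  +-assoc (a ∷ p) []      r       = ≋-refl
  +-assoc (a ∷ p) (b ∷ q) []      = ≋-refl
  +-assoc (a ∷ p) (b ∷ q) (c ∷ r) = ∷-cong (ℤₚ.+-assoc a b c) (+-assoc p q r)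

  +-comm : ∀ p q → p +P q ≋ q +P p
  +-comm []      []      = ≋-refl
  +-comm []      (b ∷ q) = ≋-refl
  +-comm (a ∷ p) []      = ≋-refl
  +-comm (a ∷ p) (b ∷ q) = ∷-cong (ℤₚ.+-comm a b) (+-comm p q)

  +-identityʳ : ∀ p → p +P [] ≋ p
  +-identityʳ []      = ≋-refl
  +-identityʳ (a ∷ p) = ≋-refl

  +-inverseʳ : ∀ p → p +P negP p ≋ []
  +-inverseʳ []      = ≋-refl
  +-inverseʳ (a ∷ p) = ≋-trans (∷-cong (ℤₚ.+-inverseʳ a) (+-inverseʳ p)) 0∷[]

  +-interchange : ∀ p q r s → (p +P q) +P (r +P s) ≋ (p +P r) +P (q +P s)
  +-interchange p q r s =
    ≋-trans (+-assoc p q (r +P s)) (≋-trans (+-cong (≋-refl {p}) middle) (≋-sym (+-assoc p r (q +P s))))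
    where
    middle : q +P (r +P s) ≋ r +P (q +P s)
    middle = ≋-trans (≋-sym (+-assoc q r s)) (≋-trans (+-cong (+-comm q r) ≋-refl) (+-assoc r q s))

  scale-0 : ∀ p → scale (+ 0) p ≋ []
  scale-0 []      = ≋-refl
  scale-0 (a ∷ p) = ≋-trans (∷-cong ≡.refl (scale-0 p)) 0∷[]

  scale-1 : ∀ p → scale (+ 1) p ≋ p
  scale-1 []      = ≋-refl
  scale-1 (a ∷ p) = ∷-cong (ℤₚ.*-identityˡ a) (scale-1 p)

  scale-+ : ∀ a b p → scale (a ℤ.+ b) p ≋ scale a p +P scale b p
  scale-+ a b []      = ≋-refl
  scale-+ a b (c ∷ p) = ∷-cong (ℤₚ.*-distribʳ-+ c a b) (scale-+ a b p)

  scale-distrib : ∀ a p q → scale a (p +P q) ≋ scale a p +P scale a q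
  scale-distrib a []      q       = ≋-refl
  scale-distrib a (b ∷ p) []      = ≋-refl
  scale-distrib a (b ∷ p) (c ∷ q) = ∷-cong (ℤₚ.*-distribˡ-+ a b c) (scale-distrib a p q)

  scale-scale : ∀ a b p → scale (a ℤ.* b) p ≋ scale a (scale b p)
  scale-scale a b []      = ≋-refl
  scale-scale a b (c ∷ p) = ∷-cong (ℤₚ.*-assoc a b c) (scale-scale a b p)

  *-zeroʳ : ∀ p → p *P [] ≋ []
  *-zeroʳ []      = ≋-refl
  *-zeroʳ (a ∷ p) = ≋-trans (∷-cong ≡.refl (*-zeroʳ p)) 0∷[]

  *-congˡ : ∀ p {q r} → q ≋ r → p *P q ≋ p *P r
  *-congˡ []      h = ≋-refl
  *-congˡ (a ∷ p) h = +-cong (scale-cong a h) (∷-cong ≡.refl (*-congˡ p h))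

  -- Multiplication recurses on its left factor; this is the matching recursion on the right factor,
  -- from which commutativity follows.
  *-∷ : ∀ p b q → p *P (b ∷ q) ≋ scale b p +P (+ 0 ∷ (p *P q))
  *-∷ []      b q = ≋-sym 0∷[]
  *-∷ (a ∷ p) b q = ∷-cong (≡.cong (ℤ._+ + 0) (ℤₚ.*-comm a b)) (begin
    scale a q +P p *P (b ∷ q)                      ≈⟨ +-cong (≋-refl {scale a q}) (*-∷ p b q) ⟩
    scale a q +P (scale b p +P (+ 0 ∷ p *P q))     ≈⟨ ≋-sym (+-assoc (scale a q) (scale b p) (+ 0 ∷ p *P q)) ⟩
    scale a q +P scale b p +P (+ 0 ∷ p *P q)       ≈⟨ +-cong (+-comm (scale a q) (scale b p)) (≋-refl {+ 0 ∷ p *P q}) ⟩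
    scale b p +P scale a q +P (+ 0 ∷ p *P q)       ≈⟨ +-assoc (scale b p) (scale a q) (+ 0 ∷ p *P q) ⟩
    scale b p +P (scale a q +P (+ 0 ∷ p *P q))     ∎)
    where open import Relation.Binary.Reasoning.Setoid ≋-setoid

  *-comm : ∀ p q → p *P q ≋ q *P p
  *-comm []      q = ≋-sym (*-zeroʳ q)
  *-comm (a ∷ p) q = ≋-trans (+-cong (≋-refl {scale a q}) (∷-cong ≡.refl (*-comm p q))) (≋-sym (*-∷ q a p))

  *-distribʳ : ∀ r p q → (p +P q) *P r ≋ p *P r +P q *P r
  *-distribʳ r []      q       = ≋-refl
  *-distribʳ r (a ∷ p) []      = ≋-sym (+-identityʳ _)
  *-distribʳ r (a ∷ p) (b ∷ q) = ≋-trans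
    (+-cong (scale-+ a b r) (∷-cong ≡.refl (*-distribʳ r p q)))
    (+-interchange (scale a r) (scale b r) (+ 0 ∷ p *P r) (+ 0 ∷ q *P r))

  scale-* : ∀ a p q → scale a p *P q ≋ scale a (p *P q)
  scale-* a []      q = ≋-refl
  scale-* a (b ∷ p) q = ≋-trans
    (+-cong (scale-scale a b q) (∷-cong (≡.sym (ℤₚ.*-zeroʳ a)) (scale-* a p q)))
    (≋-sym (scale-distrib a (scale b q) (+ 0 ∷ p *P q)))

  *-assoc : ∀ p q r → (p *P q) *P r ≋ p *P (q *P r)
  *-assoc []      q r = ≋-refl
  *-assoc (a ∷ p) q r = ≋-trans (*-distribʳ r (scale a q) (+ 0 ∷ p *P q))
    (+-cong (scale-* a q r) (+-cong (scale-0 r) (∷-cong ≡.refl (*-assoc p q r))))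

  polyRing : CommutativeRing 0ℓ 0ℓ
  polyRing = record
    { Carrier = PolyZ ; _≈_ = _≋_ ; _+_ = _+P_ ; _*_ = _*P_ ; -_ = negP ; 0# = zeroP ; 1# = oneP
    ; isCommutativeRing = record
      { isRing = record
        { +-isAbelianGroup = record
          { isGroup = record
            { isMonoid = record
              { isSemigroup = record
                { isMagma = record
                  { isEquivalence = record { refl = ≋-refl ; sym = ≋-sym ; trans = ≋-trans }
                  ; ∙-cong = +-cong }
                ; assoc = +-assoc }
              ; identity = (λ p → ≋-refl) , +-identityʳ }
            ; inverse = (λ p → ≋-trans (+-comm (negP p) p) (+-inverseʳ p)) , +-inverseʳ
            ; ⁻¹-cong = neg-cong }
          ; comm = +-comm }
        ; *-cong = λ {p} {p′} {q} {q′} h k → ≋-trans (*-congˡ p k) (≋-trans (*-comm p q′) (≋-trans (*-congˡ q′ h) (*-comm q′ p′)))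
        ; *-assoc = *-assoc
        ; *-identity = *-identityˡ , λ p → ≋-trans (*-comm p oneP) (*-identityˡ p)
        ; distrib = (λ p q r → ≋-trans (*-comm p (q +P r)) (≋-trans (*-distribʳ p q r) (+-cong (*-comm q p) (*-comm r p)))) , *-distribʳ }
      ; *-comm = *-comm }
    }
    where
    *-identityˡ : ∀ p → oneP *P p ≋ p
    *-identityˡ p = ≋-trans (+-cong (scale-1 p) 0∷[]) (+-identityʳ p)

  open Det polyRing using (det; signed; det-cong; det-reindex) renaming (sum to ∑; sum-empty to ∑-empty; sum-suc to ∑-suc)
  open Characteristic polyRing X

  PZ-det : ∀ n M → PZ.det n M ≋ det n M
  PZ-det zero    M = ≋-refl
  PZ-det (suc n) M = sumFin (suc n) λ j → signed-det (toℕ j) (M Fin.zero j) (PZ-det n _)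
    where
    signed-det : ∀ k a {p q} → p ≋ q → PZ.signed k (a *P p) ≋ signed k (a *P q)
    signed-det zero    a h = *-congˡ a h
    signed-det (suc k) a h = neg-cong (signed-det k a h)
    sumFin : ∀ n {f g : Fin n → PolyZ} → (∀ i → f i ≋ g i) → PZ.sumFin n f ≋ ∑ g
    sumFin zero    {f} {g} h = ≋-sym (∑-empty g)
    sumFin (suc n) {f} {g} h = ≋-trans (+-cong (h Fin.zero) (sumFin n (λ i → h (Fin.suc i)))) (≋-sym (∑-suc g))

  charMatrix : ∀ G → Fin (n G) → Fin (n G) → PolyZ
  charMatrix G i j = if does (i ≟F j) then X else (if adj G i j then (ℤ.- (ℤ.+ 1)) ∷ [] else [])

  charPoly-iso : ∀ G H → G ≅ H → charPoly G ≋ charPoly H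
  charPoly-iso G H G≅H = ≋-trans (PZ-det (n G) (M G)) (≋-trans
    (det-cong (n G) {M G} {λ i j → M H (to i) (to j)} same)
    (≋-trans (det-reindex (n G) (n H) to from from∘to to∘from (M H)) (≋-sym (PZ-det (n H) (M H)))))
    where
    open _≅_ G≅H
    M = charMatrix
    same : ∀ i j → M G i j ≋ M H (to i) (to j)
    same i j rewrite adj-pres i j with i ≟F j
    ... | yes ≡.refl rewrite dec-true (to i ≟F to i) ≡.refl = ≋-refl
    ... | no i≢j rewrite dec-false (to i ≟F to j) (λ e → i≢j (≡.trans (≡.sym (from∘to i)) (≡.trans (≡.cong from e) (from∘to j)))) = ≋-refl

  charPoly-starlike : ∀ ns → charPoly (starlike ns) ≋ full (pathLengths 1 ns)
  charPoly-starlike ns = ≋-trans (PZ-det (suc (sum Ls)) M) (det-cong (suc (sum Ls)) {M} same)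
    where
    Ls = pathLengths 1 ns
    M = charMatrix (starlike ns)
    same : ∀ i j → M i j ≋ entry (edgesFrom 1 Ls) (toℕ i) (toℕ j)
    same i j with i ≟F j
    ... | yes ≡.refl rewrite ≡ᵇ-refl (toℕ i) = ≋-refl
    ... | no i≢j rewrite ≢⇒≡ᵇ-false (i≢j ∘ toℕ-injective) = ≋-refl

  -- The same graph as a function of the list of branch lengths alone, so that an equality of such
  -- lists can be transported to an isomorphism.
  starlikeTree : List ℕ → Graph
  starlikeTree Ls = record { n = suc (sum Ls) ; adj = λ i j → adjacent (edgesFrom 1 Ls) (toℕ i) (toℕ j) }

  ≅-refl : ∀ G → G ≅ G
  ≅-refl G = record
    { to = λ i → i ; from = λ i → i ; from∘to = λ _ → ≡.refl ; to∘from = λ _ → ≡.refl ; adj-pres = λ _ _ → ≡.refl }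

  starlike-cong : ∀ ms ns → pathLengths 1 ms ≡ pathLengths 1 ns → starlike ms ≅ starlike ns
  starlike-cong ms ns e = ≡.subst (λ Ls → starlike ms ≅ starlikeTree Ls) e (≅-refl (starlike ms))

-- Ratios of path polynomials at a root, and bounds on their sums.

module PathRatios where

  open import Data.Nat as ℕ using (ℕ; zero; suc; z≤n; s≤s)
  import Data.Nat.Properties as ℕₚ
  open import Data.Integer using (ℤ; +_; _+_; _*_; -_; _-_; _≤_; _<_; +≤+; +<+; positive; nonNegative)
  import Data.Integer.Properties as ℤₚ
  open import Data.Integer.Tactic.RingSolver using (solve-∀)
  open import Data.List as List using (List; []; _∷_; _++_; replicate)
  open import Data.List.Relation.Unary.All using (All; []; _∷_)
  open import Data.Product using (_×_; _,_; proj₁; proj₂)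
  open import Data.Sum using (inj₁; inj₂)
  open import Relation.Nullary using (contradiction)
  open import Relation.Binary.PropositionalEquality as ≡ using (_≡_; refl; sym; trans; cong; cong₂; subst)

  +-nonneg : ∀ {x y} → + 0 ≤ x → + 0 ≤ y → + 0 ≤ x + y
  +-nonneg = ℤₚ.+-mono-≤

  +-pos : ∀ {x y} → + 0 < x → + 0 ≤ y → + 0 < x + y
  +-pos = ℤₚ.+-mono-<-≤

  *-nonneg : ∀ {x y} → + 0 ≤ x → + 0 ≤ y → + 0 ≤ x * y
  *-nonneg {x} {y} p q = subst (_≤ x * y) (ℤₚ.*-zeroʳ x) (ℤₚ.*-monoˡ-≤-nonNeg x {{nonNegative p}} q)

  *-pos : ∀ {x y} → + 0 < x → + 0 < y → + 0 < x * y
  *-pos {x} {y} p q = subst (_< x * y) (ℤₚ.*-zeroʳ x) (ℤₚ.*-monoˡ-<-pos x {{positive p}} q)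

  *-cancel-nonneg : ∀ {x y} → + 0 < x → + 0 ≤ x * y → + 0 ≤ y
  *-cancel-nonneg {x} {y} p q = ℤₚ.*-cancelˡ-≤-pos (+ 0) y x {{positive p}} (subst (_≤ x * y) (sym (ℤₚ.*-zeroʳ x)) q)

  *-cancel-pos : ∀ {x y} → + 0 < x → + 0 < x * y → + 0 < y
  *-cancel-pos {x} {y} p q = ℤₚ.≤∧≢⇒< (*-cancel-nonneg p (ℤₚ.<⇒≤ q)) (λ { refl → ℤₚ.<-irrefl (sym (ℤₚ.*-zeroʳ x)) q })

  *-cancel-zero : ∀ {x y} → + 0 < x → x * y ≡ + 0 → y ≡ + 0
  *-cancel-zero {x} {y} p e with ℤₚ.i*j≡0⇒i≡0∨j≡0 x e
  ... | inj₁ refl = contradiction p (ℤₚ.<-irrefl refl)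
  ... | inj₂ e′ = e′

  nonneg-+-zeroˡ : ∀ {x y} → + 0 ≤ x → + 0 ≤ y → x + y ≡ + 0 → x ≡ + 0
  nonneg-+-zeroˡ {x} {y} p q e = ℤₚ.≤-antisym (subst₂≤ (ℤₚ.+-monoʳ-≤ x q)) p
    where
    subst₂≤ : x + + 0 ≤ x + y → x ≤ + 0
    subst₂≤ h = ≡.subst₂ _≤_ (ℤₚ.+-identityʳ x) e h

  -- For c = λ², the numbers a L and b L are λ^(L+1) φ(L-1) and λ^L φ(L), where φ(L) is the
  -- characteristic polynomial of the path with L vertices at λ; the ratio a L / b L increases with L.
  module Ratio (c : ℤ) (4≤c : + 4 ≤ c) where

    opaque
      a b : ℕ → ℤ
      a zero    = + 0
      a (suc L) = c * b L
      b zero    = + 1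
      b (suc L) = c * b L - a L

      a-zero : a 0 ≡ + 0
      a-zero = refl

      b-zero : b 0 ≡ + 1
      b-zero = refl

      a-suc : ∀ L → a (suc L) ≡ c * b L
      a-suc L = refl

      b-suc : ∀ L → b (suc L) ≡ c * b L - a L
      b-suc L = refl

    0<c : + 0 < c
    0<c = ℤₚ.<-≤-trans (+<+ (s≤s z≤n)) 4≤c

    private
      -- The bound r ≤ 2 is preserved because c / (c - 2) ≤ 2 for c ≥ 4. It also keeps `b` positive,
      -- since b (L + 1) = (c - 2) b L + (2 b L - a L).
      bounds : ∀ L → (+ 0 < b L) × (+ 0 ≤ + 2 * b L - a L)
      bounds zero    = subst (+ 0 <_) (sym b-zero) (+<+ (s≤s z≤n)) ,
        ≡.subst₂ (λ x y → + 0 ≤ + 2 * x - y) (sym b-zero) (sym a-zero) (+≤+ z≤n)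
      bounds (suc L) with bounds L
      ... | 0<b , 0≤d =
        subst (+ 0 <_) (trans (e₁ c (b L) (a L)) (sym (b-suc L))) (+-pos (*-pos 0<c-2 0<b) 0≤d) ,
        subst (+ 0 ≤_) (trans (e₂ c (b L) (a L)) (sym (cong₂ (λ x y → + 2 * x - y) (b-suc L) (a-suc L)))) (+-nonneg (*-nonneg (ℤₚ.i≤j⇒0≤j-i 4≤c) (ℤₚ.<⇒≤ 0<b)) (*-nonneg {+ 2} (+≤+ z≤n) 0≤d))
        where
        0<c-2 : + 0 < c - + 2
        0<c-2 = ℤₚ.<-≤-trans (+<+ (s≤s z≤n)) (ℤₚ.+-monoˡ-≤ (- + 2) 4≤c)
        e₁ : ∀ c b a → (c - + 2) * b + (+ 2 * b - a) ≡ c * b - a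
        e₁ = solve-∀
        e₂ : ∀ c b a → (c - + 4) * b + + 2 * (+ 2 * b - a) ≡ + 2 * (c * b - a) - c * b
        e₂ = solve-∀

    0<b : ∀ L → + 0 < b L
    0<b L = proj₁ (bounds L)

    0≤2b-a : ∀ L → + 0 ≤ + 2 * b L - a L
    0≤2b-a L = proj₂ (bounds L)

    0<a : ∀ L → + 0 < a (suc L)
    0<a L = subst (+ 0 <_) (sym (a-suc L)) (*-pos 0<c (0<b L))

    0≤a : ∀ L → + 0 ≤ a L
    0≤a zero    = ℤₚ.≤-reflexive (sym a-zero)
    0≤a (suc L) = ℤₚ.<⇒≤ (0<a L)

    a≡b : a 1 ≡ b 1
    a≡b = trans (a-suc 0) (sym (trans (b-suc 0) (trans (cong (λ x → c * b 0 - x) a-zero) (ℤₚ.+-identityʳ (c * b 0)))))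

    -- With r = a / b the recursion reads r ↦ c / (c - r); these lemmas compare r with P / Q along it.
    upper-step : ∀ P Q → + 0 < Q → + 0 < P → + 0 ≤ P * Q * c - Q * Q * c - P * P →
      ∀ L → + 0 < P * b L - Q * a L
    upper-step P Q 0<Q 0<P κ zero    = subst (+ 0 <_) (trans (e P Q) (sym (cong₂ (λ x y → P * x - Q * y) b-zero a-zero))) 0<P
      where
      e : ∀ P Q → P ≡ P * + 1 - Q * + 0
      e = solve-∀
    upper-step P Q 0<Q 0<P κ (suc L) = *-cancel-pos 0<Q (subst (+ 0 <_) (trans (e P Q c (a L) (b L)) (sym (cong₂ (λ x y → Q * (P * x - Q * y)) (b-suc L) (a-suc L))))
      (+-pos (*-pos 0<P (upper-step P Q 0<Q 0<P κ L)) (*-nonneg κ (ℤₚ.<⇒≤ (0<b L)))))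
      where
      e : ∀ P Q c a b → P * (P * b - Q * a) + (P * Q * c - Q * Q * c - P * P) * b ≡ Q * (P * (c * b - a) - Q * (c * b))
      e = solve-∀

    lower-step : ∀ P Q → + 0 < Q → + 0 ≤ P → + 0 < P * P + Q * Q * c - P * Q * c →
      ∀ L → + 0 ≤ Q * a L - P * b L → + 0 < Q * a (suc L) - P * b (suc L)
    lower-step P Q 0<Q 0≤P κ L h = *-cancel-pos 0<Q (subst (+ 0 <_) (trans (e P Q c (a L) (b L)) (sym (cong₂ (λ x y → Q * (Q * x - P * y)) (a-suc L) (b-suc L))))
      (+-pos (*-pos κ (0<b L)) (*-nonneg 0≤P h)))
      where
      e : ∀ P Q c a b → (P * P + Q * Q * c - P * Q * c) * b + P * (Q * a - P * b) ≡ Q * (Q * (c * b) - P * (c * b - a))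
      e = solve-∀

    -- When P / Q is the exact ratio at `L`, the hypothesis on P and Q says that the next ratio is
    -- strictly larger. Monotonicity of r ↦ c / (c - r) keeps all later ratios above P / Q.
    lower-steps : ∀ P Q → + 0 < Q → + 0 ≤ P → + 0 < P * P + Q * Q * c - P * Q * c →
      ∀ L → Q * a L - P * b L ≡ + 0 → ∀ {M} → L ℕ.< M → + 0 < Q * a M - P * b M
    lower-steps P Q 0<Q 0≤P κ L h {suc M} (s≤s L≤M) with ℕₚ.m≤n⇒m<n∨m≡n L≤M
    ... | inj₁ L<M  = lower-step P Q 0<Q 0≤P κ M (ℤₚ.<⇒≤ (lower-steps P Q 0<Q 0≤P κ L h L<M))
    ... | inj₂ refl = lower-step P Q 0<Q 0≤P κ M (ℤₚ.≤-reflexive (sym h))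

    -- The values at λ, scaled by powers of λ, of the characteristic polynomials of the tree and of
    -- the tree without its centre; thus A = B (c - Σ a L / b L).
    A B : List ℕ → ℤ
    A []       = c
    A (L ∷ Ls) = b L * A Ls - a L * B Ls
    B []       = + 1
    B (L ∷ Ls) = b L * B Ls

    0<B : ∀ Ls → + 0 < B Ls
    0<B []       = +<+ (s≤s z≤n)
    0<B (L ∷ Ls) = *-pos (0<b L) (0<B Ls)

    weight : (ℕ → ℤ) → List ℕ → ℤ
    weight α []       = + 0
    weight α (L ∷ Ls) = α L + weight α Ls

    -- Clearing denominators in Σ a L / b L ≤ Σ α L / δ.
    module _ (δ : ℤ) (α : ℕ → ℤ) where

      slack : ℕ → ℤ
      slack L = α L * b L - δ * a L

      private
        -- This is `B Ls` times the sum of slack L / b L, written without fractions. Hence it is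
        -- nonnegative if all slacks are, and then vanishes only if each of them does.
        excess : List ℕ → ℤ
        excess Ls = δ * A Ls + B Ls * (weight α Ls - δ * c)

        excess-∷ : ∀ L Ls → excess (L ∷ Ls) ≡ b L * excess Ls + B Ls * slack L
        excess-∷ L Ls = e δ (α L) (a L) (b L) (A Ls) (B Ls) (weight α Ls) c
          where
          e : ∀ δ α a b A B w c → δ * (b * A - a * B) + b * B * (α + w - δ * c) ≡ b * (δ * A + B * (w - δ * c)) + B * (α * b - δ * a)
          e = solve-∀

        excess-nonneg : ∀ Ls → All (λ L → + 0 ≤ slack L) Ls → + 0 ≤ excess Ls
        excess-nonneg []       _       = ℤₚ.≤-reflexive (e δ c)
          where
          e : ∀ δ c → + 0 ≡ δ * c + + 1 * (+ 0 - δ * c)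
          e = solve-∀
        excess-nonneg (L ∷ Ls) (h ∷ hs) = subst (+ 0 ≤_) (sym (excess-∷ L Ls))
          (+-nonneg (*-nonneg (ℤₚ.<⇒≤ (0<b L)) (excess-nonneg Ls hs)) (*-nonneg (ℤₚ.<⇒≤ (0<B Ls)) h))

        excess-zero : ∀ Ls → All (λ L → + 0 ≤ slack L) Ls → excess Ls ≡ + 0 → All (λ L → slack L ≡ + 0) Ls
        excess-zero []       _        _ = []
        excess-zero (L ∷ Ls) (h ∷ hs) e =
          *-cancel-zero (0<B Ls) (nonneg-+-zeroˡ y≥0 x≥0 (trans (ℤₚ.+-comm (B Ls * slack L) _) e′)) ∷
          excess-zero Ls hs (*-cancel-zero (0<b L) (nonneg-+-zeroˡ x≥0 y≥0 e′))
          where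
          e′ = trans (sym (excess-∷ L Ls)) e
          x≥0 = *-nonneg (ℤₚ.<⇒≤ (0<b L)) (excess-nonneg Ls hs)
          y≥0 = *-nonneg (ℤₚ.<⇒≤ (0<B Ls)) h

        excess-A : ∀ Ls → A Ls ≡ + 0 → excess Ls ≡ B Ls * (weight α Ls - δ * c)
        excess-A Ls h = trans (cong (λ x → δ * x + B Ls * (weight α Ls - δ * c)) h) (e δ (B Ls * (weight α Ls - δ * c)))
          where
          e : ∀ δ x → δ * + 0 + x ≡ x
          e = solve-∀

      -- At a root the ratios sum to c, so only the weights remain in the excess. The sign of δ is
      -- free: with a negative δ, lower bounds on the ratios take the place of upper bounds.
      weight-bound : ∀ Ls → A Ls ≡ + 0 → All (λ L → + 0 ≤ slack L) Ls → + 0 ≤ weight α Ls - δ * c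
      weight-bound Ls h hs = *-cancel-nonneg (0<B Ls) (subst (+ 0 ≤_) (excess-A Ls h) (excess-nonneg Ls hs))

      weight-tight : ∀ Ls → A Ls ≡ + 0 → All (λ L → + 0 ≤ slack L) Ls → weight α Ls - δ * c ≡ + 0 → All (λ L → slack L ≡ + 0) Ls
      weight-tight Ls h hs e = excess-zero Ls hs (trans (excess-A Ls h) (trans (cong (B Ls *_) e) (ℤₚ.*-zeroʳ (B Ls))))

  -- Lengths up to 5 need weights of their own, while one common weight serves all lengths from 6
  -- on, which therefore stay together in one list.
  grouped : ℕ → ℕ → ℕ → ℕ → ℕ → List ℕ → List ℕ
  grouped n₁ n₂ n₃ n₄ n₅ rest = replicate n₁ 1 ++ replicate n₂ 2 ++ replicate n₃ 3 ++ replicate n₄ 4 ++ replicate n₅ 5 ++ rest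

-- Solving Σ r = c for the branch lengths.

module LengthClassification where

  open PathRatios
  open import Data.Nat as ℕ using (ℕ; zero; suc; z≤n; s≤s)
  import Data.Nat.Properties as ℕₚ
  open import Data.Integer using (ℤ; +_; _+_; _*_; -_; _-_; _≤_; _<_; +≤+; +<+)
  import Data.Integer.Properties as ℤₚ
  open import Data.Integer.Tactic.RingSolver using (solve-∀)
  open import Data.List as List using (List; []; _∷_; _++_; replicate; length)
  open import Data.List.Relation.Unary.All as All using (All; []; _∷_)
  open import Data.List.Relation.Unary.All.Properties using (++⁺; ++⁻; replicate⁺)
  open import Data.Product using (_×_; _,_; proj₁; proj₂)
  open import Data.Empty using (⊥; ⊥-elim)
  open import Function using (_∘_)
  open import Relation.Nullary using (Dec; yes; no)
  open import Relation.Binary.PropositionalEquality using (_≡_; _≢_; refl; sym; trans; cong; cong₂; subst)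

  nonneg-+-pos-absurd : ∀ {x y} → + 0 ≤ x → + 0 < y → x + y ≢ + 0
  nonneg-+-pos-absurd p q e = ℤₚ.<-irrefl (sym e) (ℤₚ.+-mono-≤-< p q)

  pos⇒≢0 : ∀ {x} → + 0 < x → x ≢ + 0
  pos⇒≢0 p e = ℤₚ.<-irrefl (sym e) p

  piecewise : (α₁ α₂ α₃ α₄ α₅ α₆ : ℤ) → ℕ → ℤ
  piecewise α₁ α₂ α₃ α₄ α₅ α₆ 1 = α₁
  piecewise α₁ α₂ α₃ α₄ α₅ α₆ 2 = α₂
  piecewise α₁ α₂ α₃ α₄ α₅ α₆ 3 = α₃
  piecewise α₁ α₂ α₃ α₄ α₅ α₆ 4 = α₄
  piecewise α₁ α₂ α₃ α₄ α₅ α₆ 5 = α₅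
  piecewise α₁ α₂ α₃ α₄ α₅ α₆ _ = α₆

  piecewise-≥6 : ∀ {α₁ α₂ α₃ α₄ α₅ α₆ L} → 6 ℕ.≤ L → piecewise α₁ α₂ α₃ α₄ α₅ α₆ L ≡ α₆
  piecewise-≥6 (s≤s (s≤s (s≤s (s≤s (s≤s (s≤s _)))))) = refl

  All-replicate : ∀ {P : ℕ → Set} n {L} → All P (replicate n L) → (P L → ⊥) → n ≡ 0
  All-replicate zero    _       _  = refl
  All-replicate (suc n) (p ∷ _) ¬p = ⊥-elim (¬p p)

  -- Here n = c - 2.  The weights below compare the ratios r L = a L / b L with their exact values
  -- r 1 = 1, r 2 = (n+2)/(n+1), r 3 = (n+1)/n, r 4 = n(n+2)/(n²+n-1), r 5 = (n²+n-1)/(n²-1).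
  module Classification (n : ℤ) (2≤n : + 2 ≤ n) where

    c : ℤ
    c = n + + 2

    open Ratio c (ℤₚ.+-monoˡ-≤ (+ 2) 2≤n)

    weight-replicate : ∀ α k L Ls {w} → weight α Ls ≡ w → weight α (replicate k L ++ Ls) ≡ + k * α L + w
    weight-replicate α zero    L Ls {w} h = trans h (sym (ℤₚ.+-identityˡ w))
    weight-replicate α (suc k) L Ls {w} h = trans (cong (λ z → α L + z) (weight-replicate α k L Ls h)) (e (α L) (+ k) w)
      where
      e : ∀ x k w → x + (k * x + w) ≡ (+ 1 + k) * x + w
      e = solve-∀

    weight-constant : ∀ α {x Ls} → All (λ L → α L ≡ x) Ls → weight α Ls ≡ + length Ls * x
    weight-constant α []       = refl
    weight-constant α {x} {L ∷ Ls} (h ∷ hs) = trans (cong₂ _+_ h (weight-constant α hs)) (e x (+ length Ls))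
      where
      e : ∀ x k → x + k * x ≡ (+ 1 + k) * x
      e = solve-∀

    module Weighted (n₁ n₂ n₃ n₄ n₅ : ℕ) (rest : List ℕ) (rest≥6 : All (6 ℕ.≤_) rest)
             (A≡0 : A (grouped n₁ n₂ n₃ n₄ n₅ rest) ≡ + 0) where

      record Bounds (δ α₁ α₂ α₃ α₄ α₅ α₆ : ℤ) : Set where
        field
          bound₁ : + 0 ≤ α₁ * b 1 - δ * a 1
          bound₂ : + 0 ≤ α₂ * b 2 - δ * a 2
          bound₃ : + 0 ≤ α₃ * b 3 - δ * a 3
          bound₄ : + 0 ≤ α₄ * b 4 - δ * a 4
          bound₅ : + 0 ≤ α₅ * b 5 - δ * a 5
          bound₆ : ∀ {L} → 6 ℕ.≤ L → + 0 ≤ α₆ * b L - δ * a L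

      -- Complementary slackness: in an exact sum, no branch has a length whose bound is strict.
      record Tight (δ α₁ α₂ α₃ α₄ α₅ α₆ : ℤ) : Set where
        field
          tight₁ : α₁ * b 1 - δ * a 1 ≢ + 0 → n₁ ≡ 0
          tight₂ : α₂ * b 2 - δ * a 2 ≢ + 0 → n₂ ≡ 0
          tight₃ : α₃ * b 3 - δ * a 3 ≢ + 0 → n₃ ≡ 0
          tight₄ : α₄ * b 4 - δ * a 4 ≢ + 0 → n₄ ≡ 0
          tight₅ : α₅ * b 5 - δ * a 5 ≢ + 0 → n₅ ≡ 0
          tight₆ : (∀ {L} → 6 ℕ.≤ L → α₆ * b L - δ * a L ≢ + 0) → rest ≡ []

      total : (δ α₁ α₂ α₃ α₄ α₅ α₆ : ℤ) → ℤ
      total δ α₁ α₂ α₃ α₄ α₅ α₆ =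
        (+ n₁ * α₁ + (+ n₂ * α₂ + (+ n₃ * α₃ + (+ n₄ * α₄ + (+ n₅ * α₅ + + length rest * α₆))))) - δ * c

      module _ {δ α₁ α₂ α₃ α₄ α₅ α₆ : ℤ} (bs : Bounds δ α₁ α₂ α₃ α₄ α₅ α₆) where
        open Bounds bs

        private
          α = piecewise α₁ α₂ α₃ α₄ α₅ α₆
          Ls = grouped n₁ n₂ n₃ n₄ n₅ rest

          weight≡ : weight α Ls - δ * c ≡ total δ α₁ α₂ α₃ α₄ α₅ α₆
          weight≡ = cong (_- δ * c)
            (weight-replicate α n₁ 1 _ (weight-replicate α n₂ 2 _ (weight-replicate α n₃ 3 _ (weight-replicate α n₄ 4 _
            (weight-replicate α n₅ 5 rest (weight-constant α (All.map piecewise-≥6 rest≥6)))))))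

          slacks : All (λ L → + 0 ≤ slack δ α L) Ls
          slacks = ++⁺ (replicate⁺ n₁ bound₁) (++⁺ (replicate⁺ n₂ bound₂) (++⁺ (replicate⁺ n₃ bound₃)
            (++⁺ (replicate⁺ n₄ bound₄) (++⁺ (replicate⁺ n₅ bound₅)
            (All.map (λ {L} 6≤L → subst (λ x → + 0 ≤ x * b L - δ * a L) (sym (piecewise-≥6 6≤L)) (bound₆ 6≤L)) rest≥6)))))

        total-nonneg : + 0 ≤ total δ α₁ α₂ α₃ α₄ α₅ α₆
        total-nonneg = subst (+ 0 ≤_) weight≡ (weight-bound δ α Ls A≡0 slacks)

        total-tight : total δ α₁ α₂ α₃ α₄ α₅ α₆ ≡ + 0 → Tight δ α₁ α₂ α₃ α₄ α₅ α₆
        total-tight e with ++⁻ (replicate n₁ 1) (weight-tight δ α Ls A≡0 slacks (trans weight≡ e))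
        ... | s₁ , r₁ with ++⁻ (replicate n₂ 2) r₁
        ... | s₂ , r₂ with ++⁻ (replicate n₃ 3) r₂
        ... | s₃ , r₃ with ++⁻ (replicate n₄ 4) r₃
        ... | s₄ , r₄ with ++⁻ (replicate n₅ 5) r₄
        ... | s₅ , r₅ = record
          { tight₁ = λ h → All-replicate n₁ s₁ h
          ; tight₂ = λ h → All-replicate n₂ s₂ h
          ; tight₃ = λ h → All-replicate n₃ s₃ h
          ; tight₄ = λ h → All-replicate n₄ s₄ h
          ; tight₅ = λ h → All-replicate n₅ s₅ h
          ; tight₆ = λ h → empty rest≥6 r₅ h
          }
          where
          empty : ∀ {Ls} → All (6 ℕ.≤_) Ls → All (λ L → slack δ α L ≡ + 0) Ls →
            (∀ {L} → 6 ℕ.≤ L → α₆ * b L - δ * a L ≢ + 0) → Ls ≡ []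
          empty []          []      h = refl
          empty {L ∷ _} (6≤L ∷ _) (e ∷ _) h = ⊥-elim (h 6≤L (subst (λ x → x * b L - δ * a L ≡ + 0) (piecewise-≥6 6≤L) e))

    size : ℕ → ℕ → ℕ → ℕ → ℕ → List ℕ → ℤ
    size n₁ n₂ n₃ n₄ n₅ rest = + n₁ + (+ n₂ + (+ n₃ + (+ n₄ + (+ n₅ + + length rest))))

    0≤n-2 : + 0 ≤ n - + 2
    0≤n-2 = ℤₚ.i≤j⇒0≤j-i 2≤n

    0<n-1 : + 0 < n - + 1
    0<n-1 = subst (+ 0 <_) (e n) (+-pos {+ 1} (+<+ (s≤s z≤n)) 0≤n-2)
      where
      e : ∀ n → + 1 + (n - + 2) ≡ n - + 1
      e = solve-∀

    0<n : + 0 < n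
    0<n = ℤₚ.<-≤-trans (+<+ (s≤s z≤n)) 2≤n

    0≤+ : ∀ k → + 0 ≤ + k
    0≤+ k = +≤+ z≤n

    0<n+ : ∀ k → + 0 < n + + k
    0<n+ k = +-pos 0<n (0≤+ k)

    a₁ : a 1 ≡ c
    a₁ = trans (a-suc 0) (trans (cong (c *_) b-zero) (ℤₚ.*-identityʳ c))
    b₁ : b 1 ≡ c
    b₁ = trans (sym a≡b) a₁
    a₂ : a 2 ≡ c * c
    a₂ = trans (a-suc 1) (cong (c *_) b₁)
    b₂ : b 2 ≡ c * (c - + 1)
    b₂ = trans (b-suc 1) (trans (cong₂ (λ q p → c * q - p) b₁ a₁) (e c))
      where
      e : ∀ c → c * c - c ≡ c * (c - + 1)
      e = solve-∀
    a₃ : a 3 ≡ c * c * (c - + 1)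
    a₃ = trans (a-suc 2) (trans (cong (c *_) b₂) (sym (ℤₚ.*-assoc c c _)))
    b₃ : b 3 ≡ c * c * (c - + 2)
    b₃ = trans (b-suc 2) (trans (cong₂ (λ q p → c * q - p) b₂ a₂) (e c))
      where
      e : ∀ c → c * (c * (c - + 1)) - c * c ≡ c * c * (c - + 2)
      e = solve-∀
    a₄ : a 4 ≡ c * c * (c * (c - + 2))
    a₄ = trans (a-suc 3) (trans (cong (c *_) b₃) (e c))
      where
      e : ∀ c → c * (c * c * (c - + 2)) ≡ c * c * (c * (c - + 2))
      e = solve-∀
    b₄ : b 4 ≡ c * c * (c * c - + 3 * c + + 1)
    b₄ = trans (b-suc 3) (trans (cong₂ (λ q p → c * q - p) b₃ a₃) (e c))
      where
      e : ∀ c → c * (c * c * (c - + 2)) - c * c * (c - + 1) ≡ c * c * (c * c - + 3 * c + + 1)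
      e = solve-∀
    a₅ : a 5 ≡ c * c * c * (c * c - + 3 * c + + 1)
    a₅ = trans (a-suc 4) (trans (cong (c *_) b₄) (e c))
      where
      e : ∀ c → c * (c * c * (c * c - + 3 * c + + 1)) ≡ c * c * c * (c * c - + 3 * c + + 1)
      e = solve-∀
    b₅ : b 5 ≡ c * c * c * ((c - + 1) * (c - + 3))
    b₅ = trans (b-suc 4) (trans (cong₂ (λ q p → c * q - p) b₄ a₄) (e c))
      where
      e : ∀ c → c * (c * c * (c * c - + 3 * c + + 1)) - c * c * (c * (c - + 2)) ≡ c * c * c * ((c - + 1) * (c - + 3))
      e = solve-∀

    slack-value : ∀ {L p q} α δ r → a L ≡ p → b L ≡ q → r ≡ α * q - δ * p → r ≡ α * b L - δ * a L
    slack-value α δ r ea eb e = trans e (cong₂ (λ q p → α * q - δ * p) (sym eb) (sym ea))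

    slack₁-zero : ∀ δ → δ * b 1 - δ * a 1 ≡ + 0
    slack₁-zero δ = trans (cong (λ x → δ * b 1 - δ * x) a≡b) (ℤₚ.+-inverseʳ (δ * b 1))

    -- The number n / (n - 1) solves 2 + (n - 1) t = c. The recursion does not move it upwards,
    -- because the required quantity κ is just n - 2.
    ratio-bound : ∀ L → + 0 < n * b L - (n - + 1) * a L
    ratio-bound = upper-step n (n - + 1) 0<n-1 0<n κ
      where
      κ : + 0 ≤ n * (n - + 1) * c - (n - + 1) * (n - + 1) * c - n * n
      κ = subst (+ 0 ≤_) (e n) 0≤n-2
        where
        e : ∀ n → n - + 2 ≡ n * (n - + 1) * (n + + 2) - (n - + 1) * (n - + 1) * (n + + 2) - n * n
        e = solve-∀

    -- With at most n branches the total is at most n² - (n - 1)(n + 2) = 2 - n ≤ 0, hence zero and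
    -- tight. As all bounds are strict there would be no branch at all, although the ratios sum to c
    -- > 0.
    at-least-c-1 : ∀ n₁ n₂ n₃ n₄ n₅ rest → All (6 ℕ.≤_) rest → A (grouped n₁ n₂ n₃ n₄ n₅ rest) ≡ + 0 →
      n < size n₁ n₂ n₃ n₄ n₅ rest
    at-least-c-1 n₁ n₂ n₃ n₄ n₅ rest rest≥6 A≡0 = ℤₚ.≰⇒> λ M≤n → empty
      (nonneg-+-zeroˡ (total-nonneg bs)
        (+-nonneg (*-nonneg (ℤₚ.<⇒≤ 0<n) (ℤₚ.i≤j⇒0≤j-i M≤n)) 0≤n-2)
        (e (+ n₁) (+ n₂) (+ n₃) (+ n₄) (+ n₅) (+ length rest) n))
      where
      open Weighted n₁ n₂ n₃ n₄ n₅ rest rest≥6 A≡0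
      e : ∀ N₁ N₂ N₃ N₄ N₅ N₆ n →
        (N₁ * n + (N₂ * n + (N₃ * n + (N₄ * n + (N₅ * n + N₆ * n))))) - (n - + 1) * (n + + 2)
        + (n * (n - (N₁ + (N₂ + (N₃ + (N₄ + (N₅ + N₆)))))) + (n - + 2)) ≡ + 0
      e = solve-∀
      bs : Bounds (n - + 1) n n n n n n
      bs = record { bound₁ = ℤₚ.<⇒≤ (ratio-bound 1) ; bound₂ = ℤₚ.<⇒≤ (ratio-bound 2) ; bound₃ = ℤₚ.<⇒≤ (ratio-bound 3) ; bound₄ = ℤₚ.<⇒≤ (ratio-bound 4)
                  ; bound₅ = ℤₚ.<⇒≤ (ratio-bound 5) ; bound₆ = λ {L} _ → ℤₚ.<⇒≤ (ratio-bound L) }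
      empty : total (n - + 1) n n n n n n ≡ + 0 → ⊥
      empty h = ℤₚ.<-irrefl (sym (trans (e₀ ((n - + 1) * c)) (cong -_ (trans (cong (_- (n - + 1) * c) (sym sum≡0)) h)))) (*-pos 0<n-1 (0<n+ 2))
        where
        open Tight (total-tight bs h)
        e₀ : ∀ x → x ≡ - (+ 0 - x)
        e₀ = solve-∀
        sum≡0 : + n₁ * n + (+ n₂ * n + (+ n₃ * n + (+ n₄ * n + (+ n₅ * n + + length rest * n)))) ≡ + 0
        sum≡0 = vanish (tight₁ (pos⇒≢0 (ratio-bound 1))) (tight₂ (pos⇒≢0 (ratio-bound 2))) (tight₃ (pos⇒≢0 (ratio-bound 3))) (tight₄ (pos⇒≢0 (ratio-bound 4)))
          (tight₅ (pos⇒≢0 (ratio-bound 5))) (tight₆ (λ {L} _ → pos⇒≢0 (ratio-bound L)))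
          where
          vanish : ∀ {n₁ n₂ n₃ n₄ n₅} {rest : List ℕ} → n₁ ≡ 0 → n₂ ≡ 0 → n₃ ≡ 0 → n₄ ≡ 0 → n₅ ≡ 0 → rest ≡ [] →
            + n₁ * n + (+ n₂ * n + (+ n₃ * n + (+ n₄ * n + (+ n₅ * n + + length rest * n)))) ≡ + 0
          vanish refl refl refl refl refl refl = refl

    -- Taking δ = -1 expresses r ≥ 1. The slack at length L + 1 is `a L`, which vanishes only for L
    -- = 0, so exactly c branches force all lengths to be 1.
    at-most-c : ∀ n₁ n₂ n₃ n₄ n₅ rest → All (6 ℕ.≤_) rest → A (grouped n₁ n₂ n₃ n₄ n₅ rest) ≡ + 0 →
      size n₁ n₂ n₃ n₄ n₅ rest ≤ c ×
      (size n₁ n₂ n₃ n₄ n₅ rest ≡ c → n₂ ≡ 0 × n₃ ≡ 0 × n₄ ≡ 0 × n₅ ≡ 0 × rest ≡ [])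
    at-most-c n₁ n₂ n₃ n₄ n₅ rest rest≥6 A≡0 =
      ℤₚ.0≤i-j⇒j≤i (subst (+ 0 ≤_) T (total-nonneg bs)) ,
      λ M≡c → let open Tight (total-tight bs (trans T (ℤₚ.i≡j⇒i-j≡0 (sym M≡c)))) in
        tight₂ (pos 0) , tight₃ (pos 1) , tight₄ (pos 2) , tight₅ (pos 3) , tight₆ (λ { (s≤s 5≤L) → pos-≥ 5≤L })
      where
      open Weighted n₁ n₂ n₃ n₄ n₅ rest rest≥6 A≡0
      T : total (- + 1) (- + 1) (- + 1) (- + 1) (- + 1) (- + 1) (- + 1) ≡ c - size n₁ n₂ n₃ n₄ n₅ rest
      T = e (+ n₁) (+ n₂) (+ n₃) (+ n₄) (+ n₅) (+ length rest) c
        where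
        e : ∀ N₁ N₂ N₃ N₄ N₅ N₆ c →
          (N₁ * - + 1 + (N₂ * - + 1 + (N₃ * - + 1 + (N₄ * - + 1 + (N₅ * - + 1 + N₆ * - + 1))))) - - + 1 * c
          ≡ c - (N₁ + (N₂ + (N₃ + (N₄ + (N₅ + N₆)))))
        e = solve-∀
      slack≡ : ∀ L → a L ≡ - + 1 * b (suc L) - - + 1 * a (suc L)
      slack≡ L = trans (e c (a L) (b L)) (sym (cong₂ (λ x y → - + 1 * x - - + 1 * y) (b-suc L) (a-suc L)))
        where
        e : ∀ c a b → a ≡ - + 1 * (c * b - a) - - + 1 * (c * b)
        e = solve-∀
      nonneg : ∀ L → + 0 ≤ - + 1 * b (suc L) - - + 1 * a (suc L)
      nonneg L = subst (+ 0 ≤_) (slack≡ L) (0≤a L)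
      pos : ∀ L → - + 1 * b (suc (suc L)) - - + 1 * a (suc (suc L)) ≢ + 0
      pos L e = pos⇒≢0 (0<a L) (trans (slack≡ (suc L)) e)
      pos-≥ : ∀ {L} → 5 ℕ.≤ L → - + 1 * b (suc L) - - + 1 * a (suc L) ≢ + 0
      pos-≥ {suc L} _ = pos L
      bs : Bounds (- + 1) (- + 1) (- + 1) (- + 1) (- + 1) (- + 1) (- + 1)
      bs = record { bound₁ = nonneg 0 ; bound₂ = nonneg 1 ; bound₃ = nonneg 2 ; bound₄ = nonneg 3
                  ; bound₅ = nonneg 4 ; bound₆ = λ { {suc L} _ → nonneg L } }

    -- The ring solver proves identities only; the equation M = n + 1 for the number of branches is
    -- used by splitting off a multiple of M - (n + 1) from a total.
    at-deficit : ∀ {M x} X T → M ≡ n + + 1 → x ≡ (M - (n + + 1)) * X + T → x ≡ T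
    at-deficit X T refl e = trans e (lemma (n + + 1) X T)
      where
      lemma : ∀ m X T → (m - m) * X + T ≡ T
      lemma = solve-∀

    flip : ∀ P Q {L} → Q * a L - P * b L ≡ - P * b L - - Q * a L
    flip P Q {L} = e P Q (a L) (b L)
      where
      e : ∀ P Q a b → Q * a - P * b ≡ - P * b - - Q * a
      e = solve-∀

    slack₁-nonneg : ∀ δ → + 0 ≤ δ * b 1 - δ * a 1
    slack₁-nonneg δ = ℤₚ.≤-reflexive (sym (slack₁-zero δ))

    -- With a negative δ the weight 0 is always admissible. It serves for lengths of multiplicity 0.
    slack-unweighted : ∀ {Q} → + 0 ≤ Q → ∀ L → + 0 ≤ + 0 * b L - - Q * a L
    slack-unweighted {Q} h L = subst (+ 0 ≤_) (e Q (a L) (b L)) (*-nonneg h (0≤a L))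
      where
      e : ∀ Q a b → Q * a ≡ + 0 * b - - Q * a
      e = solve-∀

    -- With weight 1 on the ones and n / (n - 1) on all other branches the total is -j. So j = 0 and
    -- the sum is tight, the strict bounds exclude every other branch, and 2 = n + 1 contradicts n ≥
    -- 2.
    not-two-ones : ∀ j n₂ n₃ n₄ n₅ rest → All (6 ℕ.≤_) rest → A (grouped (2 ℕ.+ j) n₂ n₃ n₄ n₅ rest) ≡ + 0 →
      size (2 ℕ.+ j) n₂ n₃ n₄ n₅ rest ≢ n + + 1
    not-two-ones j n₂ n₃ n₄ n₅ rest rest≥6 A≡0 M≡ = small (tight₂ (nz 2)) (tight₃ (nz 3)) (tight₄ (nz 4)) (tight₅ (nz 5)) (tight₆ (λ {L} _ → nz L))
      where
      open Weighted (2 ℕ.+ j) n₂ n₃ n₄ n₅ rest rest≥6 A≡0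
      nz : ∀ L → n * b L - (n - + 1) * a L ≢ + 0
      nz L = pos⇒≢0 (ratio-bound L)
      bs : Bounds (n - + 1) (n - + 1) n n n n n
      bs = record { bound₁ = slack₁-nonneg (n - + 1) ; bound₂ = ℤₚ.<⇒≤ (ratio-bound 2) ; bound₃ = ℤₚ.<⇒≤ (ratio-bound 3) ; bound₄ = ℤₚ.<⇒≤ (ratio-bound 4)
                  ; bound₅ = ℤₚ.<⇒≤ (ratio-bound 5) ; bound₆ = λ {L} _ → ℤₚ.<⇒≤ (ratio-bound L) }
      T : total (n - + 1) (n - + 1) n n n n n ≡ - + j
      T = at-deficit n (- + j) M≡ (e (+ j) (+ n₂) (+ n₃) (+ n₄) (+ n₅) (+ length rest) n)
        where
        e : ∀ J N₂ N₃ N₄ N₅ N₆ n → ((+ 2 + J) * (n - + 1) + (N₂ * (n) + (N₃ * (n) + (N₄ * (n) + (N₅ * (n) + (N₆ * (n))))))) - (n - + 1) * (n + + 2)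
          ≡ (((+ 2 + J) + (N₂ + (N₃ + (N₄ + (N₅ + N₆))))) - (n + + 1)) * n + - J
        e = solve-∀
      j≡0 : + j ≡ + 0
      j≡0 = nonneg-+-zeroˡ (0≤+ j) (subst (+ 0 ≤_) T (total-nonneg bs)) (ℤₚ.+-inverseʳ (+ j))
      open Tight (total-tight bs (trans T (cong -_ j≡0)))
      small : n₂ ≡ 0 → n₃ ≡ 0 → n₄ ≡ 0 → n₅ ≡ 0 → rest ≡ [] → ⊥
      small refl refl refl refl refl = pos⇒≢0 0<n-1 (trans (e₁ n) (trans (cong (_- + 2) (trans (sym M≡) (e₂ (+ j)))) j≡0))
        where
        e₁ : ∀ n → n - + 1 ≡ n + + 1 - + 2
        e₁ = solve-∀
        e₂ : ∀ j → + 2 + j + + 0 ≡ + 2 + j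
        e₂ = solve-∀

    -- Here n + 1 ratios, each at least r 2 = (n + 2) / (n + 1), sum to n + 2. All of them therefore
    -- equal r 2, and longer branches have larger ratios.
    no-ones : ∀ n₂ n₃ n₄ n₅ rest → All (6 ℕ.≤_) rest → A (grouped 0 n₂ n₃ n₄ n₅ rest) ≡ + 0 →
      size 0 n₂ n₃ n₄ n₅ rest ≡ n + + 1 → n₃ ≡ 0 × n₄ ≡ 0 × n₅ ≡ 0 × rest ≡ []
    no-ones n₂ n₃ n₄ n₅ rest rest≥6 A≡0 M≡ =
      tight₃ (nz (s≤s (s≤s (s≤s z≤n)))) , tight₄ (nz (s≤s (s≤s (s≤s z≤n)))) , tight₅ (nz (s≤s (s≤s (s≤s z≤n)))) ,
      tight₆ (λ 6≤L → nz (ℕₚ.≤-trans (s≤s (s≤s (s≤s z≤n))) 6≤L))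
      where
      open Weighted 0 n₂ n₃ n₄ n₅ rest rest≥6 A≡0
      P = n + + 2
      Q = n + + 1
      base : Q * a 2 - P * b 2 ≡ + 0
      base = trans (cong₂ (λ x y → Q * x - P * y) a₂ b₂) (e n)
        where
        e : ∀ n → (n + + 1) * ((n + + 2) * (n + + 2)) - (n + + 2) * ((n + + 2) * (n + + 2 - + 1)) ≡ + 0
        e = solve-∀
      κ : + 0 < P * P + Q * Q * c - P * Q * c
      κ = subst (+ 0 <_) (e n) (0<n+ 2)
        where
        e : ∀ n → n + + 2 ≡ (n + + 2) * (n + + 2) + (n + + 1) * (n + + 1) * (n + + 2) - (n + + 2) * (n + + 1) * (n + + 2)
        e = solve-∀
      pos : ∀ {L} → 3 ℕ.≤ L → + 0 < - P * b L - - Q * a L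
      pos {L} 3≤L = subst (+ 0 <_) (flip P Q {L}) (lower-steps P Q (0<n+ 1) (ℤₚ.<⇒≤ (0<n+ 2)) κ 2 base 3≤L)
      nz : ∀ {L} → 3 ℕ.≤ L → - P * b L - - Q * a L ≢ + 0
      nz 3≤L = pos⇒≢0 (pos 3≤L)
      bs : Bounds (- Q) (- Q) (- P) (- P) (- P) (- P) (- P)
      bs = record { bound₁ = slack₁-nonneg (- Q) ; bound₂ = ℤₚ.≤-reflexive (trans (sym base) (flip P Q {2}))
                  ; bound₃ = ℤₚ.<⇒≤ (pos (s≤s (s≤s (s≤s z≤n)))) ; bound₄ = ℤₚ.<⇒≤ (pos (s≤s (s≤s (s≤s z≤n))))
                  ; bound₅ = ℤₚ.<⇒≤ (pos (s≤s (s≤s (s≤s z≤n)))) ; bound₆ = λ 6≤L → ℤₚ.<⇒≤ (pos (ℕₚ.≤-trans (s≤s (s≤s (s≤s z≤n))) 6≤L)) }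
      T : total (- Q) (- Q) (- P) (- P) (- P) (- P) (- P) ≡ + 0
      T = at-deficit (- P) (+ 0) M≡ (e (+ n₂) (+ n₃) (+ n₄) (+ n₅) (+ length rest) n)
        where
        e : ∀ N₂ N₃ N₄ N₅ N₆ n → (+ 0 * (- (n + + 1)) + (N₂ * (- (n + + 2)) + (N₃ * (- (n + + 2)) + (N₄ * (- (n + + 2)) + (N₅ * (- (n + + 2)) + (N₆ * (- (n + + 2)))))))) - (- (n + + 1)) * (n + + 2)
          ≡ ((+ 0 + (N₂ + (N₃ + (N₄ + (N₅ + N₆))))) - (n + + 1)) * - (n + + 2) + + 0
        e = solve-∀
      open Tight (total-tight bs T)

    -- Besides the single 1 there are n ratios, each at least r 3 = (n + 1) / n, with sum n + 1. All
    -- of them therefore equal r 3.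
    one-one-no-two : ∀ n₃ n₄ n₅ rest → All (6 ℕ.≤_) rest → A (grouped 1 0 n₃ n₄ n₅ rest) ≡ + 0 →
      size 1 0 n₃ n₄ n₅ rest ≡ n + + 1 → n₄ ≡ 0 × n₅ ≡ 0 × rest ≡ []
    one-one-no-two n₃ n₄ n₅ rest rest≥6 A≡0 M≡ =
      tight₄ (nz (s≤s (s≤s (s≤s (s≤s z≤n))))) , tight₅ (nz (s≤s (s≤s (s≤s (s≤s z≤n))))) ,
      tight₆ (λ 6≤L → nz (ℕₚ.≤-trans (s≤s (s≤s (s≤s (s≤s z≤n)))) 6≤L))
      where
      open Weighted 1 0 n₃ n₄ n₅ rest rest≥6 A≡0
      P = n + + 1
      Q = n
      base : Q * a 3 - P * b 3 ≡ + 0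
      base = trans (cong₂ (λ x y → Q * x - P * y) a₃ b₃) (e n)
        where
        e : ∀ n → n * ((n + + 2) * (n + + 2) * (n + + 2 - + 1)) - (n + + 1) * ((n + + 2) * (n + + 2) * (n + + 2 - + 2)) ≡ + 0
        e = solve-∀
      κ : + 0 < P * P + Q * Q * c - P * Q * c
      κ = subst (+ 0 <_) (e n) (+<+ (s≤s z≤n))
        where
        e : ∀ n → + 1 ≡ (n + + 1) * (n + + 1) + n * n * (n + + 2) - (n + + 1) * n * (n + + 2)
        e = solve-∀
      pos : ∀ {L} → 4 ℕ.≤ L → + 0 < - P * b L - - Q * a L
      pos {L} 4≤L = subst (+ 0 <_) (flip P Q {L}) (lower-steps P Q 0<n (ℤₚ.<⇒≤ (0<n+ 1)) κ 3 base 4≤L)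
      nz : ∀ {L} → 4 ℕ.≤ L → - P * b L - - Q * a L ≢ + 0
      nz 4≤L = pos⇒≢0 (pos 4≤L)
      bs : Bounds (- Q) (- Q) (+ 0) (- P) (- P) (- P) (- P)
      bs = record { bound₁ = slack₁-nonneg (- Q) ; bound₂ = slack-unweighted (ℤₚ.<⇒≤ 0<n) 2
                  ; bound₃ = ℤₚ.≤-reflexive (trans (sym base) (flip P Q {3})) ; bound₄ = ℤₚ.<⇒≤ (pos (s≤s (s≤s (s≤s (s≤s z≤n)))))
                  ; bound₅ = ℤₚ.<⇒≤ (pos (s≤s (s≤s (s≤s (s≤s z≤n))))) ; bound₆ = λ 6≤L → ℤₚ.<⇒≤ (pos (ℕₚ.≤-trans (s≤s (s≤s (s≤s (s≤s z≤n)))) 6≤L)) }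
      T : total (- Q) (- Q) (+ 0) (- P) (- P) (- P) (- P) ≡ + 0
      T = at-deficit (- P) (+ 0) M≡ (e (+ n₃) (+ n₄) (+ n₅) (+ length rest) n)
        where
        e : ∀ N₃ N₄ N₅ N₆ n → (+ 1 * (- n) + (+ 0 * (+ 0) + (N₃ * (- (n + + 1)) + (N₄ * (- (n + + 1)) + (N₅ * (- (n + + 1)) + (N₆ * (- (n + + 1)))))))) - (- n) * (n + + 2)
          ≡ ((+ 1 + (+ 0 + (N₃ + (N₄ + (N₅ + N₆))))) - (n + + 1)) * - (n + + 1) + + 0
        e = solve-∀
      open Tight (total-tight bs T)

    -- Since 1 + r 2 + (n - 1) r 5 = c, the n - 1 remaining ratios, each at least r 5, must all
    -- equal r 5. The quotient R / Q is r 2 over the common denominator.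
    one-one-one-two : ∀ n₅ rest → All (6 ℕ.≤_) rest → A (grouped 1 1 0 0 n₅ rest) ≡ + 0 →
      size 1 1 0 0 n₅ rest ≡ n + + 1 → rest ≡ []
    one-one-one-two n₅ rest rest≥6 A≡0 M≡ = tight₆ (λ 6≤L → pos⇒≢0 (pos 6≤L))
      where
      open Weighted 1 1 0 0 n₅ rest rest≥6 A≡0
      P = n * n + n - + 1
      Q = (n - + 1) * (n + + 1)
      R = (n - + 1) * (n + + 2)
      0<Q : + 0 < Q
      0<Q = *-pos 0<n-1 (0<n+ 1)
      0≤P : + 0 ≤ P
      0≤P = subst (+ 0 ≤_) (e n) (ℤₚ.<⇒≤ (+-pos 0<Q (ℤₚ.<⇒≤ 0<n)))
        where
        e : ∀ n → (n - + 1) * (n + + 1) + n ≡ n * n + n - + 1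
        e = solve-∀
      base : Q * a 5 - P * b 5 ≡ + 0
      base = trans (cong₂ (λ x y → Q * x - P * y) a₅ b₅) (e n)
        where
        e : ∀ n → (n - + 1) * (n + + 1) * ((n + + 2) * (n + + 2) * (n + + 2) * ((n + + 2) * (n + + 2) - + 3 * (n + + 2) + + 1))
          - (n * n + n - + 1) * ((n + + 2) * (n + + 2) * (n + + 2) * ((n + + 2 - + 1) * (n + + 2 - + 3))) ≡ + 0
        e = solve-∀
      base₂ : - R * b 2 - - Q * a 2 ≡ + 0
      base₂ = trans (cong₂ (λ x y → - R * x - - Q * y) b₂ a₂) (e n)
        where
        e : ∀ n → - ((n - + 1) * (n + + 2)) * ((n + + 2) * (n + + 2 - + 1)) - - ((n - + 1) * (n + + 1)) * ((n + + 2) * (n + + 2)) ≡ + 0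
        e = solve-∀
      κ : + 0 < P * P + Q * Q * c - P * Q * c
      κ = subst (+ 0 <_) (e n) (+<+ (s≤s z≤n))
        where
        e : ∀ n → + 1 ≡ (n * n + n - + 1) * (n * n + n - + 1) + (n - + 1) * (n + + 1) * ((n - + 1) * (n + + 1)) * (n + + 2)
          - (n * n + n - + 1) * ((n - + 1) * (n + + 1)) * (n + + 2)
        e = solve-∀
      pos : ∀ {L} → 6 ℕ.≤ L → + 0 < - P * b L - - Q * a L
      pos {L} 6≤L = subst (+ 0 <_) (flip P Q {L}) (lower-steps P Q 0<Q 0≤P κ 5 base 6≤L)
      bs : Bounds (- Q) (- Q) (- R) (+ 0) (+ 0) (- P) (- P)
      bs = record { bound₁ = slack₁-nonneg (- Q) ; bound₂ = ℤₚ.≤-reflexive (sym base₂)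
                  ; bound₃ = slack-unweighted (ℤₚ.<⇒≤ 0<Q) 3 ; bound₄ = slack-unweighted (ℤₚ.<⇒≤ 0<Q) 4
                  ; bound₅ = ℤₚ.≤-reflexive (trans (sym base) (flip P Q {5})) ; bound₆ = λ 6≤L → ℤₚ.<⇒≤ (pos 6≤L) }
      T : total (- Q) (- Q) (- R) (+ 0) (+ 0) (- P) (- P) ≡ + 0
      T = at-deficit (- P) (+ 0) M≡ (e (+ n₅) (+ length rest) n)
        where
        e : ∀ N₅ N₆ n → (+ 1 * (- ((n - + 1) * (n + + 1))) + (+ 1 * (- ((n - + 1) * (n + + 2))) + (+ 0 * (+ 0) + (+ 0 * (+ 0) + (N₅ * (- (n * n + n - + 1)) + (N₆ * (- (n * n + n - + 1)))))))) - (- ((n - + 1) * (n + + 1))) * (n + + 2)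
          ≡ ((+ 1 + (+ 1 + (+ 0 + (+ 0 + (N₅ + N₆))))) - (n + + 1)) * - (n * n + n - + 1) + + 0
        e = solve-∀
      open Tight (total-tight bs T)

    -- A surplus Z has to pay Y > Z for each further branch of length 2 and Z for each of length 3
    -- or 4. So j = 0 and at most one 3 or 4 is affordable; that one would use up the surplus, and
    -- the tight case excludes it.
    few-short : ∀ {t Y Z} → + 0 < Z → + 0 < Y - Z → + 0 ≤ t → ∀ j n₃ n₄ → t ≡ Z - + j * Y - (+ n₃ + + n₄) * Z →
      (t ≡ + 0 → n₃ ≡ 0 × n₄ ≡ 0) → j ≡ 0 × n₃ ≡ 0 × n₄ ≡ 0
    few-short {t} {Y} {Z} 0<Z 0<Y-Z 0≤t (suc j) n₃ n₄ e _ = ⊥-elim (nonneg-+-pos-absurd 0≤t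
      (+-pos 0<Y-Z (+-nonneg (*-nonneg (0≤+ j) 0≤Y) (*-nonneg (0≤+ (n₃ ℕ.+ n₄)) (ℤₚ.<⇒≤ 0<Z))))
      (trans (cong (λ t → t + _) e) (lemma (+ j) (+ n₃ + + n₄) Y Z)))
      where
      0≤Y : + 0 ≤ Y
      0≤Y = subst (+ 0 ≤_) (e′ Y Z) (ℤₚ.<⇒≤ (+-pos 0<Y-Z (ℤₚ.<⇒≤ 0<Z)))
        where
        e′ : ∀ Y Z → Y - Z + Z ≡ Y
        e′ = solve-∀
      lemma : ∀ J S Y Z → Z - (+ 1 + J) * Y - S * Z + (Y - Z + (J * Y + S * Z)) ≡ + 0
      lemma = solve-∀
    few-short 0<Z 0<Y-Z 0≤t zero zero zero e _ = refl , refl , refl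
    few-short {t} {Y} {Z} 0<Z 0<Y-Z 0≤t zero (suc n₃) n₄ e tight = ⊥-elim (ℕₚ.1+n≢0 (proj₁ (tight (nonneg-+-zeroˡ 0≤t
      (*-nonneg (0≤+ (n₃ ℕ.+ n₄)) (ℤₚ.<⇒≤ 0<Z)) (trans (cong (λ t → t + _) e) (lemma (+ n₃) (+ n₄) Y Z))))))
      where
      lemma : ∀ S S′ Y Z → Z - + 0 * Y - (+ 1 + S + S′) * Z + (S + S′) * Z ≡ + 0
      lemma = solve-∀
    few-short {t} {Y} {Z} 0<Z 0<Y-Z 0≤t zero zero (suc n₄) e tight = ⊥-elim (ℕₚ.1+n≢0 (proj₂ (tight (nonneg-+-zeroˡ 0≤t
      (*-nonneg (0≤+ n₄) (ℤₚ.<⇒≤ 0<Z)) (trans (cong (λ t → t + _) e) (lemma (+ n₄) Y Z))))))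
      where
      lemma : ∀ S Y Z → Z - + 0 * Y - (+ 0 + (+ 1 + S)) * Z + S * Z ≡ + 0
      lemma = solve-∀

    -- For c = 4 the ratios are r L = 2L / (L + 1), with supremum 2. Over the denominator 3 the
    -- bounds 4/3 for length 2, 5/3 for lengths 3 and 4, and 6/3 from 5 on suffice. The general
    -- weights fail here, as their denominator has the factor n² - 4.
    one-one-some-two-small : n ≡ + 2 → ∀ j n₃ n₄ n₅ rest → All (6 ℕ.≤_) rest → A (grouped 1 (suc j) n₃ n₄ n₅ rest) ≡ + 0 →
      size 1 (suc j) n₃ n₄ n₅ rest ≡ n + + 1 → j ≡ 0 × n₃ ≡ 0 × n₄ ≡ 0
    one-one-some-two-small n≡2 j n₃ n₄ n₅ rest rest≥6 A≡0 M≡ =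
      few-short {Y = + 2} (+<+ (s≤s z≤n)) (+<+ (s≤s z≤n)) (total-nonneg bs) j n₃ n₄ T
        (λ e → let open Tight (total-tight bs e) in tight₃ (pos⇒≢0 pos₃) , tight₄ (pos⇒≢0 pos₄))
      where
      open Weighted 1 (suc j) n₃ n₄ n₅ rest rest≥6 A≡0
      0≤6b-3a : ∀ L → + 0 ≤ + 6 * b L - + 3 * a L
      0≤6b-3a L = subst (+ 0 ≤_) (e (a L) (b L)) (*-nonneg {+ 3} (0≤+ 3) (0≤2b-a L))
        where
        e : ∀ a b → + 3 * (+ 2 * b - a) ≡ + 6 * b - + 3 * a
        e = solve-∀
      pos₃ : + 0 < + 5 * b 3 - + 3 * a 3
      pos₃ = subst (+ 0 <_) (slack-value (+ 5) (+ 3) _ a₃ b₃ (e n))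
        (*-pos (*-pos 0<c 0<c) (+-pos {+ 1} (+<+ (s≤s z≤n)) (*-nonneg {+ 2} (0≤+ 2) 0≤n-2)))
        where
        e : ∀ n → (n + + 2) * (n + + 2) * (+ 1 + + 2 * (n - + 2)) ≡ + 5 * ((n + + 2) * (n + + 2) * (n + + 2 - + 2)) - + 3 * ((n + + 2) * (n + + 2) * (n + + 2 - + 1))
        e = solve-∀
      pos₄ : + 0 < + 5 * b 4 - + 3 * a 4
      pos₄ = subst (+ 0 <_) (slack-value (+ 5) (+ 3) _ a₄ b₄ (e n))
        (*-pos (*-pos 0<c 0<c) (+-pos {+ 1} (+<+ (s≤s z≤n)) (*-nonneg (ℤₚ.<⇒≤ (+-pos {+ 7} (+<+ (s≤s z≤n)) (*-nonneg {+ 2} (0≤+ 2) 0≤n-2))) 0≤n-2)))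
        where
        e : ∀ n → (n + + 2) * (n + + 2) * (+ 1 + (+ 7 + + 2 * (n - + 2)) * (n - + 2))
          ≡ + 5 * ((n + + 2) * (n + + 2) * ((n + + 2) * (n + + 2) - + 3 * (n + + 2) + + 1)) - + 3 * ((n + + 2) * (n + + 2) * ((n + + 2) * (n + + 2 - + 2)))
        e = solve-∀
      bs : Bounds (+ 3) (+ 3) (+ 4) (+ 5) (+ 5) (+ 6) (+ 6)
      bs = record { bound₁ = slack₁-nonneg (+ 3)
                  ; bound₂ = subst (+ 0 ≤_) (slack-value (+ 4) (+ 3) _ a₂ b₂ (e n)) (*-nonneg (ℤₚ.<⇒≤ 0<c) 0≤n-2)
                  ; bound₃ = ℤₚ.<⇒≤ pos₃ ; bound₄ = ℤₚ.<⇒≤ pos₄ ; bound₅ = 0≤6b-3a 5 ; bound₆ = λ {L} _ → 0≤6b-3a L }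
        where
        e : ∀ n → (n + + 2) * (n - + 2) ≡ + 4 * ((n + + 2) * (n + + 2 - + 1)) - + 3 * ((n + + 2) * (n + + 2))
        e = solve-∀
      T : total (+ 3) (+ 3) (+ 4) (+ 5) (+ 5) (+ 6) (+ 6) ≡ + 1 - + j * + 2 - (+ n₃ + + n₄) * + 1
      T = at-deficit (+ 6) _ M≡ (trans (e (+ j) (+ n₃) (+ n₄) (+ n₅) (+ length rest) n) (+-cancel (ℤₚ.i≡j⇒i-j≡0 n≡2)))
        where
        m = size 1 (suc j) n₃ n₄ n₅ rest - (n + + 1)
        r = + 1 - + j * + 2 - (+ n₃ + + n₄) * + 1
        +-cancel : n - + 2 ≡ + 0 → m * + 6 + ((n - + 2) * + 3 + r) ≡ m * + 6 + r
        +-cancel h = cong (λ z → m * + 6 + z) (trans (cong (λ z → z * + 3 + r) h) (ℤₚ.+-identityˡ r))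
        e : ∀ J N₃ N₄ N₅ N₆ n → (+ 1 * (+ 3) + ((+ 1 + J) * (+ 4) + (N₃ * (+ 5) + (N₄ * (+ 5) + (N₅ * (+ 6) + (N₆ * (+ 6))))))) - (+ 3) * (n + + 2)
          ≡ ((+ 1 + ((+ 1 + J) + (N₃ + (N₄ + (N₅ + N₆))))) - (n + + 1)) * + 6 + ((n - + 2) * + 3 + (+ 1 - J * + 2 - (N₃ + N₄) * + 1))
        e = solve-∀

    -- The weights are α₂ / Q = r 2, P / Q = r 5 + 1 / Q and α₃ / Q = r 3 + 1 / (n (n² + n - 2)).
    -- The last lies just above r 4 = r 3 + 1 / (n (n² + n - 1)), so one weight serves lengths 3 and
    -- 4. V is the discriminant c² - 4c of the fixed-point equation r (c - r) = c.
    one-one-some-two-large : + 3 ≤ n → ∀ j n₃ n₄ n₅ rest → All (6 ℕ.≤_) rest → A (grouped 1 (suc j) n₃ n₄ n₅ rest) ≡ + 0 →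
      size 1 (suc j) n₃ n₄ n₅ rest ≡ n + + 1 → j ≡ 0 × n₃ ≡ 0 × n₄ ≡ 0
    one-one-some-two-large 3≤n j n₃ n₄ n₅ rest rest≥6 A≡0 M≡ =
      few-short 0<n-1 0<Y-Z (total-nonneg bs) j n₃ n₄ T
        (λ e → let open Tight (total-tight bs e) in tight₃ (pos⇒≢0 pos₃) , tight₄ (pos⇒≢0 pos₄))
      where
      open Weighted 1 (suc j) n₃ n₄ n₅ rest rest≥6 A≡0
      -- P / Q is an upper bound for all ratios, so tight that a branch of length 3 or 4 outweighs the
      -- gain P / Q - r 5 of all the others.
      U V Q α₂ α₃ P : ℤ
      U = n * n - + 1
      V = n * n - + 4
      Q = n * U * V
      α₂ = n * (n - + 1) * (n + + 2) * V
      α₃ = (n + + 1) * U * V + (V - n + + 2)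
      P = (n + + 1) * U * V + V + + 1
      0≤n-3 : + 0 ≤ n - + 3
      0≤n-3 = ℤₚ.i≤j⇒0≤j-i 3≤n
      0<n-2 : + 0 < n - + 2
      0<n-2 = subst (+ 0 <_) (e n) (+-pos {+ 1} (+<+ (s≤s z≤n)) 0≤n-3)
        where
        e : ∀ n → + 1 + (n - + 3) ≡ n - + 2
        e = solve-∀
      0<V-1 : + 0 < V - + 1
      0<V-1 = subst (+ 0 <_) (e n) (+-pos (+-pos {+ 4} (+<+ (s≤s z≤n)) 0≤n-3) (*-nonneg (ℤₚ.<⇒≤ (0<n+ 2)) 0≤n-3))
        where
        e : ∀ n → + 4 + (n - + 3) + (n + + 2) * (n - + 3) ≡ n * n - + 4 - + 1
        e = solve-∀
      0<V : + 0 < V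
      0<V = subst (+ 0 <_) (e V) (+-pos 0<V-1 (0≤+ 1))
        where
        e : ∀ V → V - + 1 + + 1 ≡ V
        e = solve-∀
      0<U : + 0 < U
      0<U = subst (+ 0 <_) (e n) (*-pos 0<n-1 (0<n+ 1))
        where
        e : ∀ n → (n - + 1) * (n + + 1) ≡ n * n - + 1
        e = solve-∀
      0<Q : + 0 < Q
      0<Q = *-pos (*-pos 0<n 0<U) 0<V
      0<P : + 0 < P
      0<P = +-pos (+-pos (*-pos (*-pos (0<n+ 1) 0<U) 0<V) (ℤₚ.<⇒≤ 0<V)) (0≤+ 1)
      κ : + 0 ≤ P * Q * c - Q * Q * c - P * P
      -- By n² = V + 4 and U = V + 3 this becomes a polynomial in V alone, namely V² + 4V - 1.
      κ = subst (+ 0 ≤_) (trans (trans (e₁ V) (cong₂ (λ x U → x * (U * V * (V + + 1)) - (U * V + V + + 1) * (U * V + V + + 1)) (e₂ n) (e₃ n))) (e₄ n U V))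
        (ℤₚ.<⇒≤ (+-pos 0<V-1 (*-nonneg (ℤₚ.<⇒≤ 0<V) (ℤₚ.<⇒≤ (+-pos 0<V (0≤+ 3))))))
        where
        e₁ : ∀ V → V - + 1 + V * (V + + 3) ≡ (V + + 4) * ((V + + 3) * V * (V + + 1)) - ((V + + 3) * V + V + + 1) * ((V + + 3) * V + V + + 1)
        e₁ = solve-∀
        e₂ : ∀ n → n * n - + 4 + + 4 ≡ n * n
        e₂ = solve-∀
        e₃ : ∀ n → n * n - + 4 + + 3 ≡ n * n - + 1
        e₃ = solve-∀
        e₄ : ∀ n U V → n * n * (U * V * (V + + 1)) - (U * V + V + + 1) * (U * V + V + + 1)
          ≡ ((n + + 1) * U * V + V + + 1) * (n * U * V) * (n + + 2) - n * U * V * (n * U * V) * (n + + 2)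
            - ((n + + 1) * U * V + V + + 1) * ((n + + 1) * U * V + V + + 1)
        e₄ = solve-∀
      nonneg : ∀ L → + 0 ≤ P * b L - Q * a L
      nonneg L = ℤₚ.<⇒≤ (upper-step P Q 0<Q 0<P κ L)
      0<Y-Z : + 0 < n * V + + 1 - (n - + 1)
      0<Y-Z = subst (+ 0 <_) (e n V) (+-pos (*-pos 0<n 0<V-1) (0≤+ 2))
        where
        e : ∀ n V → n * (V - + 1) + + 2 ≡ n * V + + 1 - (n - + 1)
        e = solve-∀
      pos₃ : + 0 < α₃ * b 3 - Q * a 3
      pos₃ = subst (+ 0 <_) (slack-value α₃ Q _ a₃ b₃ (trans (cong (λ x → c * c * (n * x)) (e₁ n)) (e₂ n U V (c * c))))
        (*-pos (*-pos 0<c 0<c) (*-pos 0<n (*-pos 0<n-2 (0<n+ 1))))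
        where
        e₁ : ∀ n → (n - + 2) * (n + + 1) ≡ n * n - + 4 - n + + 2
        e₁ = solve-∀
        e₂ : ∀ n U V C → C * (n * (V - n + + 2)) ≡ ((n + + 1) * U * V + (V - n + + 2)) * (C * (n + + 2 - + 2)) - n * U * V * (C * (n + + 2 - + 1))
        e₂ = solve-∀
      pos₄ : + 0 < α₃ * b 4 - Q * a 4
      pos₄ = subst (+ 0 <_) (slack-value α₃ Q _ a₄ b₄ (trans (cong (λ x → c * c * x) (e₁ n)) (e₂ n U V (c * c))))
        (*-pos (*-pos 0<c 0<c) (*-pos 0<n-2 (0<n+ 1)))
        where
        e₁ : ∀ n → (n - + 2) * (n + + 1) ≡ (n * n - + 4 - n + + 2) * (n * n + n - + 1) - (n * n - + 1) * (n * n - + 4)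
        e₁ = solve-∀
        e₂ : ∀ n U V C → C * ((V - n + + 2) * (n * n + n - + 1) - U * V)
          ≡ ((n + + 1) * U * V + (V - n + + 2)) * (C * ((n + + 2) * (n + + 2) - + 3 * (n + + 2) + + 1)) - n * U * V * (C * ((n + + 2) * (n + + 2 - + 2)))
        e₂ = solve-∀
      bs : Bounds Q Q α₂ α₃ α₃ P P
      bs = record { bound₁ = slack₁-nonneg Q
                  ; bound₂ = ℤₚ.≤-reflexive (slack-value α₂ Q _ a₂ b₂ (e n V))
                  ; bound₃ = ℤₚ.<⇒≤ pos₃ ; bound₄ = ℤₚ.<⇒≤ pos₄ ; bound₅ = nonneg 5 ; bound₆ = λ {L} _ → nonneg L }
        where
        e : ∀ n V → + 0 ≡ n * (n - + 1) * (n + + 2) * V * ((n + + 2) * (n + + 2 - + 1)) - n * (n * n - + 1) * V * ((n + + 2) * (n + + 2))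
        e = solve-∀
      -- One 1, one 2 and n - 1 fives sum exactly to c, so raising r 5 by 1 / Q yields the surplus n
      -- - 1. A further 2 costs P - α₂ = nV + 1, and a 3 or 4 costs P - α₃ = n - 1.
      T : total Q Q α₂ α₃ α₃ P P ≡ n - + 1 - + j * (n * V + + 1) - (+ n₃ + + n₄) * (n - + 1)
      T = at-deficit P _ M≡ (trans (e₁ Q α₂ α₃ P (+ j) (+ n₃) (+ n₄) (+ n₅) (+ length rest) n)
        (cong (λ z → (size 1 (suc j) n₃ n₄ n₅ rest - (n + + 1)) * P + z) (e₂ (+ j) (+ n₃ + + n₄) n V)))
        where
        e₁ : ∀ Q α₂ α₃ P J N₃ N₄ N₅ N₆ n →
          + 1 * Q + ((+ 1 + J) * α₂ + (N₃ * α₃ + (N₄ * α₃ + (N₅ * P + N₆ * P)))) - Q * (n + + 2)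
          ≡ (+ 1 + (+ 1 + J + (N₃ + (N₄ + (N₅ + N₆)))) - (n + + 1)) * P
            + (n * P - (n + + 1) * Q + (+ 1 + J) * (α₂ - P) + (N₃ + N₄) * (α₃ - P))
        e₁ = solve-∀
        e₂ : ∀ J S n V → let Q = n * (n * n - + 1) * V ; W = (n + + 1) * (n * n - + 1) * V ; P = W + V + + 1 in
          n * P - (n + + 1) * Q + (+ 1 + J) * (n * (n - + 1) * (n + + 2) * V - P) + S * (W + (V - n + + 2) - P)
          ≡ n - + 1 - J * (n * V + + 1) - S * (n - + 1)
        e₂ = solve-∀

    one-one-some-two : ∀ j n₃ n₄ n₅ rest → All (6 ℕ.≤_) rest → A (grouped 1 (suc j) n₃ n₄ n₅ rest) ≡ + 0 →
      size 1 (suc j) n₃ n₄ n₅ rest ≡ n + + 1 → j ≡ 0 × n₃ ≡ 0 × n₄ ≡ 0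
    one-one-some-two with n ℤₚ.≟ + 2
    ... | yes n≡2 = one-one-some-two-small n≡2
    ... | no n≢2  = one-one-some-two-large (ℤₚ.i<j⇒suc[i]≤j (ℤₚ.≤∧≢⇒< 2≤n (n≢2 ∘ sym)))

    data Solution : (n₁ n₂ n₃ n₄ n₅ : ℕ) → List ℕ → Set where
      all-1       : ∀ {n₁} → + n₁ ≡ n + + 2 → Solution n₁ 0 0 0 0 []
      all-2       : ∀ {n₂} → + n₂ ≡ n + + 1 → Solution 0 n₂ 0 0 0 []
      one-1-all-3 : ∀ {n₃} → + n₃ ≡ n → Solution 1 0 n₃ 0 0 []
      one-1-one-2-all-5 : ∀ {n₅} → + n₅ + + 1 ≡ n → Solution 1 1 0 0 n₅ []

    private
      cancel-one : ∀ {x y} → + 1 + x ≡ y + + 1 → x ≡ y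
      cancel-one {x} {y} h = trans (e₁ x) (trans (cong (_- + 1) h) (e₂ y))
        where
        e₁ : ∀ x → x ≡ + 1 + x - + 1
        e₁ = solve-∀
        e₂ : ∀ y → y + + 1 - + 1 ≡ y
        e₂ = solve-∀

      solution-1 : ∀ {n₁ n₂ n₃ n₄ n₅ rest} → n₂ ≡ 0 × n₃ ≡ 0 × n₄ ≡ 0 × n₅ ≡ 0 × rest ≡ [] →
        size n₁ n₂ n₃ n₄ n₅ rest ≡ n + + 2 → Solution n₁ n₂ n₃ n₄ n₅ rest
      solution-1 {n₁} (refl , refl , refl , refl , refl) M≡ = all-1 (trans (sym (ℤₚ.+-identityʳ (+ n₁))) M≡)

      solution-2 : ∀ {n₂ n₃ n₄ n₅ rest} → n₃ ≡ 0 × n₄ ≡ 0 × n₅ ≡ 0 × rest ≡ [] →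
        size 0 n₂ n₃ n₄ n₅ rest ≡ n + + 1 → Solution 0 n₂ n₃ n₄ n₅ rest
      solution-2 {n₂} (refl , refl , refl , refl) M≡ = all-2 (trans (e (+ n₂)) M≡)
        where
        e : ∀ x → x ≡ + 0 + (x + + 0)
        e = solve-∀

      solution-3 : ∀ {n₃ n₄ n₅ rest} → n₄ ≡ 0 × n₅ ≡ 0 × rest ≡ [] →
        size 1 0 n₃ n₄ n₅ rest ≡ n + + 1 → Solution 1 0 n₃ n₄ n₅ rest
      solution-3 {n₃} (refl , refl , refl) M≡ = one-1-all-3 (cancel-one (trans (e (+ n₃)) M≡))
        where
        e : ∀ x → + 1 + x ≡ + 1 + (+ 0 + (x + + 0))
        e = solve-∀

      solution-4 : ∀ {n₅ rest} → rest ≡ [] → size 1 1 0 0 n₅ rest ≡ n + + 1 → Solution 1 1 0 0 n₅ rest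
      solution-4 {n₅} refl M≡ = one-1-one-2-all-5 (cancel-one (trans (e (+ n₅)) M≡))
        where
        e : ∀ x → + 1 + (x + + 1) ≡ + 1 + (+ 1 + (+ 0 + (+ 0 + (x + + 0))))
        e = solve-∀

      solution-some-two : ∀ {j n₃ n₄ n₅ rest} → j ≡ 0 × n₃ ≡ 0 × n₄ ≡ 0 → All (6 ℕ.≤_) rest →
        A (grouped 1 (suc j) n₃ n₄ n₅ rest) ≡ + 0 → size 1 (suc j) n₃ n₄ n₅ rest ≡ n + + 1 → Solution 1 (suc j) n₃ n₄ n₅ rest
      solution-some-two {n₅ = n₅} {rest} (refl , refl , refl) rest≥6 A≡0 M≡ = solution-4 (one-one-one-two n₅ rest rest≥6 A≡0 M≡) M≡

      deficit : ∀ n₁ n₂ n₃ n₄ n₅ rest → All (6 ℕ.≤_) rest → A (grouped n₁ n₂ n₃ n₄ n₅ rest) ≡ + 0 →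
        size n₁ n₂ n₃ n₄ n₅ rest ≡ n + + 1 → Solution n₁ n₂ n₃ n₄ n₅ rest
      deficit 0 n₂ n₃ n₄ n₅ rest rest≥6 A≡0 M≡ = solution-2 (no-ones n₂ n₃ n₄ n₅ rest rest≥6 A≡0 M≡) M≡
      deficit 1 0 n₃ n₄ n₅ rest rest≥6 A≡0 M≡ = solution-3 (one-one-no-two n₃ n₄ n₅ rest rest≥6 A≡0 M≡) M≡
      deficit 1 (suc j) n₃ n₄ n₅ rest rest≥6 A≡0 M≡ =
        solution-some-two (one-one-some-two j n₃ n₄ n₅ rest rest≥6 A≡0 M≡) rest≥6 A≡0 M≡
      deficit (suc (suc j)) n₂ n₃ n₄ n₅ rest rest≥6 A≡0 M≡ = ⊥-elim (not-two-ones j n₂ n₃ n₄ n₅ rest rest≥6 A≡0 M≡)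

      between : ∀ {x} → n < x → x ≤ n + + 2 → x ≢ n + + 2 → x ≡ n + + 1
      between {x} l u x≢ = ℤₚ.≤-antisym (subst (x ≤_) (e n) (ℤₚ.i<j⇒i≤pred[j] (ℤₚ.≤∧≢⇒< u x≢)))
        (subst (_≤ x) (ℤₚ.+-comm (+ 1) n) (ℤₚ.i<j⇒suc[i]≤j l))
        where
        e : ∀ n → - + 1 + (n + + 2) ≡ n + + 1
        e = solve-∀

    classify : ∀ n₁ n₂ n₃ n₄ n₅ rest → All (6 ℕ.≤_) rest → A (grouped n₁ n₂ n₃ n₄ n₅ rest) ≡ + 0 → Solution n₁ n₂ n₃ n₄ n₅ rest
    classify n₁ n₂ n₃ n₄ n₅ rest rest≥6 A≡0 = split (size n₁ n₂ n₃ n₄ n₅ rest ℤₚ.≟ c)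
      where
      upper = at-most-c n₁ n₂ n₃ n₄ n₅ rest rest≥6 A≡0
      split : Dec (size n₁ n₂ n₃ n₄ n₅ rest ≡ c) → Solution n₁ n₂ n₃ n₄ n₅ rest
      split (yes M≡c) = solution-1 (proj₂ upper M≡c) M≡c
      split (no M≢c)  = deficit n₁ n₂ n₃ n₄ n₅ rest rest≥6 A≡0
        (between (at-least-c-1 n₁ n₂ n₃ n₄ n₅ rest rest≥6 A≡0) (proj₁ upper) M≢c)

-- Evaluation at a square root of c.

module RootEvaluation where

  open Determinants
  open StarlikeDeterminants
  open IntegerPolynomials
  open PathRatios
  open LengthClassification
  open import Defs
  open import Data.Nat as ℕ using (ℕ; zero; suc)
  import Data.Nat.Properties as ℕₚ
  open import Data.Integer using (ℤ; +_; _+_; _*_; -_; _-_; _≤_)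
  import Data.Integer.Properties as ℤₚ
  open import Data.Integer.Tactic.RingSolver using (solve-∀)
  open import Data.List as List using (List; []; _∷_; _++_; replicate)
  open import Data.Nat.ListAction using (sum)
  open import Data.Fin using (toℕ)
  open import Data.List.Relation.Unary.All as All using (All; []; _∷_)
  open import Data.List.Relation.Unary.All.Properties using (++⁺; replicate⁺)
  open import Data.Product using (_×_; _,_; proj₁; proj₂)
  open import Relation.Binary.PropositionalEquality using (_≡_; refl; sym; trans; cong; cong₂; subst)
  open PZ using (scale; negP; oneP; _+P_)
  open Characteristic polyRing X
  open Det polyRing using (isolated-vertex)

  full-[] : full [] ≋ X *P oneP
  full-[] = isolated-vertex 0 (λ i j → entry [] (toℕ i) (toℕ j)) (λ ())

  module Evaluation (c : ℤ) (4≤c : + 4 ≤ c) where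
    open Ratio c 4≤c

    -- The pair (u , v) stands for u + vs in ℤ[s] with s² = c.
    infixl 7 _⊗_
    infixl 6 _⊕_
    _⊗_ _⊕_ : ℤ × ℤ → ℤ × ℤ → ℤ × ℤ
    (u , v) ⊗ (u′ , v′) = u * u′ + c * (v * v′) , u * v′ + v * u′
    (u , v) ⊕ (u′ , v′) = u + u′ , v + v′

    ⊖_ : ℤ × ℤ → ℤ × ℤ
    ⊖ (u , v) = - u , - v

    s·_ : ℤ × ℤ → ℤ × ℤ
    s· (u , v) = c * v , u

    ev : PolyZ → ℤ × ℤ
    ev []      = + 0 , + 0
    ev (a ∷ p) = (a , + 0) ⊕ s· ev p

    pair≡ : {u u′ v v′ : ℤ} → u ≡ u′ → v ≡ v′ → (u , v) ≡ (u′ , v′)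
    pair≡ = cong₂ _,_

    ev-zero : ∀ p → p ≋ [] → ev p ≡ (+ 0 , + 0)
    ev-zero []      h = refl
    ev-zero (a ∷ p) (coeffwise h) =
      trans (cong₂ (λ x z → (x , + 0) ⊕ s· z) (h 0) (ev-zero p (coeffwise λ i → h (suc i))))
            (cong (λ z → + 0 + z , + 0) (ℤₚ.*-zeroʳ c))

    ev-cong : ∀ p q → p ≋ q → ev p ≡ ev q
    ev-cong []      q       h = sym (ev-zero q (≋-sym h))
    ev-cong (a ∷ p) []      h = ev-zero (a ∷ p) h
    ev-cong (a ∷ p) (b ∷ q) (coeffwise h) =
      cong₂ (λ x z → (x , + 0) ⊕ s· z) (h 0) (ev-cong p q (coeffwise λ i → h (suc i)))

    ev-+ : ∀ p q → ev (p +P q) ≡ ev p ⊕ ev q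
    ev-+ []      q       = pair≡ (sym (ℤₚ.+-identityˡ _)) (sym (ℤₚ.+-identityˡ _))
    ev-+ (a ∷ p) []      = pair≡ (sym (ℤₚ.+-identityʳ _)) (sym (ℤₚ.+-identityʳ _))
    ev-+ (a ∷ p) (b ∷ q) = trans (cong (λ z → (a + b , + 0) ⊕ s· z) (ev-+ p q))
      (pair≡ (e₁ a b c (proj₂ (ev p)) (proj₂ (ev q))) (e₂ (proj₁ (ev p)) (proj₁ (ev q))))
      where
      e₁ : ∀ a b c v v′ → a + b + c * (v + v′) ≡ a + c * v + (b + c * v′)
      e₁ = solve-∀
      e₂ : ∀ u u′ → + 0 + (u + u′) ≡ + 0 + u + (+ 0 + u′)
      e₂ = solve-∀

    ev-neg : ∀ p → ev (negP p) ≡ ⊖ ev p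
    ev-neg []      = refl
    ev-neg (a ∷ p) = trans (cong (λ z → (- a , + 0) ⊕ s· z) (ev-neg p)) (pair≡ (e₁ a c (proj₂ (ev p))) (e₂ (proj₁ (ev p))))
      where
      e₁ : ∀ a c v → - a + c * - v ≡ - (a + c * v)
      e₁ = solve-∀
      e₂ : ∀ u → + 0 + - u ≡ - (+ 0 + u)
      e₂ = solve-∀

    ev-scale : ∀ a p → ev (scale a p) ≡ (a , + 0) ⊗ ev p
    ev-scale a []      = pair≡ (e₁ a c) (e₂ a)
      where
      e₁ : ∀ a c → + 0 ≡ a * + 0 + c * (+ 0 * + 0)
      e₁ = solve-∀
      e₂ : ∀ a → + 0 ≡ a * + 0 + + 0 * + 0
      e₂ = solve-∀
    ev-scale a (b ∷ p) = trans (cong (λ z → (a * b , + 0) ⊕ s· z) (ev-scale a p))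
      (pair≡ (e₁ a b c (proj₁ (ev p)) (proj₂ (ev p))) (e₂ a b c (proj₁ (ev p)) (proj₂ (ev p))))
      where
      e₁ : ∀ a b c u v → a * b + c * (a * v + + 0 * u) ≡ a * (b + c * v) + c * (+ 0 * (+ 0 + u))
      e₁ = solve-∀
      e₂ : ∀ a b c u v → + 0 + (a * u + c * (+ 0 * v)) ≡ a * (+ 0 + u) + + 0 * (b + c * v)
      e₂ = solve-∀

    ev-* : ∀ p q → ev (p *P q) ≡ ev p ⊗ ev q
    ev-* []      q = pair≡ (e₁ c (proj₁ (ev q)) (proj₂ (ev q))) (e₂ (proj₁ (ev q)) (proj₂ (ev q)))
      where
      e₁ : ∀ c u v → + 0 ≡ + 0 * u + c * (+ 0 * v)
      e₁ = solve-∀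
      e₂ : ∀ u v → + 0 ≡ + 0 * v + + 0 * u
      e₂ = solve-∀
    ev-* (a ∷ p) q = trans (ev-+ (scale a q) (+ 0 ∷ p *P q))
      (trans (cong₂ (λ z w → z ⊕ ((+ 0 , + 0) ⊕ s· w)) (ev-scale a q) (ev-* p q))
        (pair≡ (e₁ a c (proj₁ (ev p)) (proj₂ (ev p)) (proj₁ (ev q)) (proj₂ (ev q)))
               (e₂ a c (proj₁ (ev p)) (proj₂ (ev p)) (proj₁ (ev q)) (proj₂ (ev q)))))
      where
      e₁ : ∀ a c u v u′ v′ → a * u′ + c * (+ 0 * v′) + (+ 0 + c * (u * v′ + v * u′)) ≡ (a + c * v) * u′ + c * ((+ 0 + u) * v′)
      e₁ = solve-∀
      e₂ : ∀ a c u v u′ v′ → a * v′ + + 0 * u′ + (+ 0 + (u * u′ + c * (v * v′))) ≡ (a + c * v) * v′ + (+ 0 + u) * u′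
      e₂ = solve-∀

    scaled : ℕ → ℤ × ℤ → ℤ × ℤ
    scaled zero    z = z
    scaled (suc k) z = s· scaled k z

    s·-⊗ˡ : ∀ z w → s· (z ⊗ w) ≡ (s· z) ⊗ w
    s·-⊗ˡ (u , v) (u′ , v′) = pair≡ (e₁ c u v u′ v′) (e₂ c u v u′ v′)
      where
      e₁ : ∀ c u v u′ v′ → c * (u * v′ + v * u′) ≡ c * v * u′ + c * (u * v′)
      e₁ = solve-∀
      e₂ : ∀ c u v u′ v′ → u * u′ + c * (v * v′) ≡ c * v * v′ + u * u′
      e₂ = solve-∀

    s·-⊗ʳ : ∀ z w → s· (z ⊗ w) ≡ z ⊗ (s· w)
    s·-⊗ʳ (u , v) (u′ , v′) = pair≡ (e₁ c u v u′ v′) (e₂ c u v u′ v′)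
      where
      e₁ : ∀ c u v u′ v′ → c * (u * v′ + v * u′) ≡ u * (c * v′) + c * (v * u′)
      e₁ = solve-∀
      e₂ : ∀ c u v u′ v′ → u * u′ + c * (v * v′) ≡ u * u′ + v * (c * v′)
      e₂ = solve-∀

    scaled-⊗ : ∀ k l z w → scaled (k ℕ.+ l) (z ⊗ w) ≡ scaled k z ⊗ scaled l w
    scaled-⊗ zero    zero    z w = refl
    scaled-⊗ zero    (suc l) z w = trans (cong s·_ (scaled-⊗ zero l z w)) (s·-⊗ʳ z (scaled l w))
    scaled-⊗ (suc k) l       z w = trans (cong s·_ (scaled-⊗ k l z w)) (s·-⊗ˡ (scaled k z) (scaled l w))

    scaled-⊖ : ∀ k z w → scaled k (z ⊕ ⊖ w) ≡ scaled k z ⊕ ⊖ scaled k w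
    scaled-⊖ zero    z w = refl
    scaled-⊖ (suc k) z w = trans (cong s·_ (scaled-⊖ k z w)) (pair≡ (e c (proj₂ (scaled k z)) (proj₂ (scaled k w))) refl)
      where
      e : ∀ c v v′ → c * (v + - v′) ≡ c * v + - (c * v′)
      e = solve-∀

    scaled-zero : ∀ k → scaled k (+ 0 , + 0) ≡ (+ 0 , + 0)
    scaled-zero zero    = refl
    scaled-zero (suc k) = trans (cong s·_ (scaled-zero k)) (pair≡ (ℤₚ.*-zeroʳ c) refl)

    -- Every polynomial below contains only even or only odd powers of X, so a suitable power of s
    -- turns its value at s into an integer.
    Value : ℕ → PolyZ → ℤ → Set
    Value k p v = scaled k (ev p) ≡ (v , + 0)

    value-cong : ∀ k {p q v} → p ≋ q → Value k p v → Value k q v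
    value-cong k {p} {q} h e = trans (cong (scaled k) (sym (ev-cong p q h))) e

    value-* : ∀ k l p q {v w} → Value k p v → Value l q w → Value (k ℕ.+ l) (p *P q) (v * w)
    value-* k l p q {v} {w} e f = trans (cong (scaled (k ℕ.+ l)) (ev-* p q)) (trans (scaled-⊗ k l (ev p) (ev q))
      (trans (cong₂ _⊗_ e f) (pair≡ (e₁ c v w) (e₂ v w))))
      where
      e₁ : ∀ c v w → v * w + c * (+ 0 * + 0) ≡ v * w
      e₁ = solve-∀
      e₂ : ∀ v w → v * + 0 + + 0 * w ≡ + 0
      e₂ = solve-∀

    value-- : ∀ k p q {v w} → Value k p v → Value k q w → Value k (p +P negP q) (v - w)
    value-- k p q e f = trans (cong (scaled k) (trans (ev-+ p (negP q)) (cong (ev p ⊕_) (ev-neg q))))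
      (trans (scaled-⊖ k (ev p) (ev q)) (cong₂ (λ z w → z ⊕ ⊖ w) e f))

    value-step : ∀ k p {v} → Value k p v → Value (suc (suc k)) p (c * v)
    value-step k p e = trans (cong (λ z → s· s· z) e) (pair≡ refl (ℤₚ.*-zeroʳ c))

    value-X : Value 1 X c
    value-X = pair≡ (e₁ c) (e₂ c)
      where
      e₁ : ∀ c → c * (+ 0 + (+ 1 + c * + 0)) ≡ c
      e₁ = solve-∀
      e₂ : ∀ c → + 0 + c * (+ 0 + + 0) ≡ + 0
      e₂ = solve-∀

    value-1 : Value 0 oneP (+ 1)
    value-1 = pair≡ (cong (λ z → + 1 + z) (ℤₚ.*-zeroʳ c)) refl

    -- The polynomial `φ⁻ L` is scaled by two powers of s beyond its degree L - 1, so that both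
    -- terms of x φ L - φ⁻ L carry the exponent L + 1. This is the origin of the factor c in `a`.
    value-φ : ∀ L → Value L (φ L) (b L)
    value-φ⁻ : ∀ L → Value (suc L) (φ⁻ L) (a L)
    value-φ zero    = trans value-1 (pair≡ (sym b-zero) refl)
    value-φ (suc L) = trans (value-- (suc L) (X *P φ L) (φ⁻ L) (value-* 1 L X (φ L) value-X (value-φ L)) (value-φ⁻ L))
      (pair≡ (sym (b-suc L)) refl)
    value-φ⁻ zero    = trans (scaled-zero 1) (pair≡ (sym a-zero) refl)
    value-φ⁻ (suc L) = trans (value-step L (φ L) (value-φ L)) (pair≡ (sym (a-suc L)) refl)

    value-full    : ∀ Ls → Value (suc (sum Ls)) (full Ls) (A Ls)
    value-deleted : ∀ Ls → Value (sum Ls) (deleted Ls) (B Ls)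
    value-full []       = value-cong 1 {X *P oneP} (≋-sym full-[]) (subst (Value 1 (X *P oneP)) (ℤₚ.*-identityʳ c) (value-* 1 0 X oneP value-X value-1))
    value-full (L ∷ Ls) = value-cong (suc (L ℕ.+ sum Ls)) (≋-sym (full-∷ L Ls))
      (value-- (suc (L ℕ.+ sum Ls)) (φ L *P full Ls) (φ⁻ L *P deleted Ls)
        (subst (λ k → Value k (φ L *P full Ls) (b L * A Ls)) (ℕₚ.+-suc L (sum Ls))
          (value-* L (suc (sum Ls)) (φ L) (full Ls) (value-φ L) (value-full Ls)))
        (value-* (suc L) (sum Ls) (φ⁻ L) (deleted Ls) (value-φ⁻ L) (value-deleted Ls)))
    value-deleted []       = value-1
    value-deleted (L ∷ Ls) = value-cong (L ℕ.+ sum Ls) (≋-sym (deleted-∷ L Ls))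
      (value-* L (sum Ls) (φ L) (deleted Ls) (value-φ L) (value-deleted Ls))

    -- The factor x² - c evaluates to zero and scaling preserves zero, whatever the cofactor is. The
    -- pairs are formal, so c may also be a perfect square.
    root⇒A≡0 : ∀ Ls q → full Ls ≋ q *P x²-[ c ] → A Ls ≡ + 0
    root⇒A≡0 Ls q h = cong proj₁ (trans (sym (value-full Ls))
      (trans (cong (scaled (suc (sum Ls))) (trans (ev-cong _ _ h) (trans (ev-* q x²-[ c ]) zero-factor)))
        (scaled-zero (suc (sum Ls)))))
      where
      zero-factor : ev q ⊗ ev x²-[ c ] ≡ (+ 0 , + 0)
      zero-factor = pair≡ (e₁ c (proj₁ (ev q)) (proj₂ (ev q))) (e₂ c (proj₁ (ev q)) (proj₂ (ev q)))
        where
        e₁ : ∀ c u v → u * (- c + c * (+ 0 + (+ 1 + c * + 0))) + c * (v * (+ 0 + (+ 0 + c * (+ 0 + + 0)))) ≡ + 0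
        e₁ = solve-∀
        e₂ : ∀ c u v → u * (+ 0 + (+ 0 + c * (+ 0 + + 0))) + v * (- c + c * (+ 0 + (+ 1 + c * + 0))) ≡ + 0
        e₂ = solve-∀

  lengths-≥ : ∀ i ns → All (i ℕ.≤_) (pathLengths i ns)
  lengths-≥ i []       = []
  lengths-≥ i (m ∷ ns) = ++⁺ (replicate⁺ m ℕₚ.≤-refl) (All.map ℕₚ.<⇒≤ (lengths-≥ (suc i) ns))

  -- The default 0 stands for the omitted trailing multiplicities.
  head₀ : List ℕ → ℕ
  head₀ []      = 0
  head₀ (m ∷ _) = m

  tail₀ : List ℕ → List ℕ
  tail₀ []       = []
  tail₀ (_ ∷ ns) = ns

  lengths-split : ∀ i ns → pathLengths i ns ≡ replicate (head₀ ns) i ++ pathLengths (suc i) (tail₀ ns)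
  lengths-split i []       = refl
  lengths-split i (m ∷ ns) = refl

  lengths-grouped : ∀ ns → let t₁ = tail₀ ns ; t₂ = tail₀ t₁ ; t₃ = tail₀ t₂ ; t₄ = tail₀ t₃ in
    pathLengths 1 ns ≡ grouped (head₀ ns) (head₀ t₁) (head₀ t₂) (head₀ t₃) (head₀ t₄) (pathLengths 6 (tail₀ t₄))
  lengths-grouped ns =
    trans (lengths-split 1 ns) (cong (replicate (head₀ ns) 1 ++_)
    (trans (lengths-split 2 t₁) (cong (replicate (head₀ t₁) 2 ++_)
    (trans (lengths-split 3 t₂) (cong (replicate (head₀ t₂) 3 ++_)
    (trans (lengths-split 4 t₃) (cong (replicate (head₀ t₃) 4 ++_) (lengths-split 5 t₄))))))))
    where
    t₁ = tail₀ ns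
    t₂ = tail₀ t₁
    t₃ = tail₀ t₂
    t₄ = tail₀ t₃

-- Closed forms of the four characteristic polynomials.

module ClosedForms where

  open Determinants
  open StarlikeDeterminants
  open IntegerPolynomials
  open RootEvaluation using (full-[])
  open import Defs
  open import Algebra.Bundles using (CommutativeRing)
  import Algebra.Solver.Ring as RingSolver
  open import Algebra.Solver.Ring.AlmostCommutativeRing using (fromCommutativeRing; _-Raw-AlmostCommutative⟶_)
  open import Data.Nat as ℕ using (zero; suc)
  open import Data.Integer as ℤ using (ℤ; +_)
  import Data.Integer.Properties as ℤₚ
  open import Data.List using ([]; _∷_; _++_; replicate)
  open import Data.Maybe using (Maybe; just; nothing)
  open import Relation.Nullary using (yes; no)
  import Relation.Binary.PropositionalEquality as ≡
  open PZ using (negP; oneP; _+P_)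
  open Characteristic polyRing X
  open CommutativeRing polyRing using (setoid; *-congʳ; *-cong; *-identityˡ; +-congʳ)

  constant : ℤ → PolyZ
  constant a = a ∷ []

  constant-* : ∀ a b → constant (a ℤ.* b) ≋ constant a *P constant b
  constant-* a b = ∷-cong (≡.sym (ℤₚ.+-identityʳ _)) ≋-refl

  -- Integers as solver coefficients: numerals are computed with, while a number of branches can
  -- remain a variable standing for a constant polynomial.
  constants : CommutativeRing.rawRing ℤₚ.+-*-commutativeRing -Raw-AlmostCommutative⟶ fromCommutativeRing polyRing
  constants = record
    { ⟦_⟧ = constant ; +-homo = λ a b → ≋-refl ; *-homo = constant-* ; -‿homo = λ a → ≋-refl ; 0-homo = 0∷[] ; 1-homo = ≋-refl }

  equal-constants : ∀ a b → Maybe (constant a ≋ constant b)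
  equal-constants a b with a ℤₚ.≟ b
  ... | yes ≡.refl = just ≋-refl
  ... | no _       = nothing

  open RingSolver (CommutativeRing.rawRing ℤₚ.+-*-commutativeRing) (fromCommutativeRing polyRing) constants equal-constants
    using (solve; con; _:=_; _:+_; _:*_; _:-_) public

  open import Relation.Binary.Reasoning.Setoid setoid

  ^-distrib-* : ∀ p q k → (p *P q) ^P k ≋ p ^P k *P q ^P k
  ^-distrib-* p q zero    = ≋-sym (*-identityˡ oneP)
  ^-distrib-* p q (suc k) = ≋-trans (*-congˡ (p *P q) (^-distrib-* p q k))
    (solve 4 (λ p q p′ q′ → (p :* q) :* (p′ :* q′) := (p :* p′) :* (q :* q′)) ≋-refl p q (p ^P k) (q ^P k))

  ^-cong : ∀ {p q} k → p ≋ q → p ^P k ≋ q ^P k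
  ^-cong zero    h = ≋-refl
  ^-cong (suc k) h = *-cong h (^-cong k h)

  deleted-replicate : ∀ L k Ls → deleted (replicate k L ++ Ls) ≋ φ L ^P k *P deleted Ls
  deleted-replicate L zero    Ls = ≋-sym (*-identityˡ _)
  deleted-replicate L (suc k) Ls = ≋-trans (deleted-∷ L (replicate k L ++ Ls))
    (≋-trans (*-congˡ (φ L) (deleted-replicate L k Ls)) (≋-sym (*-assoc (φ L) (φ L ^P k) (deleted Ls))))

  -- Each further equal branch multiplies both terms by φ L and adds one more copy of φ⁻ L. Counting
  -- k + 1 branches leaves one factor φ L inside the bracket and avoids an exponent k - 1.
  full-replicate : ∀ L k Ls → full (replicate (suc k) L ++ Ls) ≋
    φ L ^P k *P (φ L *P full Ls +P negP (constant (+ suc k) *P φ⁻ L *P deleted Ls))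
  full-replicate L zero    Ls = ≋-trans (full-∷ L Ls)
    (solve 4 (λ p q f d → p :* f :- q :* d := con (+ 1) :* (p :* f :- con (+ 1) :* q :* d)) ≋-refl (φ L) (φ⁻ L) (full Ls) (deleted Ls))
  full-replicate L (suc k) Ls = begin
    full (replicate (suc (suc k)) L ++ Ls)
      ≈⟨ full-∷ L (replicate (suc k) L ++ Ls) ⟩
    φ L *P full (replicate (suc k) L ++ Ls) +P negP (φ⁻ L *P deleted (replicate (suc k) L ++ Ls))
      ≈⟨ +-cong (*-congˡ (φ L) (full-replicate L k Ls)) (neg-cong (*-congˡ (φ⁻ L) (deleted-replicate L (suc k) Ls))) ⟩
    φ L *P (φ L ^P k *P (φ L *P full Ls +P negP (constant (+ suc k) *P φ⁻ L *P deleted Ls)))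
      +P negP (φ⁻ L *P (φ L *P φ L ^P k *P deleted Ls))
      ≈⟨ solve 6 (λ p q pk n f d →
           p :* (pk :* (p :* f :- n :* q :* d)) :- q :* (p :* pk :* d) := p :* pk :* (p :* f :- (con (+ 1) :+ n) :* q :* d))
           ≋-refl (φ L) (φ⁻ L) (φ L ^P k) (constant (+ suc k)) (full Ls) (deleted Ls) ⟩
    φ L ^P suc k *P (φ L *P full Ls +P negP (constant (+ suc (suc k)) *P φ⁻ L *P deleted Ls)) ∎

  x²≋ : ∀ k → x²-[ + k ] ≋ X *P X +P negP (constant (+ k))
  x²≋ k = ∷-cong (≡.sym (ℤₚ.+-identityˡ _)) ≋-refl

  φ-2 : φ 2 ≋ x²-[ + 1 ]
  φ-2 = coeffwise λ { 0 → ≡.refl ; 1 → ≡.refl ; 2 → ≡.refl ; (suc (suc (suc i))) → ≡.refl }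

  φ-3 : φ 3 ≋ X *P x²-[ + 2 ]
  φ-3 = coeffwise λ { 0 → ≡.refl ; 1 → ≡.refl ; 2 → ≡.refl ; 3 → ≡.refl ; (suc (suc (suc (suc i)))) → ≡.refl }

  φ-4 : φ 4 ≋ x²-x-1 *P x²+x-1
  φ-4 = coeffwise λ { 0 → ≡.refl ; 1 → ≡.refl ; 2 → ≡.refl ; 3 → ≡.refl ; 4 → ≡.refl ; (suc (suc (suc (suc (suc i))))) → ≡.refl }

  φ-5 : φ 5 ≋ X *P x²-[ + 1 ] *P x²-[ + 3 ]
  φ-5 = coeffwise λ { 0 → ≡.refl ; 1 → ≡.refl ; 2 → ≡.refl ; 3 → ≡.refl ; 4 → ≡.refl ; 5 → ≡.refl ; (suc (suc (suc (suc (suc (suc i)))))) → ≡.refl }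

  full-star : ∀ k → full (replicate (suc k) 1 ++ []) ≋ X ^P k *P x²-[ + suc k ]
  full-star k = begin
    full (replicate (suc k) 1 ++ [])
      ≈⟨ full-replicate 1 k [] ⟩
    φ 1 ^P k *P (φ 1 *P full [] +P negP (constant (+ suc k) *P oneP *P oneP))
      ≈⟨ *-cong (^-cong k φ-1) (+-congʳ {negP (constant (+ suc k) *P oneP *P oneP)} (*-cong φ-1 full-[])) ⟩
    X ^P k *P (X *P (X *P oneP) +P negP (constant (+ suc k) *P oneP *P oneP))
      ≈⟨ solve 3 (λ x xᵏ n → xᵏ :* (x :* (x :* con (+ 1)) :- n :* con (+ 1) :* con (+ 1)) := xᵏ :* (x :* x :- n))
           ≋-refl X (X ^P k) (constant (+ suc k)) ⟩
    X ^P k *P (X *P X +P negP (constant (+ suc k)))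
      ≈⟨ *-congˡ (X ^P k) (≋-sym (x²≋ (suc k))) ⟩
    X ^P k *P x²-[ + suc k ] ∎

  full-twos : ∀ k → full (replicate (suc k) 2 ++ []) ≋ X *P (x²-[ + 1 ] ^P k) *P x²-[ + (suc k ℕ.+ 1) ]
  full-twos k = begin
    full (replicate (suc k) 2 ++ [])
      ≈⟨ full-replicate 2 k [] ⟩
    φ 2 ^P k *P (φ 2 *P full [] +P negP (constant (+ suc k) *P φ 1 *P oneP))
      ≈⟨ *-cong (^-cong k φ-2) (+-cong (*-cong (≋-trans φ-2 (x²≋ 1)) full-[]) (neg-cong (*-congʳ {oneP} (*-congˡ (constant (+ suc k)) φ-1)))) ⟩
    x²-[ + 1 ] ^P k *P ((X *P X +P negP (constant (+ 1))) *P (X *P oneP) +P negP (constant (+ suc k) *P X *P oneP))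
      ≈⟨ solve 3 (λ x t n → t :* ((x :* x :- con (+ 1)) :* (x :* con (+ 1)) :- n :* x :* con (+ 1)) := x :* t :* (x :* x :- (n :+ con (+ 1))))
           ≋-refl X (x²-[ + 1 ] ^P k) (constant (+ suc k)) ⟩
    X *P x²-[ + 1 ] ^P k *P (X *P X +P negP (constant (+ (suc k ℕ.+ 1))))
      ≈⟨ *-congˡ (X *P x²-[ + 1 ] ^P k) (≋-sym (x²≋ (suc k ℕ.+ 1))) ⟩
    X *P x²-[ + 1 ] ^P k *P x²-[ + (suc k ℕ.+ 1) ] ∎

  full-threes : ∀ k → full (1 ∷ replicate (suc k) 3 ++ []) ≋
    X ^P suc k *P x²-[ + 1 ] *P (x²-[ + 2 ] ^P k) *P x²-[ + (suc k ℕ.+ 2) ]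
  full-threes k = begin
    full (1 ∷ replicate (suc k) 3 ++ [])
      ≈⟨ full-∷ 1 (replicate (suc k) 3 ++ []) ⟩
    φ 1 *P full (replicate (suc k) 3 ++ []) +P negP (oneP *P deleted (replicate (suc k) 3 ++ []))
      ≈⟨ +-cong (*-cong φ-1 F) (neg-cong (*-congˡ oneP P)) ⟩
    X *P (X ^P k *P t ^P k *P (X *P x²-2 *P (X *P oneP) +P negP (N *P x²-1 *P oneP)))
      +P negP (oneP *P (X *P x²-2 *P (X ^P k *P t ^P k) *P oneP))
      -- Besides the common factor this is x⁴ - (n + 3) x² + (n + 2), which has the root x² = 1.
      ≈⟨ solve 4 (λ x xᵏ t n →
           x :* (xᵏ :* t :* (x :* (x :* x :- con (+ 2)) :* (x :* con (+ 1)) :- n :* (x :* x :- con (+ 1)) :* con (+ 1)))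
             :- con (+ 1) :* (x :* (x :* x :- con (+ 2)) :* (xᵏ :* t) :* con (+ 1))
           := x :* xᵏ :* (x :* x :- con (+ 1)) :* t :* (x :* x :- (n :+ con (+ 2))))
           ≋-refl X (X ^P k) (t ^P k) N ⟩
    X ^P suc k *P x²-1 *P t ^P k *P (X *P X +P negP (constant (+ (suc k ℕ.+ 2))))
      ≈⟨ *-cong (*-congʳ (*-congˡ (X ^P suc k) (≋-sym (x²≋ 1)))) (≋-sym (x²≋ (suc k ℕ.+ 2))) ⟩
    X ^P suc k *P x²-[ + 1 ] *P t ^P k *P x²-[ + (suc k ℕ.+ 2) ] ∎
    where
    t N x²-1 x²-2 : PolyZ
    t = x²-[ + 2 ]
    N = constant (+ suc k)
    x²-1 = X *P X +P negP (constant (+ 1))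
    x²-2 = X *P X +P negP (constant (+ 2))
    φ₃ : φ 3 ≋ X *P x²-2
    φ₃ = ≋-trans φ-3 (*-congˡ X (x²≋ 2))
    φ₃ᵏ : φ 3 ^P k ≋ X ^P k *P t ^P k
    φ₃ᵏ = ≋-trans (^-cong k φ-3) (^-distrib-* X t k)
    F : full (replicate (suc k) 3 ++ []) ≋ X ^P k *P t ^P k *P (X *P x²-2 *P (X *P oneP) +P negP (N *P x²-1 *P oneP))
    F = ≋-trans (full-replicate 3 k [])
      (*-cong φ₃ᵏ (+-cong (*-cong φ₃ full-[]) (neg-cong (*-congʳ {oneP} (*-congˡ N (≋-trans φ-2 (x²≋ 1)))))))
    P : deleted (replicate (suc k) 3 ++ []) ≋ X *P x²-2 *P (X ^P k *P t ^P k) *P oneP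
    P = ≋-trans (deleted-replicate 3 (suc k) []) (*-congʳ {oneP} (*-cong φ₃ φ₃ᵏ))

  full-fives : ∀ k → full (1 ∷ 2 ∷ replicate (suc k) 5 ++ []) ≋
    X ^P suc k *P (x²-[ + 1 ] ^P suc k) *P x²-x-1 *P x²+x-1 *P (x²-[ + 3 ] ^P k) *P x²-[ + (suc k ℕ.+ 3) ]
  full-fives k = begin
    full (1 ∷ 2 ∷ replicate (suc k) 5 ++ [])
      ≈⟨ full-∷ 1 (2 ∷ replicate (suc k) 5 ++ []) ⟩
    φ 1 *P full (2 ∷ replicate (suc k) 5 ++ []) +P negP (oneP *P deleted (2 ∷ replicate (suc k) 5 ++ []))
      ≈⟨ +-cong (*-cong φ-1 (≋-trans (full-∷ 2 (replicate (suc k) 5 ++ [])) (+-cong (*-cong φ₂ F) (neg-cong (*-cong φ-1 P)))))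
                (neg-cong (*-congˡ oneP (≋-trans (deleted-∷ 2 (replicate (suc k) 5 ++ [])) (*-cong φ₂ P)))) ⟩
    X *P (x²-1 *P (W *P (X *P x²-1 *P x²-3 *P (X *P oneP) +P negP (N *P (x²-x-1 *P x²+x-1) *P oneP)))
        +P negP (X *P (X *P x²-1 *P x²-3 *P W *P oneP)))
      +P negP (oneP *P (x²-1 *P (X *P x²-1 *P x²-3 *P W *P oneP)))
      -- After extracting x (x² - 1) w, what is left is (x² - 3)(x⁴ - 3x² + 1) - n (x⁴ - 3x² + 1),
      -- and x⁴ - 3x² + 1 is g h.
      ≈⟨ solve 5 (λ x xᵏ t s n →
           let x²-1 = x :* x :- con (+ 1)
               x²-3 = x :* x :- con (+ 3)
               g    = x :* x :- x :- con (+ 1)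
               h    = x :* x :+ x :- con (+ 1)
               w    = xᵏ :* t :* s in
           x :* (x²-1 :* (w :* (x :* x²-1 :* x²-3 :* (x :* con (+ 1)) :- n :* (g :* h) :* con (+ 1))) :- x :* (x :* x²-1 :* x²-3 :* w :* con (+ 1)))
             :- con (+ 1) :* (x²-1 :* (x :* x²-1 :* x²-3 :* w :* con (+ 1)))
           := x :* xᵏ :* (x²-1 :* t) :* g :* h :* s :* (x :* x :- (n :+ con (+ 3))))
           ≋-refl X (X ^P k) (x²-[ + 1 ] ^P k) (x²-[ + 3 ] ^P k) N ⟩
    X ^P suc k *P (x²-1 *P x²-[ + 1 ] ^P k) *P x²-x-1 *P x²+x-1 *P x²-[ + 3 ] ^P k *P (X *P X +P negP (constant (+ (suc k ℕ.+ 3))))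
      ≈⟨ *-cong (*-congʳ (*-congʳ (*-congʳ (*-congˡ (X ^P suc k) (*-congʳ (≋-sym (x²≋ 1))))))) (≋-sym (x²≋ (suc k ℕ.+ 3))) ⟩
    X ^P suc k *P x²-[ + 1 ] ^P suc k *P x²-x-1 *P x²+x-1 *P x²-[ + 3 ] ^P k *P x²-[ + (suc k ℕ.+ 3) ] ∎
    where
    N x²-1 x²-3 W : PolyZ
    N = constant (+ suc k)
    x²-1 = X *P X +P negP (constant (+ 1))
    x²-3 = X *P X +P negP (constant (+ 3))
    W = X ^P k *P x²-[ + 1 ] ^P k *P x²-[ + 3 ] ^P k
    φ₂ : φ 2 ≋ x²-1
    φ₂ = ≋-trans φ-2 (x²≋ 1)
    φ₅ : φ 5 ≋ X *P x²-1 *P x²-3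
    φ₅ = ≋-trans φ-5 (*-cong (*-congˡ X (x²≋ 1)) (x²≋ 3))
    φ₅ᵏ : φ 5 ^P k ≋ W
    φ₅ᵏ = ≋-trans (^-cong k φ-5) (≋-trans (^-distrib-* (X *P x²-[ + 1 ]) x²-[ + 3 ] k) (*-congʳ (^-distrib-* X x²-[ + 1 ] k)))
    F : full (replicate (suc k) 5 ++ []) ≋ W *P (X *P x²-1 *P x²-3 *P (X *P oneP) +P negP (N *P (x²-x-1 *P x²+x-1) *P oneP))
    F = ≋-trans (full-replicate 5 k []) (*-cong φ₅ᵏ (+-cong (*-cong φ₅ full-[]) (neg-cong (*-congʳ {oneP} (*-congˡ N φ-4)))))
    P : deleted (replicate (suc k) 5 ++ []) ≋ X *P x²-1 *P x²-3 *P W *P oneP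
    P = ≋-trans (deleted-replicate 5 (suc k) []) (*-congʳ {oneP} (*-cong φ₅ φ₅ᵏ))

-- The equivalence and the stated polynomials.

open import Defs
open import Data.Nat using (ℕ; suc; _≤_; _∸_; _+_)
open import Data.Integer using (+_)
open import Data.List using (List; []; _∷_)
open import Data.Product using (_×_; _,_; Σ)
open import Data.Sum using (_⊎_; inj₁; inj₂)
open import Function.Bundles using (_⇔_; mk⇔)
open Determinants
open StarlikeDeterminants
open IntegerPolynomials
open PathRatios
open LengthClassification
open RootEvaluation
open ClosedForms
import Data.Nat.Properties as ℕₚ
import Data.Integer as ℤ
import Data.Integer.Properties as ℤₚ
open import Relation.Binary.PropositionalEquality using (_≡_; subst; sym; trans)
open _≋_

Family : List ℕ → Set
Family ns =
  (Σ ℕ λ n₅ → 1 ≤ n₅ × starlike ns ≅ starlike (1 ∷ 1 ∷ 0 ∷ 0 ∷ n₅ ∷ []))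
  ⊎ (Σ ℕ λ n₃ → 2 ≤ n₃ × starlike ns ≅ starlike (1 ∷ 0 ∷ n₃ ∷ []))
  ⊎ (Σ ℕ λ n₂ → 3 ≤ n₂ × starlike ns ≅ starlike (0 ∷ n₂ ∷ []))
  ⊎ (Σ ℕ λ n₁ → 4 ≤ n₁ × starlike ns ≅ starlike (n₁ ∷ []))

charPoly-≅starlike : ∀ ms ns → starlike ms ≅ starlike ns → charPoly (starlike ms) ≋ Characteristic.full polyRing X (pathLengths 1 ns)
charPoly-≅starlike ms ns iso = ≋-trans (charPoly-iso (starlike ms) (starlike ns) iso) (charPoly-starlike ns)

-- The four lower bounds on the multiplicities are all the one bound n ≥ 2, that is c ≥ 4, read
-- through the respective count.
solution⇒family : ∀ ns n (2≤n : + 2 ℤ.≤ n) {n₁ n₂ n₃ n₄ n₅ rest} → pathLengths 1 ns ≡ grouped n₁ n₂ n₃ n₄ n₅ rest →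
  Classification.Solution n 2≤n n₁ n₂ n₃ n₄ n₅ rest → Family ns
solution⇒family ns n 2≤n e (Classification.all-1 {n₁} h) = inj₂ (inj₂ (inj₂ (n₁ ,
  ℤₚ.drop‿+≤+ (subst (+ 4 ℤ.≤_) (sym h) (ℤₚ.+-monoˡ-≤ (+ 2) 2≤n)) , starlike-cong ns (n₁ ∷ []) e)))
solution⇒family ns n 2≤n e (Classification.all-2 {n₂} h) = inj₂ (inj₂ (inj₁ (n₂ ,
  ℤₚ.drop‿+≤+ (subst (+ 3 ℤ.≤_) (sym h) (ℤₚ.+-monoˡ-≤ (+ 1) 2≤n)) , starlike-cong ns (0 ∷ n₂ ∷ []) e)))
solution⇒family ns n 2≤n e (Classification.one-1-all-3 {n₃} h) = inj₂ (inj₁ (n₃ ,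
  ℤₚ.drop‿+≤+ (subst (+ 2 ℤ.≤_) (sym h) 2≤n) , starlike-cong ns (1 ∷ 0 ∷ n₃ ∷ []) e))
solution⇒family ns n 2≤n e (Classification.one-1-one-2-all-5 {n₅} h) = inj₁ (n₅ ,
  ℕₚ.+-cancelʳ-≤ 1 1 n₅ (ℤₚ.drop‿+≤+ (subst (+ 2 ℤ.≤_) (sym h) 2≤n)) , starlike-cong ns (1 ∷ 1 ∷ 0 ∷ 0 ∷ n₅ ∷ []) e)

root⇒family : ∀ ns n → + 2 ℤ.≤ n → ∀ q → charPoly (starlike ns) ≋ q *P x²-[ n ℤ.+ + 2 ] → Family ns
root⇒family ns n 2≤n q h = solution⇒family ns n 2≤n {head₀ ns} {head₀ t₁} {head₀ t₂} {head₀ t₃} {head₀ t₄} {pathLengths 6 (tail₀ t₄)} (lengths-grouped ns)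
  (Classification.classify n 2≤n (head₀ ns) (head₀ t₁) (head₀ t₂) (head₀ t₃) (head₀ t₄) (pathLengths 6 (tail₀ t₄)) (lengths-≥ 6 (tail₀ t₄))
    (subst (λ Ls → Ratio.A (n ℤ.+ + 2) 4≤c Ls ≡ + 0) (lengths-grouped ns)
      (Evaluation.root⇒A≡0 (n ℤ.+ + 2) 4≤c (pathLengths 1 ns) q (≋-trans (≋-sym (charPoly-starlike ns)) h))))
  where
  4≤c = ℤₚ.+-monoˡ-≤ (+ 2) 2≤n
  t₁ = tail₀ ns
  t₂ = tail₀ t₁
  t₃ = tail₀ t₂
  t₄ = tail₀ t₃

formI⇒family : ∀ ns → FormI (charPoly (starlike ns)) → Family ns
formI⇒family ns (t₁ , t₂ , t₃ , t₄ , t₅ , c , 4≤c , h) =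
  root⇒family ns (c ℤ.- + 2) (ℤₚ.+-monoˡ-≤ (ℤ.- + 2) 4≤c)
    ((X ^P t₁) *P (x²-[ + 1 ] ^P t₂) *P (x²-[ + 2 ] ^P t₃) *P ((x²-x-1 *P x²+x-1) ^P t₄) *P (x²-[ + 3 ] ^P t₅))
    (coeffwise (subst (λ c → charPoly (starlike ns) ≈P formI t₁ t₂ t₃ t₄ t₅ c) c≡ h))
  where
  c≡ : c ≡ c ℤ.- + 2 ℤ.+ + 2
  c≡ = sym (trans (ℤₚ.+-assoc c (ℤ.- + 2) (+ 2)) (ℤₚ.+-identityʳ c))

charPoly-fives : ∀ ns n₅ → 1 ≤ n₅ → starlike ns ≅ starlike (1 ∷ 1 ∷ 0 ∷ 0 ∷ n₅ ∷ []) →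
  charPoly (starlike ns) ≋ (X ^P n₅) *P (x²-[ + 1 ] ^P n₅) *P x²-x-1 *P x²+x-1 *P (x²-[ + 3 ] ^P (n₅ ∸ 1)) *P x²-[ + (n₅ + 3) ]
charPoly-fives ns n₅@(suc k) _ iso = ≋-trans (charPoly-≅starlike ns (1 ∷ 1 ∷ 0 ∷ 0 ∷ n₅ ∷ []) iso) (full-fives k)

charPoly-threes : ∀ ns n₃ → 2 ≤ n₃ → starlike ns ≅ starlike (1 ∷ 0 ∷ n₃ ∷ []) →
  charPoly (starlike ns) ≋ (X ^P n₃) *P x²-[ + 1 ] *P (x²-[ + 2 ] ^P (n₃ ∸ 1)) *P x²-[ + (n₃ + 2) ]
charPoly-threes ns n₃@(suc k) _ iso = ≋-trans (charPoly-≅starlike ns (1 ∷ 0 ∷ n₃ ∷ []) iso) (full-threes k)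

charPoly-twos : ∀ ns n₂ → 3 ≤ n₂ → starlike ns ≅ starlike (0 ∷ n₂ ∷ []) →
  charPoly (starlike ns) ≋ X *P (x²-[ + 1 ] ^P (n₂ ∸ 1)) *P x²-[ + (n₂ + 1) ]
charPoly-twos ns n₂@(suc k) _ iso = ≋-trans (charPoly-≅starlike ns (0 ∷ n₂ ∷ []) iso) (full-twos k)

charPoly-star : ∀ ns n₁ → 4 ≤ n₁ → starlike ns ≅ starlike (n₁ ∷ []) →
  charPoly (starlike ns) ≋ (X ^P (n₁ ∸ 1)) *P x²-[ + n₁ ]
charPoly-star ns n₁@(suc k) _ iso = ≋-trans (charPoly-≅starlike ns (n₁ ∷ []) iso) (full-star k)

-- The closed forms are already of the required shape up to powers with exponent 0 or 1. These
-- unfold to 1 and p · 1, which accounts for the constants 1 in the solver equations.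
family⇒formI : ∀ ns → Family ns → FormI (charPoly (starlike ns))
family⇒formI ns (inj₁ (n₅ , 1≤n₅ , iso)) =
  n₅ , n₅ , 0 , 1 , n₅ ∸ 1 , + (n₅ + 3) , ℤ.+≤+ (ℕₚ.+-monoˡ-≤ 3 1≤n₅) , coeff≡ (≋-trans (charPoly-fives ns n₅ 1≤n₅ iso)
    (solve 6 (λ x t g h s d → x :* t :* g :* h :* s :* d := x :* t :* con (+ 1) :* (g :* h :* con (+ 1)) :* s :* d) ≋-refl
      (X ^P n₅) (x²-[ + 1 ] ^P n₅) x²-x-1 x²+x-1 (x²-[ + 3 ] ^P (n₅ ∸ 1)) x²-[ + (n₅ + 3) ]))
family⇒formI ns (inj₂ (inj₁ (n₃ , 2≤n₃ , iso))) =
  n₃ , 1 , n₃ ∸ 1 , 0 , 0 , + (n₃ + 2) , ℤ.+≤+ (ℕₚ.+-monoˡ-≤ 2 2≤n₃) , coeff≡ (≋-trans (charPoly-threes ns n₃ 2≤n₃ iso)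
    (solve 4 (λ x t s d → x :* t :* s :* d := x :* (t :* con (+ 1)) :* s :* con (+ 1) :* con (+ 1) :* d) ≋-refl
      (X ^P n₃) x²-[ + 1 ] (x²-[ + 2 ] ^P (n₃ ∸ 1)) x²-[ + (n₃ + 2) ]))
family⇒formI ns (inj₂ (inj₂ (inj₁ (n₂ , 3≤n₂ , iso)))) =
  1 , n₂ ∸ 1 , 0 , 0 , 0 , + (n₂ + 1) , ℤ.+≤+ (ℕₚ.+-monoˡ-≤ 1 3≤n₂) , coeff≡ (≋-trans (charPoly-twos ns n₂ 3≤n₂ iso)
    (solve 3 (λ x t d → x :* t :* d := x :* con (+ 1) :* t :* con (+ 1) :* con (+ 1) :* con (+ 1) :* d) ≋-refl
      X (x²-[ + 1 ] ^P (n₂ ∸ 1)) x²-[ + (n₂ + 1) ]))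
family⇒formI ns (inj₂ (inj₂ (inj₂ (n₁ , 4≤n₁ , iso)))) =
  n₁ ∸ 1 , 0 , 0 , 0 , 0 , + n₁ , ℤ.+≤+ 4≤n₁ , coeff≡ (≋-trans (charPoly-star ns n₁ 4≤n₁ iso)
    (solve 2 (λ x d → x :* d := x :* con (+ 1) :* con (+ 1) :* con (+ 1) :* con (+ 1) :* d) ≋-refl
      (X ^P (n₁ ∸ 1)) x²-[ + n₁ ]))

theorem4p6 : (ns : List ℕ) →
    QuadraticPoly (charPoly (starlike ns)) →
    ProperInducedSub K13 (starlike ns) →
    (FormI (charPoly (starlike ns)) ⇔
    ((Σ ℕ λ n₅ → 1 ≤ n₅ × starlike ns ≅ starlike (1 ∷ 1 ∷ 0 ∷ 0 ∷ n₅ ∷ []))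
    ⊎ (Σ ℕ λ n₃ → 2 ≤ n₃ × starlike ns ≅ starlike (1 ∷ 0 ∷ n₃ ∷ []))
    ⊎ (Σ ℕ λ n₂ → 3 ≤ n₂ × starlike ns ≅ starlike (0 ∷ n₂ ∷ []))
    ⊎ (Σ ℕ λ n₁ → 4 ≤ n₁ × starlike ns ≅ starlike (n₁ ∷ []))))
    × (∀ n₅ → 1 ≤ n₅ → starlike ns ≅ starlike (1 ∷ 1 ∷ 0 ∷ 0 ∷ n₅ ∷ []) →
    charPoly (starlike ns) ≈P
    (X ^P n₅) *P (x²-[ + 1 ] ^P n₅) *P x²-x-1 *P x²+x-1
    *P (x²-[ + 3 ] ^P (n₅ ∸ 1)) *P x²-[ + (n₅ + 3) ])
    × (∀ n₃ → 2 ≤ n₃ → starlike ns ≅ starlike (1 ∷ 0 ∷ n₃ ∷ []) →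
    charPoly (starlike ns) ≈P
    (X ^P n₃) *P x²-[ + 1 ] *P (x²-[ + 2 ] ^P (n₃ ∸ 1)) *P x²-[ + (n₃ + 2) ])
    × (∀ n₂ → 3 ≤ n₂ → starlike ns ≅ starlike (0 ∷ n₂ ∷ []) →
    charPoly (starlike ns) ≈P
    X *P (x²-[ + 1 ] ^P (n₂ ∸ 1)) *P x²-[ + (n₂ + 1) ])
    × (∀ n₁ → 4 ≤ n₁ → starlike ns ≅ starlike (n₁ ∷ []) →
    charPoly (starlike ns) ≈P
    (X ^P (n₁ ∸ 1)) *P x²-[ + n₁ ])
theorem4p6 ns _ _ =
  mk⇔ (formI⇒family ns) (family⇒formI ns) ,
  (λ n₅ p iso → coeff≡ (charPoly-fives ns n₅ p iso)) ,
  (λ n₃ p iso → coeff≡ (charPoly-threes ns n₃ p iso)) ,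
  (λ n₂ p iso → coeff≡ (charPoly-twos ns n₂ p iso)) ,
  (λ n₁ p iso → coeff≡ (charPoly-star ns n₁ p iso))
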